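{- Let $\mathsf{M}$ be a sparse paving matroid of rank $k$ on $n$ elements. Then (1) the coefficient sequence of $Y_{\mathsf{M}}(t)$ is unimodal; and (2) the coefficient sequence of $Y_{\mathsf{M}}(t)$ is log-concave with no internal zeros.
   Context: A matroid is paving if every circuit has size at least its rank, and sparse paving if it and its dual are paving. For a matroid $\mathsf{M}$, $\mathcal{L}(\mathsf{M})$ is its lattice of flats, $\mathsf{M}|_F$, $\mathsf{M}/F$ restriction and contraction, $\mathrm{rk}(\mathsf{M}/F)=\mathrm{rk}(\mathsf{M})-\mathrm{rk}(F)$. For loopless $\mathsf{M}$, $\mu_{\mathsf{M}}=\mu(\emptyset,E)$ in $\mathcal{L}(\mathsf{M})$ ($=1$ in rank 0), $\chi_{\mathsf{M}}(t)=\sum_{F}\mu_{\mathsf{M}|_F}t^{\mathrm{rk}(\mathsf{M}/F)}$; the inverse Kazhdan–Lusztig polynomial $Q_{\mathsf{M}}(t)$ is the unique assignment with $Q_{\mathsf{M}}=1$ in rank 0, $\deg Q_{\mathsf{M}}<\mathrm{rk}(\mathsf{M})/2$ in positive rank, and $(-t)^{\mathrm{rk}(\mathsf{M})}Q_{\mathsf{M}}(t^{ -1})=\sum_{F\in\mathcal{L}(\mathsf{M})}(-1)^{\mathrm{rk}(F)}Q_{\mathsf{M}|_F}(t)t^{\mathrm{rk}(\mathsf{M}/F)}\chi_{\mathsf{M}/F}(t^{ -1})$. The inverse $Z$-polynomial of loopless $\mathsf{M}$ is $Y_{\mathsf{M}}(t)=(-1)^{\mathrm{rk}(\mathsf{M})}\sum_{F\in\mathcal{L}(\mathsf{M})}(-1)^{\mathrm{rk}(F)}Q_{\mathsf{M}|_F}(t)t^{\mathrm{rk}(\mathsf{M}/F)}\mu_{\mathsf{M}/F}$;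 for $\mathsf{M}$ with loops, $Y_{\mathsf{M}}:=Y$ of $\mathsf{M}$ with loops deleted. Writing $Y_{\mathsf{M}}(t)=\sum_{i=0}^k a_it^i$: unimodal means $a_0\le\cdots\le a_j\ge a_{j+1}\ge\cdots\ge a_k$ for some $j$; log-concave means $a_i^2\ge a_{i-1}a_{i+1}$ for $0<i<k$; no internal zeros means there are no $i<j<l$ with $a_i,a_l\neq0$ and $a_j=0$. -}

module Defs where

open import Data.Bool using (Bool; true; false; if_then_else_; _∧_; not)
open import Data.Nat as ℕ using (ℕ; zero; suc; _≤_; _<_; _∸_; _≡ᵇ_; _≤ᵇ_; _<ᵇ_)
open import Data.Integer as ℤ using (ℤ; +_; -_)
open import Data.Fin using (Fin)
open import Data.Fin.Subset using (Subset; _∪_; _∩_; _─_; ∁; ⁅_⁆; ∣_∣; _⊆_; _∈_)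
open import Data.Fin.Subset.Properties using (_⊆?_; _∈?_)
open import Data.Vec using ([]; _∷_; tabulate)
open import Data.List using (List; []; _∷_; map; _++_; foldr; upTo; allFin)
open import Data.Product using (_×_; Σ; ∃; ∃-syntax; _,_)
open import Relation.Nullary.Decidable using (⌊_⌋)
open import Relation.Binary.PropositionalEquality using (_≡_; _≢_)

allSubsets : ∀ n → List (Subset n)
allSubsets zero    = [] ∷ []
allSubsets (suc n) = map (true ∷_) (allSubsets n) ++ map (false ∷_) (allSubsets n)

allᵇ : ∀ {A : Set} → (A → Bool) → List A → Bool
allᵇ p []       = true
allᵇ p (x ∷ xs) = p x ∧ allᵇ p xs

filterᵇ : ∀ {A : Set} → (A → Bool) → List A → List A
filterᵇ p []       = []
filterᵇ p (x ∷ xs) = if p x then x ∷ filterᵇ p xs else filterᵇ p xs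

-- Raw matroids: a ground set E ⊆ Fin N together with a rank function.
-- Working inside a fixed universe Fin N makes restriction, contraction,
-- deletion of loops and duals simple operations on the data.

record RawMatroid (N : ℕ) : Set where
  constructor mkRaw
  field
    E  : Subset N
    rk : Subset N → ℕ

open RawMatroid public

module _ {N : ℕ} where

  rank : RawMatroid N → ℕ
  rank M = rk M (E M)

  record IsMatroid (M : RawMatroid N) : Set where
    field
      R1 : ∀ A → A ⊆ E M → rk M A ≤ ∣ A ∣
      R2 : ∀ A B → A ⊆ B → B ⊆ E M → rk M A ≤ rk M B
      R3 : ∀ A B → A ⊆ E M → B ⊆ E M →
           rk M (A ∪ B) ℕ.+ rk M (A ∩ B) ≤ rk M A ℕ.+ rk M B

  Loopless : RawMatroid N → Set
  Loopless M = ∀ e → e ∈ E M → rk M ⁅ e ⁆ ≡ 1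

  restrict : RawMatroid N → Subset N → RawMatroid N
  restrict M F = mkRaw F (rk M)

  contract : RawMatroid N → Subset N → RawMatroid N
  contract M F = mkRaw (E M ─ F) (λ A → rk M (A ∪ F) ∸ rk M F)

  deleteLoops : RawMatroid N → RawMatroid N
  deleteLoops M = mkRaw (E M ∩ tabulate (λ e → not (rk M ⁅ e ⁆ ≡ᵇ 0))) (rk M)

  dual : RawMatroid N → RawMatroid N
  dual M = mkRaw (E M) (λ A → (∣ A ∣ ℕ.+ rk M (E M ─ A)) ∸ rk M (E M))

  Independent : RawMatroid N → Subset N → Set
  Independent M A = A ⊆ E M × rk M A ≡ ∣ A ∣

  Circuit : RawMatroid N → Subset N → Set
  Circuit M C = C ⊆ E M × rk M C < ∣ C ∣ ×
                (∀ D → D ⊆ C → ∣ D ∣ < ∣ C ∣ → Independent M D)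

  Paving : RawMatroid N → Set
  Paving M = ∀ C → Circuit M C → rank M ≤ ∣ C ∣

  SparsePaving : RawMatroid N → Set
  SparsePaving M = Paving M × Paving (dual M)

  isFlatᵇ : RawMatroid N → Subset N → Bool
  isFlatᵇ M F = ⌊ F ⊆? E M ⌋ ∧
    allᵇ (λ e → if ⌊ e ∈? E M ⌋ ∧ not ⌊ e ∈? F ⌋
               then rk M F <ᵇ rk M (F ∪ ⁅ e ⁆) else true) (allFin N)

  flats : RawMatroid N → List (Subset N)
  flats M = filterᵇ (isFlatᵇ M) (allSubsets N)

Σℤ : List ℤ → ℤ
Σℤ = foldr ℤ._+_ (+ 0)

sign : ℕ → ℤ
sign zero    = + 1
sign (suc r) = - sign r

-- Möbius function μ(∅,B) in the lattice of flats (∅ is the bottom flat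
-- for loopless M).  μ(∅,∅) = 1, μ(∅,B) = - Σ_{C flat, C ⊊ B} μ(∅,C).
-- The fuel argument is only for termination; fuel suc N is enough.

module _ {N : ℕ} where

  mobF : ℕ → RawMatroid N → Subset N → ℤ
  mobF zero    M B = + 0
  mobF (suc f) M B =
    if ∣ B ∣ ≡ᵇ 0 then + 1
    else - Σℤ (map (mobF f M)
                 (filterᵇ (λ C → ⌊ C ⊆? B ⌋ ∧ (∣ C ∣ <ᵇ ∣ B ∣)) (flats M)))

  mu : RawMatroid N → ℤ
  mu M = mobF (suc N) M (E M)

-- Polynomials with integer coefficients, as coefficient sequences
-- (p i = coefficient of t^i).

Poly : Set
Poly = ℕ → ℤ

_⊕_ : Poly → Poly → Poly
(p ⊕ q) i = p i ℤ.+ q i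

zeroP : Poly
zeroP _ = + 0

sumP : List Poly → Poly
sumP = foldr _⊕_ zeroP

scale : ℤ → Poly → Poly
scale c p i = c ℤ.* p i

_⊛_ : Poly → Poly → Poly
(p ⊛ q) i = Σℤ (map (λ j → p j ℤ.* q (i ∸ j)) (upTo (suc i)))

shift : ℕ → Poly → Poly
shift d p i = if d ≤ᵇ i then p (i ∸ d) else + 0

-- t^r · p(t⁻¹)  (for polynomials p of degree ≤ r)
rev : ℕ → Poly → Poly
rev r p i = if i ≤ᵇ r then p (r ∸ i) else + 0

module _ {N : ℕ} where

  chi : RawMatroid N → Poly
  chi M = sumP (map (λ F → shift (rank (contract M F)) (λ i → if i ≡ᵇ 0 then mu (restrict M F) else + 0))
                    (flats M))

  IsInverseKL : (RawMatroid N → Poly) → Set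
  IsInverseKL Q = ∀ M → IsMatroid M → Loopless M →
      (rank M ≡ 0 → ∀ i → Q M i ≡ (if i ≡ᵇ 0 then + 1 else + 0))
    × (0 < rank M → ∀ i → rank M ≤ 2 ℕ.* i → Q M i ≡ + 0)
    × (∀ i → scale (sign (rank M)) (rev (rank M) (Q M)) i ≡
             sumP (map (λ F → scale (sign (rk M F))
                               (Q (restrict M F) ⊛ rev (rank (contract M F)) (chi (contract M F))))
                       (flats M)) i)

  Yloopless : (RawMatroid N → Poly) → RawMatroid N → Poly
  Yloopless Q M = scale (sign (rank M))
    (sumP (map (λ F → scale (sign (rk M F) ℤ.* mu (contract M F))
                            (shift (rank (contract M F)) (Q (restrict M F))))
               (flats M)))

  Y : (RawMatroid N → Poly) → RawMatroid N → Poly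
  Y Q M = Yloopless Q (deleteLoops M)

Unimodal : ℕ → Poly → Set
Unimodal k a = ∃[ j ] (j ≤ k × (∀ i → i < j → a i ℤ.≤ a (suc i))
                             × (∀ i → j ≤ i → i < k → a (suc i) ℤ.≤ a i))

LogConcave : ℕ → Poly → Set
LogConcave k a = ∀ i → suc i < k → a i ℤ.* a (suc (suc i)) ℤ.≤ a (suc i) ℤ.* a (suc i)

NoInternalZeros : ℕ → Poly → Set
NoInternalZeros k a = ∀ i j l → i < j → j < l → l ≤ k → a i ≢ + 0 → a l ≢ + 0 → a j ≢ + 0

{-# OPTIONS --safe #-}

-- Write y_H = (-1)^{rk H} Y and q_H = (-1)^{rk H} Q for the restriction to H. The recursion for Q says
-- t^{rk G} q_G(1/t) = Σ_{H ≤ G} y_H, and Möbius inversion says q_G = Σ_{H ≤ G} t^{rk G - rk H} y_H; reversing the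
-- first and inducting on G shows that y_G is palindromic. As deg Q_G < rk G / 2, the first identity also gives
-- [t^i] y_G = - Σ_{H < G} [t^i] y_H for i ≤ rk G / 2, which determines y_G. For a sparse paving matroid of rank
-- k ≥ 2 with λ circuit-hyperplanes the proper flats are the Boolean ones and the circuit-hyperplanes, and one finds
--   Y_i = C(n,i) C(n-i-1,k-i-1) - λ C(k,i) for i < k/2,   Y_m = C(n,m) C(n-m-1,m-1) - λ C(k,m-1) for k = 2m.
-- Each (k-1)-set lies in at most one circuit-hyperplane, so (n-k+1) λ ≤ C(n,k), and λ = 0 if n = k. Given this,
-- the first half of the sequence is positive, increasing and log-concave, and symmetry does the rest.

module Submission where

open import Defs
open import Data.Bool using (Bool; T; true; false; if_then_else_; _∧_; _∨_; not) renaming (_≟_ to _≟ᵇ_)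
open import Data.Bool.Properties using (∧-zeroʳ; ∧-identityʳ)
open import Data.Empty using (⊥-elim)
open import Data.Unit using (tt)
open import Data.Fin using (Fin; zero; suc)
open import Data.Fin.Subset using (Subset; ⊤; ⊥; _∪_; _∩_; _─_; _-_; ∁; ⁅_⁆; ∣_∣; _⊆_; _∈_; _∉_)
open import Data.Fin.Subset.Properties
open import Data.Integer using (ℤ; +_; -_; -[1+_]; +≤+) renaming (_+_ to _+ᶻ_; _*_ to _*ᶻ_; _-_ to _-ᶻ_; _≤_ to _≤ᶻ_; ∣_∣ to absᶻ)
import Data.Integer.Properties as ℤₚ
import Data.Integer.Tactic.RingSolver as ℤ-Solver
open import Data.List using ([]; _∷_; map; _++_; upTo; allFin; applyUpTo)
open import Data.List.Properties using (map-∘; map-++; map-applyUpTo; map-cong)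
open import Data.List.Membership.Propositional using () renaming (_∈_ to _∈ˡ_)
open import Data.List.Membership.Propositional.Properties using (∈-allFin)
open import Data.List.Relation.Unary.Any using (here; there)
open import Data.Nat hiding (∣_-_∣)
open import Data.Nat.Combinatorics using (nCk+nC[k+1]≡[n+1]C[k+1]; nC1≡n; nCk≡nC[n∸k]; k>n⇒nCk≡0; nCk≡n!/k![n-k]!; k![n∸k]!∣n!) renaming (_C_ to infixl 8 _choose_)
open import Data.Nat.DivMod using (m/n*n≡m)
open import Data.Nat.Properties
import Data.Nat.Tactic.RingSolver as ℕ-Solver
open import Data.Product using (_×_; _,_; proj₁; proj₂; ∃)
open import Data.Sum using (inj₁; inj₂; [_,_]′)
import Data.Vec as Vec
open import Data.Vec.Properties using (lookup∘tabulate; lookup⇒[]=)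
open import Data.Vec using ([]; _∷_; here; there; tabulate)
open import Function using (_∘_; id)
open import Relation.Binary.Definitions using (Tri; tri<; tri≈; tri>)
open import Relation.Nullary using (¬_; Dec; yes; no; contradiction)
open import Relation.Nullary.Decidable using (⌊_⌋)
open import Relation.Binary.PropositionalEquality hiding ([_])

-- Finite sums and indicators

-- The degree bound on `Q` only makes the low coefficients of `Σ y_H` vanish, so `y` is computed for
-- `2 * i ≤ rk` and continued by symmetry. This is what singles out the middle coefficient for
-- `k = 2m`: a circuit-hyperplane has rank `2m - 1`, so index `m` lies in its upper half and is read
-- off at `m - 1`, which puts `C(k,m-1)` in place of `C(k,m)`. The formula for `Y_i` is a
-- difference. Writing the counting bound as `C(n,k) = (n-k+1) λ + σ` with a natural number `σ`, and
-- multiplying by `n - i`, turns it into a sum of natural terms. Positivity is then visible, and the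
-- inequalities become comparisons of polynomials with nonnegative coefficients in `λ`, `σ`,
-- `x = n - k` and an index. Contractions enter only through Möbius values, so only their flats are
-- studied. Loops can occur only in ranks 0 and 1, where at most two coefficients are left to
-- compare.

infixr 8 [_]_

[_]_ : Bool → ℤ → ℤ
[ b ] x = if b then x else + 0

-- Sums run over the whole Boolean cube, with an indicator cutting out the index set; exchanging
-- sums, isolating a term and reindexing then go by induction on the universe.
Σˢ : ∀ {n} → (Subset n → ℤ) → ℤ
Σˢ {zero}  g = g []
Σˢ {suc n} g = Σˢ (g ∘ (true ∷_)) +ᶻ Σˢ (g ∘ (false ∷_))

bool-ext : ∀ {b c} → (b ≡ true → c ≡ true) → (c ≡ true → b ≡ true) → b ≡ c
bool-ext {true}  {c}     f g = sym (f refl)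
bool-ext {false} {false} f g = refl
bool-ext {false} {true}  f g = g refl

¬true⇒false : ∀ {b} → b ≢ true → b ≡ false
¬true⇒false {true}  h = ⊥-elim (h refl)
¬true⇒false {false} h = refl

∧-true : ∀ {a b} → a ≡ true → b ≡ true → a ∧ b ≡ true
∧-true refl refl = refl

∧-true⁻ : ∀ {a b} → a ∧ b ≡ true → a ≡ true × b ≡ true
∧-true⁻ {true} {true} _ = refl , refl

[]-cong : ∀ b {x y} → (b ≡ true → x ≡ y) → [ b ] x ≡ [ b ] y
[]-cong true  h = h refl
[]-cong false h = refl

[]-true : ∀ {b} x → b ≡ true → [ b ] x ≡ x
[]-true x refl = refl

[]-false : ∀ {b} x → b ≢ true → [ b ] x ≡ + 0
[]-false {true}  x h = ⊥-elim (h refl)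
[]-false {false} x h = refl

[]-∧ : ∀ a b x → [ a ] [ b ] x ≡ [ a ∧ b ] x
[]-∧ true  b x = refl
[]-∧ false b x = refl

[]-swap : ∀ a b x → [ a ] [ b ] x ≡ [ b ] [ a ] x
[]-swap true  b     x = refl
[]-swap false true  x = refl
[]-swap false false x = refl

[]-*ˡ : ∀ b c x → c *ᶻ [ b ] x ≡ [ b ] (c *ᶻ x)
[]-*ˡ true  c x = refl
[]-*ˡ false c x = ℤₚ.*-zeroʳ c

[]-*ʳ : ∀ b x c → ([ b ] x) *ᶻ c ≡ [ b ] (x *ᶻ c)
[]-*ʳ true  x c = refl
[]-*ʳ false x c = refl

[]-zero : ∀ b → [ b ] (+ 0) ≡ + 0
[]-zero true  = refl
[]-zero false = refl

+-interchange : ∀ a b c d → (a +ᶻ b) +ᶻ (c +ᶻ d) ≡ (a +ᶻ c) +ᶻ (b +ᶻ d)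
+-interchange = ℤ-Solver.solve-∀

Σˢ-cong : ∀ {n} {f g : Subset n → ℤ} → (∀ A → f A ≡ g A) → Σˢ f ≡ Σˢ g
Σˢ-cong {zero}  h = h []
Σˢ-cong {suc n} h = cong₂ _+ᶻ_ (Σˢ-cong (h ∘ (true ∷_))) (Σˢ-cong (h ∘ (false ∷_)))

Σˢ-zero : ∀ n → Σˢ {n} (λ _ → + 0) ≡ + 0
Σˢ-zero zero = refl
Σˢ-zero (suc n) rewrite Σˢ-zero n = refl

Σˢ-+ : ∀ {n} (f g : Subset n → ℤ) → Σˢ (λ A → f A +ᶻ g A) ≡ Σˢ f +ᶻ Σˢ g
Σˢ-+ {zero}  f g = refl
Σˢ-+ {suc n} f g = trans
  (cong₂ _+ᶻ_ (Σˢ-+ (f ∘ (true ∷_)) (g ∘ (true ∷_))) (Σˢ-+ (f ∘ (false ∷_)) (g ∘ (false ∷_))))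
  (+-interchange (Σˢ (f ∘ (true ∷_))) _ _ _)

Σˢ-*ˡ : ∀ {n} c (f : Subset n → ℤ) → Σˢ (λ A → c *ᶻ f A) ≡ c *ᶻ Σˢ f
Σˢ-*ˡ {zero}  c f = refl
Σˢ-*ˡ {suc n} c f = trans
  (cong₂ _+ᶻ_ (Σˢ-*ˡ c (f ∘ (true ∷_))) (Σˢ-*ˡ c (f ∘ (false ∷_))))
  (sym (ℤₚ.*-distribˡ-+ c _ _))

Σˢ-*ʳ : ∀ {n} c (f : Subset n → ℤ) → Σˢ (λ A → f A *ᶻ c) ≡ Σˢ f *ᶻ c
Σˢ-*ʳ c f = trans (Σˢ-cong (λ A → ℤₚ.*-comm (f A) c)) (trans (Σˢ-*ˡ c f) (ℤₚ.*-comm c _))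

Σˢ-[] : ∀ {n} b (f : Subset n → ℤ) → Σˢ (λ A → [ b ] f A) ≡ [ b ] Σˢ f
Σˢ-[] {n} true  f = refl
Σˢ-[] {n} false f = Σˢ-zero n

Σˢ-swap : ∀ {m n} (f : Subset m → Subset n → ℤ) →
          Σˢ (λ A → Σˢ (λ B → f A B)) ≡ Σˢ (λ B → Σˢ (λ A → f A B))
Σˢ-swap {zero}  f = refl
Σˢ-swap {suc m} f = trans
  (cong₂ _+ᶻ_ (Σˢ-swap (f ∘ (true ∷_))) (Σˢ-swap (f ∘ (false ∷_))))
  (sym (Σˢ-+ (λ B → Σˢ (λ A → f (true ∷ A) B)) (λ B → Σˢ (λ A → f (false ∷ A) B))))

Σˢ-single : ∀ {n} (f : Subset n → ℤ) A₀ → (∀ A → A ≢ A₀ → f A ≡ + 0) → Σˢ f ≡ f A₀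
Σˢ-single {zero}  f [] h = refl
Σˢ-single {suc n} f (true ∷ A₀) h = trans
  (cong₂ _+ᶻ_ (Σˢ-single (f ∘ (true ∷_)) A₀ (λ A ne → h _ (λ { refl → ne refl })))
              (trans (Σˢ-cong (λ A → h (false ∷ A) (λ ()))) (Σˢ-zero n)))
  (ℤₚ.+-identityʳ _)
Σˢ-single {suc n} f (false ∷ A₀) h = trans
  (cong₂ _+ᶻ_ (trans (Σˢ-cong (λ A → h (true ∷ A) (λ ()))) (Σˢ-zero n))
              (Σˢ-single (f ∘ (false ∷_)) A₀ (λ A ne → h _ (λ { refl → ne refl }))))
  (ℤₚ.+-identityˡ _)

Σˢ-mono : ∀ {n} {f g : Subset n → ℤ} → (∀ A → f A ≤ᶻ g A) → Σˢ f ≤ᶻ Σˢ g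
Σˢ-mono {zero}  h = h []
Σˢ-mono {suc n} h = ℤₚ.+-mono-≤ (Σˢ-mono (h ∘ (true ∷_))) (Σˢ-mono (h ∘ (false ∷_)))

Σˢ-neg : ∀ {n} (f : Subset n → ℤ) → Σˢ (λ A → - f A) ≡ - Σˢ f
Σˢ-neg f = trans (Σˢ-cong (λ A → sym (ℤₚ.-1*i≡-i (f A)))) (trans (Σˢ-*ˡ (- + 1) f) (ℤₚ.-1*i≡-i (Σˢ f)))

-- The bijection C ↦ C ∪ F from the sets disjoint from F onto the sets containing F.
Σˢ-union : ∀ {n} (F : Subset n) (a b : Subset n → ℤ) →
           (∀ C → C ∩ F ≡ ⊥ → a C ≡ b (C ∪ F)) → (∀ C → C ∩ F ≢ ⊥ → a C ≡ + 0) →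
           (∀ K → ¬ (F ⊆ K) → b K ≡ + 0) → Σˢ a ≡ Σˢ b
Σˢ-union {zero} [] a b h _ _ = h [] refl
Σˢ-union {suc n} (true ∷ F) a b h h₁ h₂ = begin
  Σˢ (a ∘ (true ∷_)) +ᶻ Σˢ (a ∘ (false ∷_))
    ≡⟨ cong₂ _+ᶻ_ (trans (Σˢ-cong (λ C → h₁ (true ∷ C) (λ ()))) (Σˢ-zero n))
        (Σˢ-union F (a ∘ (false ∷_)) (b ∘ (true ∷_)) (λ C e → h (false ∷ C) (cong (false ∷_) e))
          (λ C e → h₁ (false ∷ C) (λ { e' → e (cong Vec.tail e') }))
          (λ K e → h₂ (true ∷ K) (λ s → e (drop-∷-⊆ s)))) ⟩
  + 0 +ᶻ Σˢ (b ∘ (true ∷_))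
    ≡⟨ ℤₚ.+-comm (+ 0) (Σˢ (b ∘ (true ∷_))) ⟩
  Σˢ (b ∘ (true ∷_)) +ᶻ + 0
    ≡⟨ cong (Σˢ (b ∘ (true ∷_)) +ᶻ_) (sym (trans (Σˢ-cong (λ C → h₂ (false ∷ C) (λ s → λ-in-false (s here)))) (Σˢ-zero n))) ⟩
  Σˢ (b ∘ (true ∷_)) +ᶻ Σˢ (b ∘ (false ∷_)) ∎
  where
  open ≡-Reasoning
  λ-in-false : ∀ {C : Subset n} → zero ∉ (false ∷ C)
  λ-in-false ()
Σˢ-union {suc n} (false ∷ F) a b h h₁ h₂ = cong₂ _+ᶻ_ (part true) (part false)
  where
  part : ∀ c → Σˢ (a ∘ (c ∷_)) ≡ Σˢ (b ∘ (c ∷_))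
  part c = Σˢ-union F (a ∘ (c ∷_)) (b ∘ (c ∷_))
    (λ C e → trans (h (c ∷ C) (cong₂ _∷_ (∧-zeroʳ c) e)) (cong (λ x → b (x ∷ (C ∪ F))) (∨-f c)))
    (λ C e → h₁ (c ∷ C) (λ e' → e (cong Vec.tail e')))
    (λ K e → h₂ (c ∷ K) (λ s → e (drop-∷-⊆ s)))
    where
    ∨-f : ∀ c → c ∨ false ≡ c
    ∨-f true = refl
    ∨-f false = refl

-- From sums over lists to sums over the Boolean cube

Σℤ-filter : ∀ {A : Set} (g : A → ℤ) (p : A → Bool) xs →
            Σℤ (map g (filterᵇ p xs)) ≡ Σℤ (map (λ x → [ p x ] g x) xs)
Σℤ-filter g p []       = refl
Σℤ-filter g p (x ∷ xs) with p x
... | true  = cong (g x +ᶻ_) (Σℤ-filter g p xs)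
... | false = trans (Σℤ-filter g p xs) (sym (ℤₚ.+-identityˡ _))

Σℤ-++ : ∀ xs ys → Σℤ (xs ++ ys) ≡ Σℤ xs +ᶻ Σℤ ys
Σℤ-++ []       ys = sym (ℤₚ.+-identityˡ _)
Σℤ-++ (x ∷ xs) ys = trans (cong (x +ᶻ_) (Σℤ-++ xs ys)) (sym (ℤₚ.+-assoc x _ _))

Σℤ-allSubsets : ∀ {n} (g : Subset n → ℤ) → Σℤ (map g (allSubsets n)) ≡ Σˢ g
Σℤ-allSubsets {zero}  g = ℤₚ.+-identityʳ _
Σℤ-allSubsets {suc n} g = begin
  Σℤ (map g (map (true ∷_) S ++ map (false ∷_) S))             ≡⟨ cong Σℤ (map-++ g (map (true ∷_) S) _) ⟩
  Σℤ (map g (map (true ∷_) S) ++ map g (map (false ∷_) S))     ≡⟨ Σℤ-++ (map g (map (true ∷_) S)) _ ⟩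
  Σℤ (map g (map (true ∷_) S)) +ᶻ Σℤ (map g (map (false ∷_) S)) ≡⟨ cong₂ (λ x y → Σℤ x +ᶻ Σℤ y) (sym (map-∘ S)) (sym (map-∘ S)) ⟩
  Σℤ (map (g ∘ (true ∷_)) S) +ᶻ Σℤ (map (g ∘ (false ∷_)) S)     ≡⟨ cong₂ _+ᶻ_ (Σℤ-allSubsets (g ∘ (true ∷_))) (Σℤ-allSubsets (g ∘ (false ∷_))) ⟩
  Σˢ g ∎
  where
  open ≡-Reasoning
  S = allSubsets n

Σℤ-flats : ∀ {n} (M : RawMatroid n) (g : Subset n → ℤ) →
           Σℤ (map g (flats M)) ≡ Σˢ (λ F → [ isFlatᵇ M F ] g F)
Σℤ-flats M g = trans (Σℤ-filter g (isFlatᵇ M) (allSubsets _)) (Σℤ-allSubsets (λ F → [ isFlatᵇ M F ] g F))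

sumP-eval : ∀ {A : Set} (f : A → Poly) xs i → sumP (map f xs) i ≡ Σℤ (map (λ x → f x i) xs)
sumP-eval f []       i = refl
sumP-eval f (x ∷ xs) i = cong (f x i +ᶻ_) (sumP-eval f xs i)

sumP-flats : ∀ {n} (M : RawMatroid n) (f : Subset n → Poly) i →
             sumP (map f (flats M)) i ≡ Σˢ (λ F → [ isFlatᵇ M F ] f F i)
sumP-flats M f i = trans (sumP-eval f (flats M) i) (Σℤ-flats M (λ F → f F i))

-- Boolean tests as propositions

T⇒≡true : ∀ {b} → T b → b ≡ true
T⇒≡true {true} _ = refl

≡true⇒T : ∀ {b} → b ≡ true → T b
≡true⇒T refl = tt

≤ᵇ-true : ∀ {m n} → m ≤ n → (m ≤ᵇ n) ≡ true
≤ᵇ-true p = T⇒≡true (≤⇒≤ᵇ p)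

≤ᵇ-true⁻ : ∀ m n → (m ≤ᵇ n) ≡ true → m ≤ n
≤ᵇ-true⁻ m n p = ≤ᵇ⇒≤ m n (≡true⇒T p)

<ᵇ-true : ∀ {m n} → m < n → (m <ᵇ n) ≡ true
<ᵇ-true p = T⇒≡true (<⇒<ᵇ p)

<ᵇ-true⁻ : ∀ m n → (m <ᵇ n) ≡ true → m < n
<ᵇ-true⁻ m n p = <ᵇ⇒< m n (≡true⇒T p)

≡ᵇ-true : ∀ {m n} → m ≡ n → (m ≡ᵇ n) ≡ true
≡ᵇ-true p = T⇒≡true (≡⇒≡ᵇ _ _ p)

≡ᵇ-true⁻ : ∀ m n → (m ≡ᵇ n) ≡ true → m ≡ n
≡ᵇ-true⁻ m n p = ≡ᵇ⇒≡ m n (≡true⇒T p)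

⌊⌋-true : ∀ {P : Set} (d : Dec P) → P → ⌊ d ⌋ ≡ true
⌊⌋-true (yes _) p = refl
⌊⌋-true (no ¬p) p = contradiction p ¬p

⌊⌋-true⁻ : ∀ {P : Set} (d : Dec P) → ⌊ d ⌋ ≡ true → P
⌊⌋-true⁻ (yes p) _ = p

∸-cancel-< : ∀ {a b} f → a ∸ f < b ∸ f → a < b
∸-cancel-< f lt = ≰⇒> (λ b≤a → <⇒≱ lt (∸-monoˡ-≤ f b≤a))

-- Polynomials

Σℤ-applyUpTo-zero : ∀ m (f : ℕ → ℤ) → (∀ j → j < m → f j ≡ + 0) → Σℤ (applyUpTo f m) ≡ + 0
Σℤ-applyUpTo-zero zero    f h = refl
Σℤ-applyUpTo-zero (suc m) f h =
  cong₂ _+ᶻ_ (h 0 z<s) (Σℤ-applyUpTo-zero m (f ∘ suc) (λ j lt → h (suc j) (s<s lt)))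

Σℤ-applyUpTo-single : ∀ m (f : ℕ → ℤ) j₀ → j₀ < m → (∀ j → j < m → j ≢ j₀ → f j ≡ + 0) →
                      Σℤ (applyUpTo f m) ≡ f j₀
Σℤ-applyUpTo-single (suc m) f zero _ h = trans
  (cong (f 0 +ᶻ_) (Σℤ-applyUpTo-zero m (f ∘ suc) (λ j lt → h (suc j) (s<s lt) (λ ()))))
  (ℤₚ.+-identityʳ _)
Σℤ-applyUpTo-single (suc m) f (suc j₀) (s≤s lt) h = trans
  (cong₂ _+ᶻ_ (h 0 z<s (λ ()))
    (Σℤ-applyUpTo-single m (f ∘ suc) j₀ lt (λ j lt′ ne → h (suc j) (s<s lt′) (ne ∘ suc-injective))))
  (ℤₚ.+-identityˡ _)

Σℤ-Σˢ : ∀ {n} (f : ℕ → Subset n → ℤ) xs →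
        Σℤ (map (λ j → Σˢ (f j)) xs) ≡ Σˢ (λ C → Σℤ (map (λ j → f j C) xs))
Σℤ-Σˢ {n} f []   = sym (Σˢ-zero n)
Σℤ-Σˢ f (x ∷ xs) = trans (cong (Σˢ (f x) +ᶻ_) (Σℤ-Σˢ f xs)) (sym (Σˢ-+ (f x) (λ C → Σℤ (map (λ j → f j C) xs))))

shift-shift : ∀ a b p i → shift a (shift b p) i ≡ shift (a + b) p i
shift-shift a b p i = begin
  [ a ≤ᵇ i ] [ b ≤ᵇ i ∸ a ] p (i ∸ a ∸ b)  ≡⟨ []-∧ (a ≤ᵇ i) _ _ ⟩
  [ (a ≤ᵇ i) ∧ (b ≤ᵇ i ∸ a) ] p (i ∸ a ∸ b) ≡⟨ cong₂ (λ c x → [ c ] p x) (bool-ext to from) (∸-+-assoc i a b) ⟩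
  [ a + b ≤ᵇ i ] p (i ∸ (a + b)) ∎
  where
  open ≡-Reasoning
  to : (a ≤ᵇ i) ∧ (b ≤ᵇ i ∸ a) ≡ true → (a + b ≤ᵇ i) ≡ true
  to e with ∧-true⁻ e
  ... | p , q = ≤ᵇ-true (subst (_≤ i) (+-comm b a) (m≤o∸n⇒m+n≤o b (≤ᵇ-true⁻ a i p) (≤ᵇ-true⁻ b (i ∸ a) q)))
  from : (a + b ≤ᵇ i) ≡ true → (a ≤ᵇ i) ∧ (b ≤ᵇ i ∸ a) ≡ true
  from e = ∧-true (≤ᵇ-true (≤-trans (m≤m+n a b) le)) (≤ᵇ-true (m+n≤o⇒m≤o∸n b (subst (_≤ i) (+-comm a b) le)))
    where le = ≤ᵇ-true⁻ (a + b) i e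

constP : ℤ → Poly
constP c i = [ i ≡ᵇ 0 ] c

-- Reversal sends the monomial `c t^s` to `c t^(r-s)`; `chi` is a sum of such monomials.
rev-shift-const : ∀ r s c j → s ≤ r → rev r (shift s (constP c)) j ≡ [ j ≡ᵇ (r ∸ s) ] c
rev-shift-const r s c j s≤r = begin
  [ j ≤ᵇ r ] [ s ≤ᵇ r ∸ j ] [ (r ∸ j ∸ s) ≡ᵇ 0 ] c
    ≡⟨ cong ([ j ≤ᵇ r ]_) ([]-∧ (s ≤ᵇ r ∸ j) _ c) ⟩
  [ j ≤ᵇ r ] [ (s ≤ᵇ r ∸ j) ∧ ((r ∸ j ∸ s) ≡ᵇ 0) ] c
    ≡⟨ []-∧ (j ≤ᵇ r) _ c ⟩
  [ (j ≤ᵇ r) ∧ ((s ≤ᵇ r ∸ j) ∧ ((r ∸ j ∸ s) ≡ᵇ 0)) ] c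
    ≡⟨ cong ([_] c) (bool-ext to from) ⟩
  [ j ≡ᵇ (r ∸ s) ] c ∎
  where
  open ≡-Reasoning
  to : (j ≤ᵇ r) ∧ ((s ≤ᵇ r ∸ j) ∧ ((r ∸ j ∸ s) ≡ᵇ 0)) ≡ true → (j ≡ᵇ (r ∸ s)) ≡ true
  to e with ∧-true⁻ e
  ... | p , e′ with ∧-true⁻ {s ≤ᵇ r ∸ j} e′
  ... | q , z = ≡ᵇ-true (trans (sym (m∸[m∸n]≡n (≤ᵇ-true⁻ j r p)))
      (cong (r ∸_) (≤-antisym (m∸n≡0⇒m≤n (≡ᵇ-true⁻ (r ∸ j ∸ s) 0 z)) (≤ᵇ-true⁻ s (r ∸ j) q))))
  from : (j ≡ᵇ (r ∸ s)) ≡ true → (j ≤ᵇ r) ∧ ((s ≤ᵇ r ∸ j) ∧ ((r ∸ j ∸ s) ≡ᵇ 0)) ≡ true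
  from e rewrite ≡ᵇ-true⁻ j (r ∸ s) e | m∸[m∸n]≡n s≤r | n∸n≡0 s =
    ∧-true (≤ᵇ-true (m∸n≤m r s)) (∧-true (≤ᵇ-true (≤-refl {s})) refl)

conv-monomial : ∀ p d c i → Σℤ (map (λ j → p j *ᶻ [ (i ∸ j) ≡ᵇ d ] c) (upTo (suc i))) ≡ c *ᶻ shift d p i
conv-monomial p d c i = trans (cong Σℤ (map-applyUpTo id f (suc i))) (main (d ≤? i))
  where
  f : ℕ → ℤ
  f j = p j *ᶻ [ (i ∸ j) ≡ᵇ d ] c
  vanish : ∀ j → i ∸ j ≢ d → f j ≡ + 0
  vanish j ne = trans (cong (p j *ᶻ_) ([]-false c (ne ∘ ≡ᵇ-true⁻ (i ∸ j) d))) (ℤₚ.*-zeroʳ (p j))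
  main : Dec (d ≤ i) → Σℤ (applyUpTo f (suc i)) ≡ c *ᶻ shift d p i
  main (yes d≤i) = begin
    Σℤ (applyUpTo f (suc i))  ≡⟨ Σℤ-applyUpTo-single (suc i) f (i ∸ d) (s≤s (m∸n≤m i d))
                                   (λ j lt ne → vanish j (λ e → ne (trans (sym (m∸[m∸n]≡n (≤-pred lt))) (cong (i ∸_) e)))) ⟩
    p (i ∸ d) *ᶻ [ (i ∸ (i ∸ d)) ≡ᵇ d ] c  ≡⟨ cong (p (i ∸ d) *ᶻ_) ([]-true c (≡ᵇ-true (m∸[m∸n]≡n d≤i))) ⟩
    p (i ∸ d) *ᶻ c            ≡⟨ ℤₚ.*-comm (p (i ∸ d)) c ⟩
    c *ᶻ p (i ∸ d)            ≡⟨ cong (c *ᶻ_) (sym ([]-true (p (i ∸ d)) (≤ᵇ-true d≤i))) ⟩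
    c *ᶻ shift d p i ∎
    where open ≡-Reasoning
  main (no d≰i) = trans
    (Σℤ-applyUpTo-zero (suc i) f (λ j _ → vanish j (λ e → d≰i (subst (_≤ i) e (m∸n≤m i j)))))
    (sym (trans (cong (c *ᶻ_) ([]-false (p (i ∸ d)) (d≰i ∘ ≤ᵇ-true⁻ d i))) (ℤₚ.*-zeroʳ c)))

⊛-cong : ∀ p {q q′ : Poly} → (∀ j → q j ≡ q′ j) → ∀ i → (p ⊛ q) i ≡ (p ⊛ q′) i
⊛-cong p h i = cong Σℤ (map-cong (λ j → cong (p j *ᶻ_) (h (i ∸ j))) (upTo (suc i)))

-- The second factor is the polynomial with a term `c A * t^(d A)` for each selected `A`, so the
-- product is a sum of shifted copies of `p`. This removes convolution from the recursion for `Q`.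
⊛-monomials : ∀ {n} p (b : Subset n → Bool) (d : Subset n → ℕ) (c : Subset n → ℤ) i →
  (p ⊛ (λ j → Σˢ (λ A → [ b A ] [ j ≡ᵇ d A ] c A))) i ≡ Σˢ (λ A → [ b A ] (c A *ᶻ shift (d A) p i))
⊛-monomials p b d c i = begin
  Σℤ (map (λ j → p j *ᶻ Σˢ (λ A → [ b A ] [ i ∸ j ≡ᵇ d A ] c A)) (upTo (suc i)))
    ≡⟨ cong Σℤ (map-cong (λ j → trans (sym (Σˢ-*ˡ (p j) (λ A → [ b A ] [ i ∸ j ≡ᵇ d A ] c A)))
         (Σˢ-cong (λ A → []-*ˡ (b A) (p j) _))) (upTo (suc i))) ⟩
  Σℤ (map (λ j → Σˢ (λ A → [ b A ] (p j *ᶻ [ i ∸ j ≡ᵇ d A ] c A))) (upTo (suc i)))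
    ≡⟨ Σℤ-Σˢ (λ j A → [ b A ] (p j *ᶻ [ i ∸ j ≡ᵇ d A ] c A)) (upTo (suc i)) ⟩
  Σˢ (λ A → Σℤ (map (λ j → [ b A ] (p j *ᶻ [ i ∸ j ≡ᵇ d A ] c A)) (upTo (suc i))))
    ≡⟨ Σˢ-cong (λ A → pull (b A) (λ j → p j *ᶻ [ i ∸ j ≡ᵇ d A ] c A) (upTo (suc i))) ⟩
  Σˢ (λ A → [ b A ] Σℤ (map (λ j → p j *ᶻ [ i ∸ j ≡ᵇ d A ] c A) (upTo (suc i))))
    ≡⟨ Σˢ-cong (λ A → cong ([ b A ]_) (conv-monomial p (d A) (c A) i)) ⟩
  Σˢ (λ A → [ b A ] (c A *ᶻ shift (d A) p i)) ∎
  where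
  open ≡-Reasoning
  pull : ∀ b (f : ℕ → ℤ) xs → Σℤ (map (λ j → [ b ] f j) xs) ≡ [ b ] Σℤ (map f xs)
  pull true  f xs       = refl
  pull false f []       = refl
  pull false f (x ∷ xs) = trans (ℤₚ.+-identityˡ _) (pull false f xs)

-- Flats

x∈p─q⇒x∉q : ∀ {n} {x : Fin n} (p q : Subset n) → x ∈ p ─ q → x ∉ q
x∈p─q⇒x∉q (_ ∷ _) (true ∷ _) () here
x∈p─q⇒x∉q (_ ∷ p) (_ ∷ q) (there x∈) (there x∈q) = x∈p─q⇒x∉q p q x∈ x∈q

∩≡⊥ : ∀ {n} (p q : Subset n) → (∀ {x} → x ∈ p → x ∉ q) → p ∩ q ≡ ⊥
∩≡⊥ p q h = Empty-unique (λ (x , x∈) → let (a , b) = x∈p∩q⁻ p q x∈ in h a b)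

∩≡⊥⁻ : ∀ {n} {p q : Subset n} → p ∩ q ≡ ⊥ → ∀ {x} → x ∈ p → x ∉ q
∩≡⊥⁻ e x∈p x∈q = ∉⊥ (subst (_ ∈_) e (x∈p∩q⁺ (x∈p , x∈q)))

∪-⊆ : ∀ {n} {p q r : Subset n} → p ⊆ r → q ⊆ r → p ∪ q ⊆ r
∪-⊆ {p = p} {q} f g x∈ = [ f , g ]′ (x∈p∪q⁻ p q x∈)

⊆∪ˡ : ∀ {n} {p q : Subset n} → p ⊆ p ∪ q
⊆∪ˡ x∈ = x∈p∪q⁺ (inj₁ x∈)

⊆∪ʳ : ∀ {n} {p q : Subset n} → q ⊆ p ∪ q
⊆∪ʳ x∈ = x∈p∪q⁺ (inj₂ x∈)

⁅⁆⊆ : ∀ {n} {e : Fin n} {p} → e ∈ p → ⁅ e ⁆ ⊆ p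
⁅⁆⊆ {p = p} e∈ x∈ = subst (_∈ p) (sym (x∈⁅y⁆⇒x≡y _ x∈)) e∈

∪─ : ∀ {n} {p q : Subset n} → q ⊆ p → (p ─ q) ∪ q ≡ p
∪─ {p = p} {q} q⊆p = ⊆-antisym (∪-⊆ (p─q⊆p p q) q⊆p) back
  where
  back : p ⊆ (p ─ q) ∪ q
  back {x} x∈ with x ∈? q
  ... | yes x∈q = ⊆∪ʳ x∈q
  ... | no  x∉q = ⊆∪ˡ (x∈p∧x∉q⇒x∈p─q x∈ x∉q)

∪─-disjoint : ∀ {n} {p q : Subset n} → p ∩ q ≡ ⊥ → (p ∪ q) ─ q ≡ p
∪─-disjoint {p = p} {q} e = ⊆-antisym to (λ x∈ → x∈p∧x∉q⇒x∈p─q (⊆∪ˡ x∈) (∩≡⊥⁻ e x∈))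
  where
  to : (p ∪ q) ─ q ⊆ p
  to x∈ with x∈p∪q⁻ p q (p─q⊆p (p ∪ q) q x∈)
  ... | inj₁ x∈p = x∈p
  ... | inj₂ x∈q = ⊥-elim (x∈p─q⇒x∉q (p ∪ q) q x∈ x∈q)

∪-swapʳ : ∀ {n} (p q r : Subset n) → (p ∪ q) ∪ r ≡ (p ∪ r) ∪ q
∪-swapʳ p q r = trans (∪-assoc p q r) (trans (cong (p ∪_) (∪-comm q r)) (sym (∪-assoc p r q)))

⊆-∣∣≥⇒≡ : ∀ {n} {p q : Subset n} → p ⊆ q → ∣ q ∣ ≤ ∣ p ∣ → p ≡ q
⊆-∣∣≥⇒≡ {p = p} {q} p⊆q le = ⊆-antisym p⊆q q⊆p
  where
  q⊆p : q ⊆ p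
  q⊆p {x} x∈ with x ∈? p
  ... | yes x∈p = x∈p
  ... | no  x∉p = contradiction (p⊂q⇒∣p∣<∣q∣ (p⊆q , x , x∈ , x∉p)) (≤⇒≯ le)

Flat : ∀ {n} → RawMatroid n → Subset n → Set
Flat M F = F ⊆ E M × (∀ e → e ∈ E M → e ∉ F → rk M F < rk M (F ∪ ⁅ e ⁆))

allᵇ-true : ∀ {A : Set} (p : A → Bool) xs → (∀ x → x ∈ˡ xs → p x ≡ true) → allᵇ p xs ≡ true
allᵇ-true p []       h = refl
allᵇ-true p (x ∷ xs) h = ∧-true (h x (here refl)) (allᵇ-true p xs (λ y y∈ → h y (there y∈)))

allᵇ-true⁻ : ∀ {A : Set} (p : A → Bool) xs → allᵇ p xs ≡ true → ∀ x → x ∈ˡ xs → p x ≡ true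
allᵇ-true⁻ p (x ∷ xs) h y (here refl) = proj₁ (∧-true⁻ h)
allᵇ-true⁻ p (x ∷ xs) h y (there y∈)  = allᵇ-true⁻ p xs (proj₂ (∧-true⁻ {p x} h)) y y∈

module _ {n} (M : RawMatroid n) (F : Subset n) where

  private
    jumps : Fin n → Bool
    jumps e = if ⌊ e ∈? E M ⌋ ∧ not ⌊ e ∈? F ⌋ then rk M F <ᵇ rk M (F ∪ ⁅ e ⁆) else true

  isFlat⁺ : Flat M F → isFlatᵇ M F ≡ true
  isFlat⁺ (F⊆E , h) = ∧-true (⌊⌋-true (F ⊆? E M) F⊆E) (allᵇ-true jumps (allFin n) (λ e _ → jump e))
    where
    jump : ∀ e → jumps e ≡ true
    jump e with e ∈? E M | e ∈? F
    ... | yes e∈E | yes e∈F = refl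
    ... | yes e∈E | no  e∉F = <ᵇ-true (h e e∈E e∉F)
    ... | no  e∉E | _       = refl

  isFlat⁻ : isFlatᵇ M F ≡ true → Flat M F
  isFlat⁻ eq = (λ {x} → ⌊⌋-true⁻ (F ⊆? E M) (proj₁ (∧-true⁻ eq)) {x}) , jump
    where
    jump : ∀ e → e ∈ E M → e ∉ F → rk M F < rk M (F ∪ ⁅ e ⁆)
    jump e e∈E e∉F with e ∈? E M | e ∈? F | allᵇ-true⁻ jumps (allFin n) (proj₂ (∧-true⁻ {⌊ F ⊆? E M ⌋} eq)) e (∈-allFin e)
    ... | yes _   | yes e∈F | _ = contradiction e∈F e∉F
    ... | yes _   | no  _   | j = <ᵇ-true⁻ _ _ j
    ... | no e∉E  | _       | _ = contradiction e∈E e∉E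

-- Restrictions and contractions

-- This is all that the Möbius recursion asks of `N`. A contraction inherits it from the ambient
-- matroid, so the rank axioms are never transported to contractions.
Hereditary : ∀ {n} → RawMatroid n → Set
Hereditary N = ∀ C D → isFlatᵇ N C ≡ true → isFlatᵇ (restrict N C) D ≡ isFlatᵇ N D ∧ ⌊ D ⊆? C ⌋

mobF-suc : ∀ {n} f (N : RawMatroid n) B → ∣ B ∣ ≢ 0 →
  mobF (suc f) N B ≡ - Σˢ (λ D → [ isFlatᵇ N D ] [ ⌊ D ⊆? B ⌋ ∧ (∣ D ∣ <ᵇ ∣ B ∣) ] mobF f N D)
mobF-suc f N B ne rewrite ¬true⇒false (ne ∘ ≡ᵇ-true⁻ ∣ B ∣ 0) =
  cong -_ (trans (Σℤ-filter (mobF f N) (λ D → ⌊ D ⊆? B ⌋ ∧ (∣ D ∣ <ᵇ ∣ B ∣)) (flats N)) (Σℤ-flats N _))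

-- Independence of the fuel and locality are proved together: the recursion at `B` only visits flats
-- strictly smaller than `B`, and these are the same in `N` and in `restrict N C`.
mobF-restrict : ∀ {n} (N : RawMatroid n) → Hereditary N → ∀ f f′ C B → isFlatᵇ N C ≡ true → B ⊆ C →
                ∣ B ∣ < f → ∣ B ∣ < f′ → mobF f N B ≡ mobF f′ (restrict N C) B
mobF-restrict N her (suc f) (suc f′) C B flC B⊆C (s≤s lt) (s≤s lt′) with ∣ B ∣ ≟ 0
... | yes z rewrite z = refl
... | no nz = begin
  mobF (suc f) N B ≡⟨ mobF-suc f N B nz ⟩
  - Σˢ (λ D → [ isFlatᵇ N D ] [ ⌊ D ⊆? B ⌋ ∧ (∣ D ∣ <ᵇ ∣ B ∣) ] mobF f N D)
    ≡⟨ cong -_ (Σˢ-cong term) ⟩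
  - Σˢ (λ D → [ isFlatᵇ (restrict N C) D ] [ ⌊ D ⊆? B ⌋ ∧ (∣ D ∣ <ᵇ ∣ B ∣) ] mobF f′ (restrict N C) D)
    ≡⟨ mobF-suc f′ (restrict N C) B nz ⟨
  mobF (suc f′) (restrict N C) B ∎
  where
  open ≡-Reasoning
  below : Subset _ → Bool
  below D = ⌊ D ⊆? B ⌋ ∧ (∣ D ∣ <ᵇ ∣ B ∣)
  term : ∀ D → [ isFlatᵇ N D ] [ below D ] mobF f N D ≡ [ isFlatᵇ (restrict N C) D ] [ below D ] mobF f′ (restrict N C) D
  term D with below D in eq
  ... | false = trans ([]-zero (isFlatᵇ N D)) (sym ([]-zero (isFlatᵇ (restrict N C) D)))
  ... | true = cong₂ [_]_ (sym (trans (her C D flC)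
                 (trans (cong (isFlatᵇ N D ∧_) (⌊⌋-true (D ⊆? C) D⊆C)) (∧-identityʳ _))))
               (mobF-restrict N her f f′ C D flC D⊆C (<-≤-trans D<B lt) (<-≤-trans D<B lt′))
    where
    D<B : ∣ D ∣ < ∣ B ∣
    D<B = <ᵇ-true⁻ ∣ D ∣ ∣ B ∣ (proj₂ (∧-true⁻ {⌊ D ⊆? B ⌋} eq))
    D⊆C : D ⊆ C
    D⊆C = ⊆-trans (⌊⌋-true⁻ (D ⊆? B) (proj₁ (∧-true⁻ eq))) B⊆C

-- The defining recursion of `mu N` with the top term moved to the other side. A proper flat has
-- fewer than `n` elements, so the fuel `n` left after one unfolding still gives its true Möbius
-- value.
Σ-mu : ∀ {n} (N : RawMatroid n) → Hereditary N → ∣ E N ∣ ≢ 0 →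
       Σˢ (λ D → [ isFlatᵇ N D ] mu (restrict N D)) ≡ + 0
Σ-mu {n} N her nz = begin
  Σˢ (λ D → [ isFlatᵇ N D ] mu (restrict N D))     ≡⟨ Σˢ-cong term ⟩
  Σˢ (λ D → top D +ᶻ proper D)                     ≡⟨ Σˢ-+ top proper ⟩
  Σˢ top +ᶻ Σˢ proper                              ≡⟨ cong (_+ᶻ Σˢ proper) Σtop ⟩
  mu N +ᶻ Σˢ proper                                ≡⟨ cong (_+ᶻ Σˢ proper) (mobF-suc n N (E N) nz) ⟩
  - Σˢ proper +ᶻ Σˢ proper                         ≡⟨ ℤₚ.+-inverseˡ (Σˢ proper) ⟩
  + 0 ∎
  where
  open ≡-Reasoning
  top proper : Subset n → ℤ
  top D = [ isFlatᵇ N D ∧ ⌊ E N ⊆? D ⌋ ] mu (restrict N D)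
  proper D = [ isFlatᵇ N D ] [ ⌊ D ⊆? E N ⌋ ∧ (∣ D ∣ <ᵇ ∣ E N ∣) ] mobF n N D
  flat⊆ : ∀ {D} → isFlatᵇ N D ≡ true → D ⊆ E N
  flat⊆ {D} eq = proj₁ (isFlat⁻ N D eq)
  E-flat : isFlatᵇ N (E N) ≡ true
  E-flat = isFlat⁺ N (E N) (⊆-refl , λ e e∈ e∉ → contradiction e∈ e∉)
  Σtop : Σˢ top ≡ mu N
  Σtop = trans (Σˢ-single top (E N) (λ D ne → []-false _ (λ e → let (p , q) = ∧-true⁻ e in
           ne (⊆-antisym (flat⊆ p) (⌊⌋-true⁻ (E N ⊆? D) q)))))
         ([]-true _ (∧-true E-flat (⌊⌋-true (E N ⊆? E N) ⊆-refl)))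
  term : ∀ D → [ isFlatᵇ N D ] mu (restrict N D) ≡ top D +ᶻ proper D
  term D with isFlatᵇ N D in flD
  ... | false = refl
  ... | true with E N ⊆? D
  ...   | yes E⊆D = sym (trans (cong (mu (restrict N D) +ᶻ_) ([]-false (mobF n N D) (λ e →
                      <⇒≱ (<ᵇ-true⁻ ∣ D ∣ _ (proj₂ (∧-true⁻ {⌊ D ⊆? E N ⌋} e))) (p⊆q⇒∣p∣≤∣q∣ E⊆D))))
                    (ℤₚ.+-identityʳ _))
  ...   | no  E⊈D = begin
    mu (restrict N D)  ≡⟨ mobF-restrict N her n (suc n) D D flD ⊆-refl D<n (s≤s (∣p∣≤n D)) ⟨
    mobF n N D         ≡⟨ []-true (mobF n N D) (∧-true (⌊⌋-true (D ⊆? E N) D⊆E) (<ᵇ-true D<E)) ⟨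
    [ ⌊ D ⊆? E N ⌋ ∧ (∣ D ∣ <ᵇ ∣ E N ∣) ] mobF n N D ≡⟨ ℤₚ.+-identityˡ _ ⟨
    + 0 +ᶻ [ ⌊ D ⊆? E N ⌋ ∧ (∣ D ∣ <ᵇ ∣ E N ∣) ] mobF n N D ∎
    where
    D⊆E : D ⊆ E N
    D⊆E = flat⊆ flD
    D<E : ∣ D ∣ < ∣ E N ∣
    D<E = ≰⇒> (λ le → E⊈D (⊆-reflexive (sym (⊆-∣∣≥⇒≡ D⊆E le))))
    D<n : ∣ D ∣ < n
    D<n = <-≤-trans D<E (∣p∣≤n (E N))

module Restrictions {n} (rk : Subset n → ℕ) (E₀ : Subset n) (isM : IsMatroid (mkRaw E₀ rk)) where

  open IsMatroid isM

  M : Subset n → RawMatroid n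
  M G = mkRaw G rk

  fl : Subset n → Subset n → Bool
  fl G H = isFlatᵇ (M G) H

  restrict-isMatroid : ∀ {G} → G ⊆ E₀ → IsMatroid (M G)
  restrict-isMatroid G⊆E₀ = record
    { R1 = λ A A⊆G → R1 A (⊆-trans A⊆G G⊆E₀)
    ; R2 = λ A B A⊆B B⊆G → R2 A B A⊆B (⊆-trans B⊆G G⊆E₀)
    ; R3 = λ A B A⊆G B⊆G → R3 A B (⊆-trans A⊆G G⊆E₀) (⊆-trans B⊆G G⊆E₀) }

  flat⊆ : ∀ {G H} → fl G H ≡ true → H ⊆ G
  flat⊆ {G} {H} eq = proj₁ (isFlat⁻ (M G) H eq)

  self-flat : ∀ G → fl G G ≡ true
  self-flat G = isFlat⁺ (M G) G (⊆-refl , λ e e∈ e∉ → contradiction e∈ e∉)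

  -- The substance is that a flat of a flat is a flat. For `e` outside `K`, submodularity applied to
  -- `K` and `F ∪ ⁅ e ⁆`, whose intersection contains `F`, shows that `e` raises the rank of `F` at
  -- least as much as that of `K`.
  flat-restrict : ∀ {G} → G ⊆ E₀ → ∀ K F → fl G K ≡ true → fl K F ≡ fl G F ∧ ⌊ F ⊆? K ⌋
  flat-restrict {G} G⊆E₀ K F flK = bool-ext to from
    where
    K⊆G : K ⊆ G
    K⊆G = flat⊆ flK
    to : fl K F ≡ true → fl G F ∧ ⌊ F ⊆? K ⌋ ≡ true
    to flF = ∧-true (isFlat⁺ (M G) F (⊆-trans F⊆K K⊆G , up)) (⌊⌋-true (F ⊆? K) F⊆K)
      where
      F⊆K : F ⊆ K
      F⊆K = flat⊆ flF
      up : ∀ e → e ∈ G → e ∉ F → rk F < rk (F ∪ ⁅ e ⁆)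
      up e e∈G e∉F with e ∈? K
      ... | yes e∈K = proj₂ (isFlat⁻ (M K) F flF) e e∈K e∉F
      ... | no  e∉K = +-cancelˡ-< (rk K) _ _ (begin-strict
        rk K + rk F                          <⟨ +-monoˡ-< (rk F) (proj₂ (isFlat⁻ (M G) K flK) e e∈G e∉K) ⟩
        rk (K ∪ ⁅ e ⁆) + rk F                ≤⟨ +-mono-≤
                                                  (R2 _ _ (∪-⊆ ⊆∪ˡ (⊆-trans ⊆∪ʳ ⊆∪ʳ)) (∪-⊆ K⊆E₀ Fe⊆E₀))
                                                  (R2 _ _ (λ x∈ → x∈p∩q⁺ (F⊆K x∈ , ⊆∪ˡ x∈)) (⊆-trans (p∩q⊆p K (F ∪ ⁅ e ⁆)) K⊆E₀)) ⟩
        rk (K ∪ (F ∪ ⁅ e ⁆)) + rk (K ∩ (F ∪ ⁅ e ⁆)) ≤⟨ R3 K (F ∪ ⁅ e ⁆) K⊆E₀ Fe⊆E₀ ⟩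
        rk K + rk (F ∪ ⁅ e ⁆) ∎)
        where
        open ≤-Reasoning
        K⊆E₀ : K ⊆ E₀
        K⊆E₀ = ⊆-trans K⊆G G⊆E₀
        Fe⊆E₀ : F ∪ ⁅ e ⁆ ⊆ E₀
        Fe⊆E₀ = ∪-⊆ (⊆-trans F⊆K K⊆E₀) (⊆-trans (⁅⁆⊆ e∈G) G⊆E₀)
    from : fl G F ∧ ⌊ F ⊆? K ⌋ ≡ true → fl K F ≡ true
    from eq = isFlat⁺ (M K) F (⌊⌋-true⁻ (F ⊆? K) (proj₂ (∧-true⁻ {fl G F} eq)) ,
      λ e e∈K → proj₂ (isFlat⁻ (M G) F (proj₁ (∧-true⁻ eq))) e (K⊆G e∈K))

  -- Truncated subtraction of `rk F` preserves a strict inequality only between ranks that are at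
  -- least `rk F`; monotonicity of `rk` ensures this because both sets contain `F`.
  contract-flat : ∀ {G F} → G ⊆ E₀ → F ⊆ G → ∀ C → C ∩ F ≡ ⊥ → isFlatᵇ (contract (M G) F) C ≡ fl G (C ∪ F)
  contract-flat {G} {F} G⊆E₀ F⊆G C dis = bool-ext to from
    where
    swap : ∀ e → rk ((C ∪ ⁅ e ⁆) ∪ F) ≡ rk ((C ∪ F) ∪ ⁅ e ⁆)
    swap e = cong rk (∪-swapʳ C ⁅ e ⁆ F)
    to : isFlatᵇ (contract (M G) F) C ≡ true → fl G (C ∪ F) ≡ true
    to eq with isFlat⁻ (contract (M G) F) C eq
    ... | C⊆ , up = isFlat⁺ (M G) (C ∪ F) (∪-⊆ (⊆-trans C⊆ (p─q⊆p G F)) F⊆G ,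
      λ e e∈G e∉ → subst (rk (C ∪ F) <_) (swap e)
        (∸-cancel-< (rk F) (up e (x∈p∧x∉q⇒x∈p─q e∈G (e∉ ∘ ⊆∪ʳ)) (e∉ ∘ ⊆∪ˡ))))
    from : fl G (C ∪ F) ≡ true → isFlatᵇ (contract (M G) F) C ≡ true
    from eq with isFlat⁻ (M G) (C ∪ F) eq
    ... | CF⊆ , up = isFlat⁺ (contract (M G) F) C ((λ x∈ → x∈p∧x∉q⇒x∈p─q (CF⊆ (⊆∪ˡ x∈)) (∩≡⊥⁻ dis x∈)) ,
      λ e e∈ e∉C → ∸-monoˡ-< (subst (rk (C ∪ F) <_) (sym (swap e))
          (up e (p─q⊆p G F e∈) (λ e∈∪ → [ e∉C , x∈p─q⇒x∉q G F e∈ ]′ (x∈p∪q⁻ C F e∈∪))))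
        (R2 F (C ∪ F) ⊆∪ʳ (⊆-trans CF⊆ G⊆E₀)))

  contract-flat-disjoint : ∀ G F C → isFlatᵇ (contract (M G) F) C ≡ true → C ∩ F ≡ ⊥
  contract-flat-disjoint G F C eq = ∩≡⊥ C F (λ x∈ → x∈p─q⇒x∉q G F (proj₁ (isFlat⁻ (contract (M G) F) C eq) x∈))

  -- As `C` is disjoint from `F`, restricting the contraction to `C` is literally the contraction of
  -- `M (C ∪ F)` by `F`. Under the map `D ↦ D ∪ F` the claim becomes `flat-restrict` for the flat
  -- `C ∪ F` of `G`.
  contract-hereditary : ∀ {G F} → G ⊆ E₀ → fl G F ≡ true → Hereditary (contract (M G) F)
  contract-hereditary {G} {F} G⊆E₀ flF C D flC = begin
    isFlatᵇ (restrict N C) D                ≡⟨ cong (λ X → isFlatᵇ (mkRaw X (RawMatroid.rk N)) D) (∪─-disjoint disC) ⟨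
    isFlatᵇ (contract (M (C ∪ F)) F) D      ≡⟨ bool-ext to from ⟩
    isFlatᵇ N D ∧ ⌊ D ⊆? C ⌋ ∎
    where
    open ≡-Reasoning
    N = contract (M G) F
    F⊆G : F ⊆ G
    F⊆G = flat⊆ flF
    disC : C ∩ F ≡ ⊥
    disC = contract-flat-disjoint G F C flC
    flCF : fl G (C ∪ F) ≡ true
    flCF = trans (sym (contract-flat G⊆E₀ F⊆G C disC)) flC
    CF⊆E₀ : C ∪ F ⊆ E₀
    CF⊆E₀ = ⊆-trans (flat⊆ flCF) G⊆E₀
    to : isFlatᵇ (contract (M (C ∪ F)) F) D ≡ true → isFlatᵇ N D ∧ ⌊ D ⊆? C ⌋ ≡ true
    to eq = ∧-true (trans (contract-flat G⊆E₀ F⊆G D disD) (proj₁ (∧-true⁻ both)))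
              (⌊⌋-true (D ⊆? C) (λ x∈ → [ id , ⊥-elim ∘ ∩≡⊥⁻ disD x∈ ]′
                (x∈p∪q⁻ C F (⌊⌋-true⁻ (D ∪ F ⊆? C ∪ F) (proj₂ (∧-true⁻ {fl G (D ∪ F)} both)) (⊆∪ˡ x∈)))))
      where
      disD = contract-flat-disjoint (C ∪ F) F D eq
      both : fl G (D ∪ F) ∧ ⌊ D ∪ F ⊆? C ∪ F ⌋ ≡ true
      both = trans (sym (flat-restrict G⊆E₀ (C ∪ F) (D ∪ F) flCF))
               (trans (sym (contract-flat CF⊆E₀ ⊆∪ʳ D disD)) eq)
    from : isFlatᵇ N D ∧ ⌊ D ⊆? C ⌋ ≡ true → isFlatᵇ (contract (M (C ∪ F)) F) D ≡ true
    from eq = trans (contract-flat CF⊆E₀ ⊆∪ʳ D disD)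
                (trans (flat-restrict G⊆E₀ (C ∪ F) (D ∪ F) flCF)
                  (∧-true (trans (sym (contract-flat G⊆E₀ F⊆G D disD)) flD)
                          (⌊⌋-true (D ∪ F ⊆? C ∪ F) (∪-⊆ (⊆-trans D⊆C ⊆∪ˡ) ⊆∪ʳ))))
      where
      flD : isFlatᵇ N D ≡ true
      flD = proj₁ (∧-true⁻ eq)
      D⊆C : D ⊆ C
      D⊆C = ⌊⌋-true⁻ (D ⊆? C) (proj₂ (∧-true⁻ {isFlatᵇ N D} eq))
      disD = contract-flat-disjoint G F D flD

  -- The Möbius function of the interval from `F` to `K`; it does not depend on the flat `G` in
  -- which the interval is considered.
  μ : Subset n → Subset n → ℤ
  μ F K = mu (contract (M K) F)

  -- Reindexing by `K = C ∪ F` replaces the lattice of flats of the contraction by the interval from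
  -- `F` to `G`.
  contract-sum : ∀ {G F} → G ⊆ E₀ → fl G F ≡ true → (h : Subset n → ℤ) →
    Σˢ (λ C → [ isFlatᵇ (contract (M G) F) C ] (mu (restrict (contract (M G) F) C) *ᶻ h (C ∪ F))) ≡
    Σˢ (λ K → [ fl G K ∧ ⌊ F ⊆? K ⌋ ] (μ F K *ᶻ h K))
  contract-sum {G} {F} G⊆E₀ flF h = Σˢ-union F _ _
    (λ C dis → cong₂ (λ b m → [ b ] (m *ᶻ h (C ∪ F)))
      (trans (contract-flat G⊆E₀ (flat⊆ flF) C dis)
        (sym (trans (cong (fl G (C ∪ F) ∧_) (⌊⌋-true (F ⊆? C ∪ F) ⊆∪ʳ)) (∧-identityʳ _))))
      (cong (λ X → mu (mkRaw X (RawMatroid.rk (contract (M G) F)))) (sym (∪─-disjoint dis))))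
    (λ C ¬dis → []-false _ (¬dis ∘ contract-flat-disjoint G F C))
    (λ K F⊈K → []-false _ (λ e → F⊈K (⌊⌋-true⁻ (F ⊆? K) (proj₂ (∧-true⁻ {fl G K} e)))))

  -- This is `Σ-mu` for the contraction by `F`, whose ground set is nonempty when `F` is a proper
  -- flat.
  Σμ-above : ∀ {G F} → G ⊆ E₀ → fl G F ≡ true → F ≢ G → Σˢ (λ K → [ fl G K ∧ ⌊ F ⊆? K ⌋ ] μ F K) ≡ + 0
  Σμ-above {G} {F} G⊆E₀ flF F≢G = begin
    Σˢ (λ K → [ fl G K ∧ ⌊ F ⊆? K ⌋ ] μ F K)
      ≡⟨ Σˢ-cong (λ K → cong ([ fl G K ∧ ⌊ F ⊆? K ⌋ ]_) (sym (ℤₚ.*-identityʳ (μ F K)))) ⟩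
    Σˢ (λ K → [ fl G K ∧ ⌊ F ⊆? K ⌋ ] (μ F K *ᶻ + 1))
      ≡⟨ contract-sum G⊆E₀ flF (λ _ → + 1) ⟨
    Σˢ (λ C → [ isFlatᵇ N C ] (mu (restrict N C) *ᶻ + 1))
      ≡⟨ Σˢ-cong (λ C → cong ([ isFlatᵇ N C ]_) (ℤₚ.*-identityʳ _)) ⟩
    Σˢ (λ C → [ isFlatᵇ N C ] mu (restrict N C))
      ≡⟨ Σ-mu N (contract-hereditary G⊆E₀ flF) nonempty ⟩
    + 0 ∎
    where
    open ≡-Reasoning
    N = contract (M G) F
    nonempty : ∣ G ─ F ∣ ≢ 0
    nonempty z = F≢G (⊆-antisym (flat⊆ flF) G⊆F)
      where
      G⊆F : G ⊆ F
      G⊆F {x} x∈ with x ∈? F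
      ... | yes x∈F = x∈F
      ... | no  x∉F = contradiction (subst₂ _≤_ (∣⁅x⁆∣≡1 x) z (p⊆q⇒∣p∣≤∣q∣ (⁅⁆⊆ (x∈p∧x∉q⇒x∈p─q x∈ x∉F)))) λ ()

  μ-refl : ∀ G → μ G G ≡ + 1
  μ-refl G rewrite trans (cong ∣_∣ (⊆-antisym {i = G ─ G} {j = ⊥} (λ x∈ → contradiction (p─q⊆p G G x∈) (x∈p─q⇒x∉q G G x∈)) (⊆-min _))) (∣⊥∣≡0 n) = refl

  Σμ-self : ∀ G → Σˢ (λ K → [ fl G K ∧ ⌊ G ⊆? K ⌋ ] μ G K) ≡ + 1
  Σμ-self G = trans
    (Σˢ-single _ G (λ K ne → []-false _ (λ e → let (p , q) = ∧-true⁻ e in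
      ne (⊆-antisym (flat⊆ p) (⌊⌋-true⁻ (G ⊆? K) q)))))
    (trans ([]-true _ (∧-true (self-flat G) (⌊⌋-true (G ⊆? G) ⊆-refl))) (μ-refl G))

-- The induction device for sums over the flats of `G`: the totals agree, all terms but the one at
-- `A₀ = G` agree by induction, hence so do the two terms at `G`.
Σˢ-cancel : ∀ {n} (f g : Subset n → ℤ) A₀ → (∀ A → A ≢ A₀ → f A ≡ g A) → Σˢ f ≡ Σˢ g → f A₀ ≡ g A₀
Σˢ-cancel f g A₀ h eq = ℤₚ.i-j≡0⇒i≡j (f A₀) (g A₀) (begin
  f A₀ -ᶻ g A₀               ≡⟨ Σˢ-single (λ A → f A -ᶻ g A) A₀ (λ A ne → ℤₚ.i≡j⇒i-j≡0 (h A ne)) ⟨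
  Σˢ (λ A → f A -ᶻ g A)      ≡⟨ Σˢ-+ f (λ A → - g A) ⟩
  Σˢ f +ᶻ Σˢ (λ A → - g A)   ≡⟨ cong₂ _+ᶻ_ eq (Σˢ-neg g) ⟩
  Σˢ g -ᶻ Σˢ g               ≡⟨ ℤₚ.+-inverseʳ (Σˢ g) ⟩
  + 0 ∎)
  where open ≡-Reasoning

sign*sign : ∀ r → sign r *ᶻ sign r ≡ + 1
sign*sign zero    = refl
sign*sign (suc r) = trans (neg*neg (sign r)) (sign*sign r)
  where
  neg*neg : ∀ a → - a *ᶻ - a ≡ a *ᶻ a
  neg*neg = ℤ-Solver.solve-∀

-- The inverse Kazhdan–Lusztig recursion in the lattice of flats

module KazhdanLusztig {n} (rk : Subset n → ℕ) (E₀ : Subset n) (isM : IsMatroid (mkRaw E₀ rk))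
  (loopless : Loopless (mkRaw E₀ rk)) (Q : RawMatroid n → Poly) (isQ : IsInverseKL Q) where

  open Restrictions rk E₀ isM public
  open IsMatroid isM public

  y : Subset n → Poly
  y H i = Σˢ (λ F → [ fl H F ] ((sign (rk F) *ᶻ μ F H) *ᶻ shift (rk H ∸ rk F) (Q (M F)) i))

  contract-rank : ∀ {G F} → F ⊆ G → rank (contract (M G) F) ≡ rk G ∸ rk F
  contract-rank {G} {F} F⊆G = cong (λ X → rk X ∸ rk F) (∪─ F⊆G)

  Yloopless-y : ∀ G i → Yloopless Q (M G) i ≡ sign (rk G) *ᶻ y G i
  Yloopless-y G i = cong (sign (rk G) *ᶻ_) (trans
    (sumP-flats (M G) (λ F → scale (sign (rk F) *ᶻ μ F G) (shift (rank (contract (M G) F)) (Q (M F)))) i)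
    (Σˢ-cong (λ F → []-cong (fl G F) (λ flF →
      cong (λ d → (sign (rk F) *ᶻ μ F G) *ᶻ shift d (Q (M F)) i) (contract-rank (flat⊆ flF))))))

  flat-rk≤ : ∀ {G F} → G ⊆ E₀ → fl G F ≡ true → rk F ≤ rk G
  flat-rk≤ G⊆E₀ flF = R2 _ _ (flat⊆ flF) G⊆E₀

  -- Both sides sum over flags `F ≤ K ≤ G`; by `flat-restrict` the condition that `F` and `K` are
  -- flats of `G` with `F ⊆ K` can be read as `F` being a flat of `K`.
  flag-sum : ∀ {G} → G ⊆ E₀ → (s : Subset n → ℤ) (h : Subset n → Subset n → ℤ) →
    Σˢ (λ F → [ fl G F ] (s F *ᶻ Σˢ (λ K → [ fl G K ∧ ⌊ F ⊆? K ⌋ ] (μ F K *ᶻ h F K)))) ≡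
    Σˢ (λ K → [ fl G K ] Σˢ (λ F → [ fl K F ] ((s F *ᶻ μ F K) *ᶻ h F K)))
  flag-sum {G} G⊆E₀ s h = begin
    Σˢ (λ F → [ fl G F ] (s F *ᶻ Σˢ (λ K → [ fl G K ∧ ⌊ F ⊆? K ⌋ ] (μ F K *ᶻ h F K))))
      ≡⟨ Σˢ-cong (λ F → trans (cong ([ fl G F ]_) (sym (Σˢ-*ˡ (s F) (λ K → [ fl G K ∧ ⌊ F ⊆? K ⌋ ] (μ F K *ᶻ h F K)))))
           (sym (Σˢ-[] (fl G F) (λ K → s F *ᶻ [ fl G K ∧ ⌊ F ⊆? K ⌋ ] (μ F K *ᶻ h F K))))) ⟩
    Σˢ (λ F → Σˢ (λ K → [ fl G F ] (s F *ᶻ [ fl G K ∧ ⌊ F ⊆? K ⌋ ] (μ F K *ᶻ h F K))))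
      ≡⟨ Σˢ-swap (λ F K → [ fl G F ] (s F *ᶻ [ fl G K ∧ ⌊ F ⊆? K ⌋ ] (μ F K *ᶻ h F K))) ⟩
    Σˢ (λ K → Σˢ (λ F → [ fl G F ] (s F *ᶻ [ fl G K ∧ ⌊ F ⊆? K ⌋ ] (μ F K *ᶻ h F K))))
      ≡⟨ Σˢ-cong (λ K → Σˢ-cong (λ F → term F K)) ⟩
    Σˢ (λ K → Σˢ (λ F → [ fl G K ] [ fl K F ] ((s F *ᶻ μ F K) *ᶻ h F K)))
      ≡⟨ Σˢ-cong (λ K → Σˢ-[] (fl G K) (λ F → [ fl K F ] ((s F *ᶻ μ F K) *ᶻ h F K))) ⟩
    Σˢ (λ K → [ fl G K ] Σˢ (λ F → [ fl K F ] ((s F *ᶻ μ F K) *ᶻ h F K))) ∎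
    where
    open ≡-Reasoning
    indicators : ∀ F K x → [ fl G F ] [ fl G K ∧ ⌊ F ⊆? K ⌋ ] x ≡ [ fl G K ] [ fl K F ] x
    indicators F K x with fl G K in flK
    ... | true  = trans ([]-∧ (fl G F) _ x) (cong ([_] x) (sym (flat-restrict G⊆E₀ K F flK)))
    ... | false = []-zero (fl G F)
    term : ∀ F K → [ fl G F ] (s F *ᶻ [ fl G K ∧ ⌊ F ⊆? K ⌋ ] (μ F K *ᶻ h F K)) ≡
                   [ fl G K ] [ fl K F ] ((s F *ᶻ μ F K) *ᶻ h F K)
    term F K = trans (cong ([ fl G F ]_) (trans ([]-*ˡ (fl G K ∧ ⌊ F ⊆? K ⌋) (s F) _)
                 (cong ([ fl G K ∧ ⌊ F ⊆? K ⌋ ]_) (sym (ℤₚ.*-assoc (s F) (μ F K) (h F K))))))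
               (indicators F K _)

  -- Reversal turns the term `μ F K` of `chi` in degree `rk G - rk K` into one in degree
  -- `rk K - rk F`, which no longer involves `G`. That makes the inner sums in `rev-Q` equal to `y`.
  conv-chi : ∀ {G F} → G ⊆ E₀ → fl G F ≡ true → ∀ p i →
    (p ⊛ rev (rank (contract (M G) F)) (chi (contract (M G) F))) i ≡
    Σˢ (λ K → [ fl G K ∧ ⌊ F ⊆? K ⌋ ] (μ F K *ᶻ shift (rk K ∸ rk F) p i))
  conv-chi {G} {F} G⊆E₀ flF p i = begin
    (p ⊛ rev (rank N) (chi N)) i
      ≡⟨ ⊛-cong p rev-chi i ⟩
    (p ⊛ (λ j → Σˢ (λ C → [ isFlatᵇ N C ] [ j ≡ᵇ RawMatroid.rk N C ] mu (restrict N C)))) i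
      ≡⟨ ⊛-monomials p (isFlatᵇ N) (RawMatroid.rk N) (λ C → mu (restrict N C)) i ⟩
    Σˢ (λ C → [ isFlatᵇ N C ] (mu (restrict N C) *ᶻ shift (RawMatroid.rk N C) p i))
      ≡⟨ contract-sum G⊆E₀ flF (λ K → shift (rk K ∸ rk F) p i) ⟩
    Σˢ (λ K → [ fl G K ∧ ⌊ F ⊆? K ⌋ ] (μ F K *ᶻ shift (rk K ∸ rk F) p i)) ∎
    where
    open ≡-Reasoning
    N = contract (M G) F
    rkᴺ = RawMatroid.rk N
    rev-chi : ∀ j → rev (rank N) (chi N) j ≡ Σˢ (λ C → [ isFlatᵇ N C ] [ j ≡ᵇ rkᴺ C ] mu (restrict N C))
    rev-chi j = begin
      [ j ≤ᵇ rank N ] chi N (rank N ∸ j)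
        ≡⟨ cong ([ j ≤ᵇ rank N ]_) (sumP-flats N (λ C → shift (rank (contract N C)) (constP (mu (restrict N C)))) _) ⟩
      [ j ≤ᵇ rank N ] Σˢ (λ C → [ isFlatᵇ N C ] shift (rank (contract N C)) (constP (mu (restrict N C))) (rank N ∸ j))
        ≡⟨ Σˢ-[] (j ≤ᵇ rank N) (λ C → [ isFlatᵇ N C ] shift (rank (contract N C)) (constP (mu (restrict N C))) (rank N ∸ j)) ⟨
      Σˢ (λ C → [ j ≤ᵇ rank N ] [ isFlatᵇ N C ] shift (rank (contract N C)) (constP (mu (restrict N C))) (rank N ∸ j))
        ≡⟨ Σˢ-cong (λ C → []-swap (j ≤ᵇ rank N) (isFlatᵇ N C) (shift (rank (contract N C)) (constP (mu (restrict N C))) (rank N ∸ j))) ⟩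
      Σˢ (λ C → [ isFlatᵇ N C ] rev (rank N) (shift (rank (contract N C)) (constP (mu (restrict N C)))) j)
        ≡⟨ Σˢ-cong (λ C → []-cong (isFlatᵇ N C) (λ flC → trans
             (rev-shift-const (rank N) _ _ j (≤-trans (≤-reflexive (rank-eq C flC)) (m∸n≤m (rank N) (rkᴺ C))))
             (cong (λ d → [ j ≡ᵇ d ] mu (restrict N C)) (trans (cong (rank N ∸_) (rank-eq C flC)) (m∸[m∸n]≡n (rk-le C flC)))))) ⟩
      Σˢ (λ C → [ isFlatᵇ N C ] [ j ≡ᵇ rkᴺ C ] mu (restrict N C)) ∎
      where
      rank-eq : ∀ C → isFlatᵇ N C ≡ true → rank (contract N C) ≡ rank N ∸ rkᴺ C
      rank-eq C flC = cong (λ X → rkᴺ X ∸ rkᴺ C) (∪─ (proj₁ (isFlat⁻ N C flC)))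
      rk-le : ∀ C → isFlatᵇ N C ≡ true → rkᴺ C ≤ rank N
      rk-le C flC = ∸-monoˡ-≤ (rk F) (R2 _ _ (∪-⊆ (⊆-trans (proj₁ (isFlat⁻ N C flC)) ⊆∪ˡ) ⊆∪ʳ)
        (⊆-trans (∪-⊆ (p─q⊆p G F) (flat⊆ flF)) G⊆E₀))

  module _ {G : Subset n} (G⊆E₀ : G ⊆ E₀) where

    private
      KL = isQ (M G) (restrict-isMatroid G⊆E₀) (λ e e∈ → loopless e (G⊆E₀ e∈))

    Q-rank0 : rk G ≡ 0 → Q (M G) 0 ≡ + 1
    Q-rank0 z = proj₁ KL z 0

    -- Leaving out `i = 0` lets rank 0, where `Q` is the constant 1, obey the same rule as positive
    -- rank.
    Q-degree : ∀ i → rk G ≤ 2 * i → i ≢ 0 → Q (M G) i ≡ + 0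
    Q-degree i le i≢0 with rk G ≟ 0
    ... | yes z = trans (proj₁ KL z i) ([]-false (+ 1) (i≢0 ∘ ≡ᵇ-true⁻ i 0))
    ... | no nz = proj₁ (proj₂ KL) (n≢0⇒n>0 nz) i le

    rev-Q : ∀ i → sign (rk G) *ᶻ rev (rk G) (Q (M G)) i ≡ Σˢ (λ H → [ fl G H ] y H i)
    rev-Q i = begin
      sign (rk G) *ᶻ rev (rk G) (Q (M G)) i
        ≡⟨ proj₂ (proj₂ KL) i ⟩
      sumP (map (λ F → scale (sign (rk F)) (Q (M F) ⊛ rev (rank (contract (M G) F)) (chi (contract (M G) F)))) (flats (M G))) i
        ≡⟨ sumP-flats (M G) (λ F → scale (sign (rk F)) (Q (M F) ⊛ rev (rank (contract (M G) F)) (chi (contract (M G) F)))) i ⟩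
      Σˢ (λ F → [ fl G F ] (sign (rk F) *ᶻ (Q (M F) ⊛ rev (rank (contract (M G) F)) (chi (contract (M G) F))) i))
        ≡⟨ Σˢ-cong (λ F → []-cong (fl G F) (λ flF → cong (sign (rk F) *ᶻ_) (conv-chi G⊆E₀ flF (Q (M F)) i))) ⟩
      Σˢ (λ F → [ fl G F ] (sign (rk F) *ᶻ Σˢ (λ K → [ fl G K ∧ ⌊ F ⊆? K ⌋ ] (μ F K *ᶻ shift (rk K ∸ rk F) (Q (M F)) i))))
        ≡⟨ flag-sum G⊆E₀ (λ F → sign (rk F)) (λ F K → shift (rk K ∸ rk F) (Q (M F)) i) ⟩
      Σˢ (λ H → [ fl G H ] y H i) ∎
      where open ≡-Reasoning

    shift-y : ∀ {K} → fl G K ≡ true → ∀ i →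
      Σˢ (λ F → [ fl K F ] ((sign (rk F) *ᶻ μ F K) *ᶻ shift (rk G ∸ rk F) (Q (M F)) i)) ≡ shift (rk G ∸ rk K) (y K) i
    shift-y {K} flK i = sym (trans
      (sym (Σˢ-[] (d ≤ᵇ i) (λ F → [ fl K F ] ((sign (rk F) *ᶻ μ F K) *ᶻ shift (rk K ∸ rk F) (Q (M F)) (i ∸ d)))))
      (Σˢ-cong term))
      where
      d = rk G ∸ rk K
      term : ∀ F → [ d ≤ᵇ i ] [ fl K F ] ((sign (rk F) *ᶻ μ F K) *ᶻ shift (rk K ∸ rk F) (Q (M F)) (i ∸ d)) ≡
                   [ fl K F ] ((sign (rk F) *ᶻ μ F K) *ᶻ shift (rk G ∸ rk F) (Q (M F)) i)
      term F with fl K F in flF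
      ... | false = []-zero (d ≤ᵇ i)
      ... | true  = trans (sym ([]-*ˡ (d ≤ᵇ i) c _)) (cong (c *ᶻ_) (trans (shift-shift d (rk K ∸ rk F) (Q (M F)) i)
                      (cong (λ e → shift e (Q (M F)) i) d+)))
        where
        c = sign (rk F) *ᶻ μ F K
        d+ : d + (rk K ∸ rk F) ≡ rk G ∸ rk F
        d+ = trans (sym (+-∸-assoc d (R2 F K (flat⊆ flF) (⊆-trans (flat⊆ flK) G⊆E₀))))
               (cong (_∸ rk F) (m∸n+n≡m (flat-rk≤ G⊆E₀ flK)))

    -- Möbius inversion, read from right to left: collecting by `F` leaves the sum of `μ F K` over
    -- `K`, which vanishes unless `F = G`. Shifting each `y K` by `rk G - rk K` brings every
    -- `Q (M F)` to the shift `rk G - rk F`, so `K` occurs only in `μ F K`.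
    Q-shift : ∀ i → sign (rk G) *ᶻ Q (M G) i ≡ Σˢ (λ K → [ fl G K ] shift (rk G ∸ rk K) (y K) i)
    Q-shift i = begin
      sign (rk G) *ᶻ Q (M G) i
        ≡⟨ at-G ⟨
      term G
        ≡⟨ Σˢ-single term G off-G ⟨
      Σˢ term
        ≡⟨ flag-sum G⊆E₀ (λ F → sign (rk F)) (λ F K → sh F) ⟩
      Σˢ (λ K → [ fl G K ] Σˢ (λ F → [ fl K F ] ((sign (rk F) *ᶻ μ F K) *ᶻ sh F)))
        ≡⟨ Σˢ-cong (λ K → []-cong (fl G K) (λ flK → shift-y flK i)) ⟩
      Σˢ (λ K → [ fl G K ] shift (rk G ∸ rk K) (y K) i) ∎
      where
      open ≡-Reasoning
      sh : Subset n → ℤ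
      sh F = shift (rk G ∸ rk F) (Q (M F)) i
      term : Subset n → ℤ
      term F = [ fl G F ] (sign (rk F) *ᶻ Σˢ (λ K → [ fl G K ∧ ⌊ F ⊆? K ⌋ ] (μ F K *ᶻ sh F)))
      inner : ∀ F → Σˢ (λ K → [ fl G K ∧ ⌊ F ⊆? K ⌋ ] (μ F K *ᶻ sh F)) ≡ Σˢ (λ K → [ fl G K ∧ ⌊ F ⊆? K ⌋ ] μ F K) *ᶻ sh F
      inner F = trans (Σˢ-cong (λ K → sym ([]-*ʳ (fl G K ∧ ⌊ F ⊆? K ⌋) (μ F K) (sh F)))) (Σˢ-*ʳ (sh F) (λ K → [ fl G K ∧ ⌊ F ⊆? K ⌋ ] μ F K))
      off-G : ∀ F → F ≢ G → term F ≡ + 0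
      off-G F F≢G = trans ([]-cong (fl G F) (λ flF → trans (cong (sign (rk F) *ᶻ_)
        (trans (inner F) (cong (_*ᶻ sh F) (Σμ-above G⊆E₀ flF F≢G)))) (ℤₚ.*-zeroʳ (sign (rk F))))) ([]-zero (fl G F))
      at-G : term G ≡ sign (rk G) *ᶻ Q (M G) i
      at-G = trans ([]-true _ (self-flat G)) (cong (sign (rk G) *ᶻ_) (trans (inner G)
        (trans (cong (_*ᶻ sh G) (Σμ-self G)) (trans (ℤₚ.*-identityˡ (sh G)) (cong (λ d → shift d (Q (M G)) i) (n∸n≡0 (rk G)))))))

  flat-smaller : ∀ {G H} → fl G H ≡ true → H ≢ G → ∣ H ∣ < ∣ G ∣
  flat-smaller flH H≢G = ≰⇒> (λ le → H≢G (⊆-∣∣≥⇒≡ (flat⊆ flH) le))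

  -- Above the rank the left side of `rev-Q` is zero, and by induction so is every term on the right
  -- except the one at `G`.
  y-degree : ∀ m {G} → ∣ G ∣ < m → G ⊆ E₀ → ∀ i → rk G < i → y G i ≡ + 0
  y-degree (suc m) {G} (s≤s lt) G⊆E₀ i rk<i = begin
    y G i                                     ≡⟨ []-true (y G i) (self-flat G) ⟨
    [ fl G G ] y G i                          ≡⟨ Σˢ-single (λ H → [ fl G H ] y H i) G off ⟨
    Σˢ (λ H → [ fl G H ] y H i)               ≡⟨ rev-Q G⊆E₀ i ⟨
    sign (rk G) *ᶻ rev (rk G) (Q (M G)) i     ≡⟨ cong (sign (rk G) *ᶻ_) ([]-false _ (<⇒≱ rk<i ∘ ≤ᵇ-true⁻ i (rk G))) ⟩
    sign (rk G) *ᶻ + 0                        ≡⟨ ℤₚ.*-zeroʳ (sign (rk G)) ⟩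
    + 0 ∎
    where
    open ≡-Reasoning
    off : ∀ H → H ≢ G → [ fl G H ] y H i ≡ + 0
    off H H≢G = trans ([]-cong (fl G H) (λ flH → y-degree m (<-≤-trans (flat-smaller flH H≢G) lt)
      (⊆-trans (flat⊆ flH) G⊆E₀) i (≤-<-trans (flat-rk≤ G⊆E₀ flH) rk<i))) ([]-zero (fl G H))

  -- Reversing the identity rev-Q turns it into Q-shift as soon as y H is palindromic for every proper flat H.
  y-palindromic : ∀ m {G} → ∣ G ∣ < m → G ⊆ E₀ → ∀ i → i ≤ rk G → y G (rk G ∸ i) ≡ y G i
  y-palindromic (suc m) {G} (s≤s lt) G⊆E₀ i i≤ = begin
    y G (rk G ∸ i)                       ≡⟨ []-true _ (self-flat G) ⟨
    [ fl G G ] y G (rk G ∸ i)            ≡⟨ Σˢ-cancel _ _ G off sums ⟩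
    [ fl G G ] shift (rk G ∸ rk G) (y G) i ≡⟨ []-true _ (self-flat G) ⟩
    shift (rk G ∸ rk G) (y G) i          ≡⟨ cong (λ d → shift d (y G) i) (n∸n≡0 (rk G)) ⟩
    y G i ∎
    where
    open ≡-Reasoning
    sums : Σˢ (λ H → [ fl G H ] y H (rk G ∸ i)) ≡ Σˢ (λ H → [ fl G H ] shift (rk G ∸ rk H) (y H) i)
    sums = begin
      Σˢ (λ H → [ fl G H ] y H (rk G ∸ i))
        ≡⟨ rev-Q G⊆E₀ (rk G ∸ i) ⟨
      sign (rk G) *ᶻ rev (rk G) (Q (M G)) (rk G ∸ i)
        ≡⟨ cong (sign (rk G) *ᶻ_) (trans ([]-true _ (≤ᵇ-true (m∸n≤m (rk G) i))) (cong (Q (M G)) (m∸[m∸n]≡n i≤))) ⟩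
      sign (rk G) *ᶻ Q (M G) i
        ≡⟨ Q-shift G⊆E₀ i ⟩
      Σˢ (λ H → [ fl G H ] shift (rk G ∸ rk H) (y H) i) ∎
    off : ∀ H → H ≢ G → [ fl G H ] y H (rk G ∸ i) ≡ [ fl G H ] shift (rk G ∸ rk H) (y H) i
    off H H≢G = []-cong (fl G H) same
      where
      same : fl G H ≡ true → y H (rk G ∸ i) ≡ shift (rk G ∸ rk H) (y H) i
      same flH with rk G ∸ rk H ≤? i
      ... | yes d≤i = begin
        y H (rk G ∸ i)                          ≡⟨ cong (y H) index ⟨
        y H (rk H ∸ (i ∸ (rk G ∸ rk H)))        ≡⟨ y-palindromic m H<m H⊆E₀ (i ∸ (rk G ∸ rk H)) i-d≤ ⟩
        y H (i ∸ (rk G ∸ rk H))                 ≡⟨ []-true _ (≤ᵇ-true d≤i) ⟨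
        shift (rk G ∸ rk H) (y H) i ∎
        where
        H⊆E₀ = ⊆-trans (flat⊆ flH) G⊆E₀
        H<m = <-≤-trans (flat-smaller flH H≢G) lt
        H≤G = flat-rk≤ G⊆E₀ flH
        i-d≤ : i ∸ (rk G ∸ rk H) ≤ rk H
        i-d≤ = ≤-trans (∸-monoˡ-≤ (rk G ∸ rk H) i≤) (≤-reflexive (m∸[m∸n]≡n H≤G))
        index : rk H ∸ (i ∸ (rk G ∸ rk H)) ≡ rk G ∸ i
        index = trans (cong (_∸ (i ∸ (rk G ∸ rk H))) (sym (m∸[m∸n]≡n H≤G)))
                  (trans (∸-+-assoc (rk G) (rk G ∸ rk H) (i ∸ (rk G ∸ rk H))) (cong (rk G ∸_) (m+[n∸m]≡n d≤i)))
      -- Below the shift both sides vanish: `rk G ∸ i` then exceeds `rk H`, so `y-degree` applies on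
      -- the left.
      ... | no d≰i = trans
        (y-degree (suc ∣ H ∣) ≤-refl (⊆-trans (flat⊆ flH) G⊆E₀) (rk G ∸ i) H<)
        (sym ([]-false _ (d≰i ∘ ≤ᵇ-true⁻ _ i)))
        where
        H< : rk H < rk G ∸ i
        H< = subst (_< rk G ∸ i) (m∸[m∸n]≡n (flat-rk≤ G⊆E₀ flH)) (∸-monoʳ-< (≰⇒> d≰i) (m∸n≤m (rk G) (rk H)))

  -- Coefficient `i` of `rev-Q` is coefficient `rk G ∸ i` of `Q`, at or beyond half the rank. The
  -- degree bound is strict, so the middle index `2 * i ≡ rk G` is included.
  Σy-low : ∀ {G} → G ⊆ E₀ → 0 < rk G → ∀ i → 2 * i ≤ rk G → Σˢ (λ H → [ fl G H ] y H i) ≡ + 0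
  Σy-low {G} G⊆E₀ pos i 2i≤ = trans (sym (rev-Q G⊆E₀ i)) (trans
    (cong (sign (rk G) *ᶻ_) (trans ([]-cong (i ≤ᵇ rk G) (λ _ → Q-degree G⊆E₀ (rk G ∸ i) high nonzero)) ([]-zero (i ≤ᵇ rk G))))
    (ℤₚ.*-zeroʳ (sign (rk G))))
    where
    i+i≤ : i + i ≤ rk G
    i+i≤ = subst (_≤ rk G) (cong (λ j → i + j) (+-identityʳ i)) 2i≤
    i≤ : i ≤ rk G ∸ i
    i≤ = m+n≤o⇒m≤o∸n i i+i≤
    high : rk G ≤ 2 * (rk G ∸ i)
    high = begin
      rk G                        ≡⟨ m∸n+n≡m (≤-trans (m≤m+n i i) i+i≤) ⟨
      (rk G ∸ i) + i              ≤⟨ +-monoʳ-≤ (rk G ∸ i) (≤-trans i≤ (≤-reflexive (sym (+-identityʳ _)))) ⟩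
      2 * (rk G ∸ i) ∎
      where open ≤-Reasoning
    nonzero : rk G ∸ i ≢ 0
    nonzero z = <⇒≱ pos (subst (λ r → rk G ≤ 2 * r) z high)

  rk⊥ : rk ⊥ ≡ 0
  rk⊥ = n≤0⇒n≡0 (subst (rk ⊥ ≤_) (∣⊥∣≡0 n) (R1 ⊥ (⊆-min E₀)))

  y-⊥ : ∀ i → y ⊥ i ≡ [ i ≡ᵇ 0 ] (+ 1)
  y-⊥ zero = begin
    y ⊥ 0                                  ≡⟨ []-true (y ⊥ 0) (self-flat ⊥) ⟨
    [ fl ⊥ ⊥ ] y ⊥ 0                       ≡⟨ Σˢ-single (λ H → [ fl ⊥ H ] y H 0) ⊥ (λ H ne → []-false _ (λ e → ne (⊆-antisym (flat⊆ e) (⊆-min H)))) ⟨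
    Σˢ (λ H → [ fl ⊥ H ] y H 0)            ≡⟨ rev-Q (⊆-min E₀) 0 ⟨
    sign (rk ⊥) *ᶻ Q (M ⊥) (rk ⊥ ∸ 0)      ≡⟨ cong (λ r → sign r *ᶻ Q (M ⊥) r) rk⊥ ⟩
    + 1 *ᶻ Q (M ⊥) 0                       ≡⟨ ℤₚ.*-identityˡ (Q (M ⊥) 0) ⟩
    Q (M ⊥) 0                              ≡⟨ Q-rank0 (⊆-min E₀) rk⊥ ⟩
    + 1 ∎
    where open ≡-Reasoning
  y-⊥ (suc i) = y-degree (suc ∣ ⊥ {n} ∣) ≤-refl (⊆-min E₀) (suc i) (subst (_< suc i) (sym rk⊥) z<s)

-- Binomial sums

-- The sum of `C(N,r) f(r)` over `r`, in the form given by Pascal's rule: each element is either in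
-- or out, exactly as in the recursion of `Σˢ`.
binomialSum : ℕ → (ℕ → ℤ) → ℤ
binomialSum zero    f = f 0
binomialSum (suc N) f = binomialSum N (f ∘ suc) +ᶻ binomialSum N f

binomialSum-cong : ∀ N {f g : ℕ → ℤ} → (∀ r → f r ≡ g r) → binomialSum N f ≡ binomialSum N g
binomialSum-cong zero    h = h 0
binomialSum-cong (suc N) h = cong₂ _+ᶻ_ (binomialSum-cong N (h ∘ suc)) (binomialSum-cong N h)

binomialSum-zero : ∀ N → binomialSum N (λ _ → + 0) ≡ + 0
binomialSum-zero zero = refl
binomialSum-zero (suc N) rewrite binomialSum-zero N = refl

binomialSum-+ : ∀ N (f g : ℕ → ℤ) → binomialSum N (λ r → f r +ᶻ g r) ≡ binomialSum N f +ᶻ binomialSum N g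
binomialSum-+ zero    f g = refl
binomialSum-+ (suc N) f g = trans
  (cong₂ _+ᶻ_ (binomialSum-+ N (f ∘ suc) (g ∘ suc)) (binomialSum-+ N f g))
  (+-interchange (binomialSum N (f ∘ suc)) _ _ _)

binomialSum-*ˡ : ∀ N c (f : ℕ → ℤ) → binomialSum N (λ r → c *ᶻ f r) ≡ c *ᶻ binomialSum N f
binomialSum-*ˡ zero    c f = refl
binomialSum-*ˡ (suc N) c f = trans
  (cong₂ _+ᶻ_ (binomialSum-*ˡ N c (f ∘ suc)) (binomialSum-*ˡ N c f))
  (sym (ℤₚ.*-distribˡ-+ c _ _))

Σˢ-⊆ : ∀ {n} (C : Subset n) (f : ℕ → ℤ) → Σˢ (λ H → [ ⌊ H ⊆? C ⌋ ] f ∣ H ∣) ≡ binomialSum ∣ C ∣ f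
Σˢ-⊆ []          f = refl
Σˢ-⊆ (true ∷ C)  f = cong₂ _+ᶻ_
  (trans (Σˢ-cong (λ H → cong (λ b → [ b ] f (suc ∣ H ∣)) (bool-ext
      (λ e → ⌊⌋-true (H ⊆? C) (drop-∷-⊆ (⌊⌋-true⁻ ((true ∷ H) ⊆? (true ∷ C)) e)))
      (λ e → ⌊⌋-true ((true ∷ H) ⊆? (true ∷ C)) (in⊆in (⌊⌋-true⁻ (H ⊆? C) e))))))
    (Σˢ-⊆ C (f ∘ suc)))
  (trans (Σˢ-cong (λ H → cong (λ b → [ b ] f ∣ H ∣) (bool-ext
      (λ e → ⌊⌋-true (H ⊆? C) (drop-∷-⊆ (⌊⌋-true⁻ ((false ∷ H) ⊆? (true ∷ C)) e)))
      (λ e → ⌊⌋-true ((false ∷ H) ⊆? (true ∷ C)) (out⊆ (⌊⌋-true⁻ (H ⊆? C) e))))))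
    (Σˢ-⊆ C f))
Σˢ-⊆ {suc n} (false ∷ C) f = trans (cong₂ _+ᶻ_
  (trans (Σˢ-cong (λ H → []-false (f (suc ∣ H ∣)) (λ e → ¬here (⌊⌋-true⁻ ((true ∷ H) ⊆? (false ∷ C)) e here))))
    (Σˢ-zero n))
  (trans (Σˢ-cong (λ H → cong (λ b → [ b ] f ∣ H ∣) (bool-ext
      (λ e → ⌊⌋-true (H ⊆? C) (drop-∷-⊆ (⌊⌋-true⁻ ((false ∷ H) ⊆? (false ∷ C)) e)))
      (λ e → ⌊⌋-true ((false ∷ H) ⊆? (false ∷ C)) (out⊆ (⌊⌋-true⁻ (H ⊆? C) e))))))
    (Σˢ-⊆ C f)))
  (ℤₚ.+-identityˡ _)
  where
  ¬here : zero ∉ (false ∷ C)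
  ¬here ()

pascalᶻ : ∀ n k → + (suc n choose suc k) ≡ + (n choose k) +ᶻ + (n choose suc k)
pascalᶻ n k = trans (cong +_ (sym (nCk+nC[k+1]≡[n+1]C[k+1] n k))) (ℤₚ.pos-+ (n choose k) _)

binomialSum-single : ∀ N b c → binomialSum N (λ r → [ r ≡ᵇ b ] c) ≡ + (N choose b) *ᶻ c
binomialSum-single zero    zero    c = sym (ℤₚ.*-identityˡ c)
binomialSum-single zero    (suc b) c = sym (trans (cong (λ x → + x *ᶻ c) (k>n⇒nCk≡0 {0} {suc b} z<s)) (ℤₚ.*-zeroˡ c))
binomialSum-single (suc N) zero    c = trans (cong₂ _+ᶻ_ (binomialSum-zero N) (binomialSum-single N zero c)) (ℤₚ.+-identityˡ _)
binomialSum-single (suc N) (suc b) c = begin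
  binomialSum N (λ r → [ r ≡ᵇ b ] c) +ᶻ binomialSum N (λ r → [ r ≡ᵇ suc b ] c)
    ≡⟨ cong₂ _+ᶻ_ (binomialSum-single N b c) (binomialSum-single N (suc b) c) ⟩
  + (N choose b) *ᶻ c +ᶻ + (N choose suc b) *ᶻ c
    ≡⟨ ℤₚ.*-distribʳ-+ c (+ (N choose b)) (+ (N choose suc b)) ⟨
  (+ (N choose b) +ᶻ + (N choose suc b)) *ᶻ c
    ≡⟨ cong (_*ᶻ c) (pascalᶻ N b) ⟨
  + (suc N choose suc b) *ᶻ c ∎
  where open ≡-Reasoning

-- One application of Pascal's rule pairs the truncated sign sequence with its shift; consecutive
-- signs cancel except at the cut `r = b`.
binomialSum-alternating : ∀ a b → binomialSum (suc a) (λ r → [ r <ᵇ suc b ] sign r) ≡ + (a choose b) *ᶻ sign b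
binomialSum-alternating a b = trans
  (sym (binomialSum-+ a (λ r → [ r <ᵇ b ] - sign r) (λ r → [ r <ᵇ suc b ] sign r)))
  (trans (binomialSum-cong a (λ r → telescope r b)) (binomialSum-single a b (sign b)))
  where
  telescope : ∀ r b → ([ r <ᵇ b ] - sign r) +ᶻ ([ r <ᵇ suc b ] sign r) ≡ [ r ≡ᵇ b ] sign b
  telescope zero    zero    = refl
  telescope zero    (suc b) = refl
  telescope (suc r) zero    = refl
  telescope (suc r) (suc b) = begin
    ([ r <ᵇ b ] - - sign r) +ᶻ ([ r <ᵇ suc b ] - sign r)  ≡⟨ cong₂ _+ᶻ_ (neg-[] (r <ᵇ b)) (neg-[] (r <ᵇ suc b)) ⟩
    - ([ r <ᵇ b ] - sign r) +ᶻ - ([ r <ᵇ suc b ] sign r)  ≡⟨ ℤₚ.neg-distrib-+ ([ r <ᵇ b ] - sign r) ([ r <ᵇ suc b ] sign r) ⟨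
    - (([ r <ᵇ b ] - sign r) +ᶻ ([ r <ᵇ suc b ] sign r))  ≡⟨ cong -_ (telescope r b) ⟩
    - ([ r ≡ᵇ b ] sign b)                                ≡⟨ neg-[] (r ≡ᵇ b) ⟨
    [ r ≡ᵇ b ] - sign b ∎
    where
    open ≡-Reasoning
    neg-[] : ∀ c {x} → [ c ] (- x) ≡ - ([ c ] x)
    neg-[] true  = refl
    neg-[] false = refl

binomialSum-sign : ∀ a → binomialSum (suc a) sign ≡ + 0
binomialSum-sign a = trans (sym (binomialSum-+ a (λ r → - sign r) sign))
  (trans (binomialSum-cong a (λ r → ℤₚ.+-inverseˡ (sign r))) (binomialSum-zero a))

-- C(N,r) C(r,i) = C(N,i) C(N-i,r-i)
binomialSum-absorb : ∀ N i (g : ℕ → ℤ) →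
  binomialSum N (λ r → + (r choose i) *ᶻ g r) ≡ + (N choose i) *ᶻ binomialSum (N ∸ i) (λ r → g (i + r))
binomialSum-absorb N zero g = trans (binomialSum-cong N (λ r → ℤₚ.*-identityˡ (g r))) (sym (ℤₚ.*-identityˡ _))
binomialSum-absorb zero (suc i) g rewrite k>n⇒nCk≡0 {0} {suc i} z<s = refl
binomialSum-absorb (suc N) (suc i) g = begin
  binomialSum N (λ r → + (suc r choose suc i) *ᶻ g (suc r)) +ᶻ binomialSum N (λ r → + (r choose suc i) *ᶻ g r)
    ≡⟨ cong (_+ᶻ binomialSum N (λ r → + (r choose suc i) *ᶻ g r))
         (trans (binomialSum-cong N (λ r → trans (cong (_*ᶻ g (suc r)) (pascalᶻ r i)) (ℤₚ.*-distribʳ-+ (g (suc r)) (+ (r choose i)) (+ (r choose suc i)))))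
                (binomialSum-+ N (λ r → + (r choose i) *ᶻ g (suc r)) (λ r → + (r choose suc i) *ᶻ g (suc r)))) ⟩
  binomialSum N (λ r → + (r choose i) *ᶻ g (suc r)) +ᶻ binomialSum N (λ r → + (r choose suc i) *ᶻ g (suc r))
    +ᶻ binomialSum N (λ r → + (r choose suc i) *ᶻ g r)
    ≡⟨ cong₂ _+ᶻ_ (cong₂ _+ᶻ_ (binomialSum-absorb N i (g ∘ suc)) (binomialSum-absorb N (suc i) (g ∘ suc))) (binomialSum-absorb N (suc i) g) ⟩
  + (N choose i) *ᶻ U +ᶻ + (N choose suc i) *ᶻ V +ᶻ + (N choose suc i) *ᶻ W
    ≡⟨ regroup (+ (N choose i)) (+ (N choose suc i)) U V W ⟩
  + (N choose i) *ᶻ U +ᶻ + (N choose suc i) *ᶻ (V +ᶻ W)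
    ≡⟨ cong (+ (N choose i) *ᶻ U +ᶻ_) step ⟩
  + (N choose i) *ᶻ U +ᶻ + (N choose suc i) *ᶻ U
    ≡⟨ ℤₚ.*-distribʳ-+ U (+ (N choose i)) (+ (N choose suc i)) ⟨
  (+ (N choose i) +ᶻ + (N choose suc i)) *ᶻ U
    ≡⟨ cong (_*ᶻ U) (pascalᶻ N i) ⟨
  + (suc N choose suc i) *ᶻ U ∎
  where
  open ≡-Reasoning
  U = binomialSum (N ∸ i) (λ r → g (suc i + r))
  V = binomialSum (N ∸ suc i) (λ r → g (suc (suc i + r)))
  W = binomialSum (N ∸ suc i) (λ r → g (suc i + r))
  regroup : ∀ a b u v w → a *ᶻ u +ᶻ b *ᶻ v +ᶻ b *ᶻ w ≡ a *ᶻ u +ᶻ b *ᶻ (v +ᶻ w)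
  regroup = ℤ-Solver.solve-∀
  step : + (N choose suc i) *ᶻ (V +ᶻ W) ≡ + (N choose suc i) *ᶻ U
  step with i <? N
  ... | yes i<N = cong (+ (N choose suc i) *ᶻ_) (trans
      (cong (_+ᶻ W) (binomialSum-cong (N ∸ suc i) (λ r → cong (g ∘ suc) (sym (+-suc i r)))))
      (cong (λ m → binomialSum m (λ r → g (suc i + r))) (sym (+-∸-assoc 1 i<N))))
  -- Here `N ∸ suc i` is no longer one less than `N ∸ i`, but the common factor `C(N,i+1)` is zero.
  ... | no i≮N rewrite k>n⇒nCk≡0 {N} {suc i} (≰⇒> i≮N) = refl

sign-+ : ∀ a b → sign (a + b) ≡ sign a *ᶻ sign b
sign-+ zero    b = sym (ℤₚ.*-identityˡ (sign b))
sign-+ (suc a) b = trans (cong -_ (sign-+ a b)) (ℤₚ.neg-distribˡ-* (sign a) (sign b))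

-- The coefficients of `(-1)^r (1+t)^r`, which is `y` for a Boolean matroid of rank `r`.
signedBinomial : ℕ → Poly
signedBinomial r i = sign r *ᶻ + (r choose i)

-- `binomialSum-absorb` takes `C(N,i)` out and leaves a truncated alternating sum over `N - i`
-- elements. Writing the size and the cut as `i + suc a` and `i + suc b` avoids truncated
-- subtraction.
binomialSum-signed-below : ∀ i a b →
  binomialSum (i + suc a) (λ r → [ r <ᵇ i + suc b ] signedBinomial r i) ≡
  sign (i + b) *ᶻ (+ ((i + suc a) choose i) *ᶻ + (a choose b))
binomialSum-signed-below i a b = begin
  binomialSum (i + suc a) (λ r → [ r <ᵇ i + suc b ] signedBinomial r i)
    ≡⟨ binomialSum-cong (i + suc a) (λ r → trans (cong ([ r <ᵇ i + suc b ]_) (ℤₚ.*-comm (sign r) _))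
         (sym ([]-*ˡ (r <ᵇ i + suc b) (+ (r choose i)) (sign r)))) ⟩
  binomialSum (i + suc a) (λ r → + (r choose i) *ᶻ [ r <ᵇ i + suc b ] sign r)
    ≡⟨ binomialSum-absorb (i + suc a) i (λ r → [ r <ᵇ i + suc b ] sign r) ⟩
  N,i *ᶻ binomialSum (i + suc a ∸ i) (λ r → [ i + r <ᵇ i + suc b ] sign (i + r))
    ≡⟨ cong (λ m → N,i *ᶻ binomialSum m (λ r → [ i + r <ᵇ i + suc b ] sign (i + r))) (m+n∸m≡n i (suc a)) ⟩
  N,i *ᶻ binomialSum (suc a) (λ r → [ i + r <ᵇ i + suc b ] sign (i + r))
    ≡⟨ cong (N,i *ᶻ_) (binomialSum-cong (suc a) (λ r → trans (cong₂ [_]_ (cancel i r) (sign-+ i r))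
         (sym ([]-*ˡ (r <ᵇ suc b) (sign i) (sign r))))) ⟩
  N,i *ᶻ binomialSum (suc a) (λ r → sign i *ᶻ [ r <ᵇ suc b ] sign r)
    ≡⟨ cong (N,i *ᶻ_) (trans (binomialSum-*ˡ (suc a) (sign i) (λ r → [ r <ᵇ suc b ] sign r))
         (cong (sign i *ᶻ_) (binomialSum-alternating a b))) ⟩
  N,i *ᶻ (sign i *ᶻ (+ (a choose b) *ᶻ sign b))
    ≡⟨ regroup N,i (sign i) (+ (a choose b)) (sign b) ⟩
  (sign i *ᶻ sign b) *ᶻ (N,i *ᶻ + (a choose b))
    ≡⟨ cong (_*ᶻ (N,i *ᶻ + (a choose b))) (sign-+ i b) ⟨
  sign (i + b) *ᶻ (N,i *ᶻ + (a choose b)) ∎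
  where
  open ≡-Reasoning
  N,i = + ((i + suc a) choose i)
  cancel : ∀ i r → (i + r <ᵇ i + suc b) ≡ (r <ᵇ suc b)
  cancel zero    r = refl
  cancel (suc i) r = cancel i r
  regroup : ∀ p s c t → p *ᶻ (s *ᶻ (c *ᶻ t)) ≡ (s *ᶻ t) *ᶻ (p *ᶻ c)
  regroup = ℤ-Solver.solve-∀

binomialSum-signed : ∀ i a → binomialSum (i + suc a) (λ r → signedBinomial r i) ≡ + 0
binomialSum-signed i a = begin
  binomialSum (i + suc a) (λ r → signedBinomial r i)
    ≡⟨ binomialSum-cong (i + suc a) (λ r → ℤₚ.*-comm (sign r) (+ (r choose i))) ⟩
  binomialSum (i + suc a) (λ r → + (r choose i) *ᶻ sign r)
    ≡⟨ binomialSum-absorb (i + suc a) i sign ⟩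
  N,i *ᶻ binomialSum (i + suc a ∸ i) (λ r → sign (i + r))
    ≡⟨ cong (λ m → N,i *ᶻ binomialSum m (λ r → sign (i + r))) (m+n∸m≡n i (suc a)) ⟩
  N,i *ᶻ binomialSum (suc a) (λ r → sign (i + r))
    ≡⟨ cong (N,i *ᶻ_) (trans (binomialSum-cong (suc a) (sign-+ i)) (binomialSum-*ˡ (suc a) (sign i) sign)) ⟩
  N,i *ᶻ (sign i *ᶻ binomialSum (suc a) sign)
    ≡⟨ cong (λ z → N,i *ᶻ (sign i *ᶻ z)) (binomialSum-sign a) ⟩
  N,i *ᶻ (sign i *ᶻ + 0)
    ≡⟨ vanish N,i (sign i) ⟩
  + 0 ∎
  where
  open ≡-Reasoning
  N,i = + ((i + suc a) choose i)
  vanish : ∀ p s → p *ᶻ (s *ᶻ + 0) ≡ + 0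
  vanish p s = trans (cong (p *ᶻ_) (ℤₚ.*-zeroʳ s)) (ℤₚ.*-zeroʳ p)

-- Binomial identities by clearing factorials

choose-factorial : ∀ i a → ((i + a) choose i) * (i ! * a !) ≡ (i + a) !
choose-factorial i a = subst (λ c → ((i + a) choose i) * (i ! * c !) ≡ (i + a) !) (m+n∸m≡n i a)
  (trans (cong (_* (i ! * (i + a ∸ i) !)) (nCk≡n!/k![n-k]! i≤)) (m/n*n≡m (k![n∸k]!∣n! i≤)))
  where
  i≤ = m≤m+n i a
  instance _ = m*n≢0 (i !) ((i + a ∸ i) !) {{i !≢0}} {{(i + a ∸ i) !≢0}}

absorption : ∀ b x → suc (b + x) * ((b + x) choose b) ≡ suc b * (suc (b + x) choose suc b)
absorption b x = *-cancelʳ-≡ _ _ (b ! * x !) (begin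
  suc (b + x) * ((b + x) choose b) * (b ! * x !)      ≡⟨ *-assoc (suc (b + x)) ((b + x) choose b) (b ! * x !) ⟩
  suc (b + x) * (((b + x) choose b) * (b ! * x !))    ≡⟨ cong (suc (b + x) *_) (choose-factorial b x) ⟩
  suc (b + x) !                                       ≡⟨ choose-factorial (suc b) x ⟨
  (suc (b + x) choose suc b) * (suc b * b ! * x !)    ≡⟨ regroup (suc (b + x) choose suc b) (suc b) (b !) (x !) ⟩
  suc b * (suc (b + x) choose suc b) * (b ! * x !) ∎)
  where
  open ≡-Reasoning
  instance _ = m*n≢0 (b !) (x !) {{b !≢0}} {{x !≢0}}
  regroup : ∀ c s p q → c * (s * p * q) ≡ s * c * (p * q)
  regroup = ℕ-Solver.solve-∀

choose-step : ∀ i a → suc i * ((i + suc a) choose suc i) ≡ suc a * ((i + suc a) choose i)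
choose-step i a = *-cancelʳ-≡ _ _ (i ! * a !) (begin
  suc i * ((i + suc a) choose suc i) * (i ! * a !)    ≡⟨ regroup₁ (suc i) ((i + suc a) choose suc i) (i !) (a !) ⟩
  ((i + suc a) choose suc i) * (suc i * i ! * a !)    ≡⟨ cong (λ m → (m choose suc i) * (suc i * i ! * a !)) (+-suc i a) ⟩
  (suc (i + a) choose suc i) * (suc i * i ! * a !)    ≡⟨ choose-factorial (suc i) a ⟩
  suc (i + a) !                                       ≡⟨ cong _! (+-suc i a) ⟨
  (i + suc a) !                                       ≡⟨ choose-factorial i (suc a) ⟨
  ((i + suc a) choose i) * (i ! * (suc a * a !))      ≡⟨ regroup₂ ((i + suc a) choose i) (i !) (suc a) (a !) ⟩
  suc a * ((i + suc a) choose i) * (i ! * a !) ∎)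
  where
  open ≡-Reasoning
  instance _ = m*n≢0 (i !) (a !) {{i !≢0}} {{a !≢0}}
  regroup₁ : ∀ s c p q → s * c * (p * q) ≡ c * (s * p * q)
  regroup₁ = ℕ-Solver.solve-∀
  regroup₂ : ∀ c p s q → c * (p * (s * q)) ≡ s * c * (p * q)
  regroup₂ = ℕ-Solver.solve-∀

choose-delete : ∀ i b → suc (i + b) * ((i + b) choose i) ≡ suc b * (suc (i + b) choose i)
choose-delete i b = *-cancelʳ-≡ _ _ (i ! * b !) (begin
  suc (i + b) * ((i + b) choose i) * (i ! * b !)      ≡⟨ *-assoc (suc (i + b)) ((i + b) choose i) (i ! * b !) ⟩
  suc (i + b) * (((i + b) choose i) * (i ! * b !))    ≡⟨ cong (suc (i + b) *_) (choose-factorial i b) ⟩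
  suc (i + b) !                                       ≡⟨ cong _! (+-suc i b) ⟨
  (i + suc b) !                                       ≡⟨ choose-factorial i (suc b) ⟨
  ((i + suc b) choose i) * (i ! * (suc b * b !))      ≡⟨ regroup ((i + suc b) choose i) (i !) (suc b) (b !) ⟩
  suc b * ((i + suc b) choose i) * (i ! * b !)        ≡⟨ cong (λ m → suc b * (m choose i) * (i ! * b !)) (+-suc i b) ⟩
  suc b * (suc (i + b) choose i) * (i ! * b !) ∎)
  where
  open ≡-Reasoning
  instance _ = m*n≢0 (i !) (b !) {{i !≢0}} {{b !≢0}}
  regroup : ∀ c p s q → c * (p * (s * q)) ≡ s * c * (p * q)
  regroup = ℕ-Solver.solve-∀

choose-choose : ∀ i c x → ((i + (c + x)) choose i) * ((c + x) choose c) ≡ ((i + c + x) choose (i + c)) * ((i + c) choose i)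
choose-choose i c x = *-cancelʳ-≡ _ _ (i ! * (c ! * x !)) (begin
  (i + (c + x)) choose i * (c + x) choose c * (i ! * (c ! * x !))
    ≡⟨ regroup₁ ((i + (c + x)) choose i) ((c + x) choose c) (i !) (c !) (x !) ⟩
  (i + (c + x)) choose i * (i ! * ((c + x) choose c * (c ! * x !)))
    ≡⟨ cong (λ z → (i + (c + x)) choose i * (i ! * z)) (choose-factorial c x) ⟩
  (i + (c + x)) choose i * (i ! * (c + x) !)
    ≡⟨ choose-factorial i (c + x) ⟩
  (i + (c + x)) !
    ≡⟨ cong _! (+-assoc i c x) ⟨
  (i + c + x) !
    ≡⟨ choose-factorial (i + c) x ⟨
  (i + c + x) choose (i + c) * ((i + c) ! * x !)
    ≡⟨ cong (λ z → (i + c + x) choose (i + c) * (z * x !)) (choose-factorial i c) ⟨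
  (i + c + x) choose (i + c) * ((i + c) choose i * (i ! * c !) * x !)
    ≡⟨ regroup₂ ((i + c + x) choose (i + c)) ((i + c) choose i) (i !) (c !) (x !) ⟩
  (i + c + x) choose (i + c) * (i + c) choose i * (i ! * (c ! * x !)) ∎)
  where
  open ≡-Reasoning
  instance
    _ = m*n≢0 (c !) (x !) {{c !≢0}} {{x !≢0}}
    _ = m*n≢0 (i !) (c ! * x !) {{i !≢0}}
  regroup₁ : ∀ u v p q r → u * v * (p * (q * r)) ≡ u * (p * (v * (q * r)))
  regroup₁ = ℕ-Solver.solve-∀
  regroup₂ : ∀ u v p q r → u * (v * (p * q) * r) ≡ u * v * (p * (q * r))
  regroup₂ = ℕ-Solver.solve-∀

-- Sparse paving matroids of rank at least 2

∣p∪⁅x⁆∣≡1+∣p∣ : ∀ {n} (p : Subset n) x → x ∉ p → ∣ p ∪ ⁅ x ⁆ ∣ ≡ suc ∣ p ∣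
∣p∪⁅x⁆∣≡1+∣p∣ (true  ∷ p) zero    x∉ = contradiction here x∉
∣p∪⁅x⁆∣≡1+∣p∣ (false ∷ p) zero    x∉ = cong (suc ∘ ∣_∣) (∪-identityʳ p)
∣p∪⁅x⁆∣≡1+∣p∣ (true  ∷ p) (suc x) x∉ = cong suc (∣p∪⁅x⁆∣≡1+∣p∣ p x (x∉ ∘ there))
∣p∪⁅x⁆∣≡1+∣p∣ (false ∷ p) (suc x) x∉ = ∣p∪⁅x⁆∣≡1+∣p∣ p x (x∉ ∘ there)

∣p∣<∣q∣⇒∃∉ : ∀ {n} (p q : Subset n) → ∣ p ∣ < ∣ q ∣ → ∃ λ e → e ∈ q × e ∉ p
∣p∣<∣q∣⇒∃∉ p q lt with nonempty? (q ─ p)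
... | yes (e , e∈) = e , p─q⊆p q p e∈ , x∈p─q⇒x∉q q p e∈
... | no  empty    = contradiction (p⊆q⇒∣p∣≤∣q∣ q⊆p) (<⇒≱ lt)
  where
  q⊆p : q ⊆ p
  q⊆p {x} x∈ with x ∈? p
  ... | yes x∈p = x∈p
  ... | no  x∉p = contradiction (x , x∈p∧x∉q⇒x∈p─q x∈ x∉p) empty

-- For sums over flats whose proper terms have a closed form `g` while the term at the top `A₀` is
-- still unknown.
Σˢ-extract : ∀ {n} (f g : Subset n → ℤ) A₀ → (∀ A → A ≢ A₀ → f A ≡ g A) → g A₀ ≡ + 0 → Σˢ f ≡ Σˢ g +ᶻ f A₀
Σˢ-extract f g A₀ h z = begin
  Σˢ f                              ≡⟨ Σˢ-cong (λ A → split (f A) (g A)) ⟩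
  Σˢ (λ A → g A +ᶻ (f A -ᶻ g A))    ≡⟨ Σˢ-+ g (λ A → f A -ᶻ g A) ⟩
  Σˢ g +ᶻ Σˢ (λ A → f A -ᶻ g A)     ≡⟨ cong (Σˢ g +ᶻ_) (Σˢ-single _ A₀ (λ A ne → ℤₚ.i≡j⇒i-j≡0 (h A ne))) ⟩
  Σˢ g +ᶻ (f A₀ -ᶻ g A₀)            ≡⟨ cong (λ x → Σˢ g +ᶻ (f A₀ -ᶻ x)) z ⟩
  Σˢ g +ᶻ (f A₀ +ᶻ + 0)             ≡⟨ cong (Σˢ g +ᶻ_) (ℤₚ.+-identityʳ (f A₀)) ⟩
  Σˢ g +ᶻ f A₀ ∎
  where
  open ≡-Reasoning
  split : ∀ a b → a ≡ b +ᶻ (a -ᶻ b)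
  split = ℤ-Solver.solve-∀

reflect-half : ∀ N i → ¬ (2 * i ≤ N) → i ≤ N → 2 * (N ∸ i) ≤ N
reflect-half N i ≰ i≤N = begin
  (N ∸ i) + ((N ∸ i) + 0)   ≡⟨ cong (λ d → (N ∸ i) + d) (+-identityʳ (N ∸ i)) ⟩
  (N ∸ i) + (N ∸ i)         ≤⟨ +-monoʳ-≤ (N ∸ i) N∸i≤i ⟩
  (N ∸ i) + i               ≡⟨ m∸n+n≡m i≤N ⟩
  N ∎
  where
  open ≤-Reasoning
  N∸i≤i : N ∸ i ≤ i
  N∸i≤i = m≤n+o⇒m∸n≤o N i (<⇒≤ (subst (N <_) (cong (λ j → i + j) (+-identityʳ i)) (≰⇒> ≰)))

module SparsePavingY {n} (rk : Subset n → ℕ) (isM : IsMatroid (mkRaw ⊤ rk)) (loopless : Loopless (mkRaw ⊤ rk))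
  (Q : RawMatroid n → Poly) (isQ : IsInverseKL Q) (k₁ : ℕ) (0<k₁ : 0 < k₁) (rk⊤ : rk ⊤ ≡ suc k₁)
  (small : ∀ A → ∣ A ∣ < suc k₁ → rk A ≡ ∣ A ∣) (large : ∀ A → suc k₁ < ∣ A ∣ → rk A ≡ suc k₁) where

  open KazhdanLusztig rk ⊤ isM loopless Q isQ public

  k : ℕ
  k = suc k₁

  -- Every subset of an independent set is a flat, so by induction only the top term of `Σy-low` is
  -- unknown, and signed binomials satisfy the same equation by `binomialSum-signed`. The upper half
  -- follows because both sides are palindromic.
  y-independent : ∀ m {G} → ∣ G ∣ < m → (∀ H → H ⊆ G → rk H ≡ ∣ H ∣) → ∀ i → y G i ≡ signedBinomial ∣ G ∣ i
  y-independent (suc m) {G} (s≤s lt) ind i with ∣ G ∣ ≟ 0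
  ... | yes z rewrite sym (⊆-∣∣≥⇒≡ (⊆-min G) (≤-trans (≤-reflexive z) z≤n)) = trans (y-⊥ i)
          (trans (base i) (cong (λ r → signedBinomial r i) (sym (∣⊥∣≡0 n))))
    where
    base : ∀ i → [ i ≡ᵇ 0 ] (+ 1) ≡ signedBinomial 0 i
    base zero    = refl
    base (suc i) rewrite k>n⇒nCk≡0 {0} {suc i} z<s = refl
  ... | no nz = main
    where
    open ≡-Reasoning
    rkG : rk G ≡ ∣ G ∣
    rkG = ind G ⊆-refl
    fl-⊆ : ∀ H → fl G H ≡ ⌊ H ⊆? G ⌋
    fl-⊆ H = bool-ext (λ e → ⌊⌋-true (H ⊆? G) (flat⊆ e)) (λ e → flat (⌊⌋-true⁻ (H ⊆? G) e))
      where
      flat : H ⊆ G → fl G H ≡ true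
      flat H⊆G = isFlat⁺ (M G) H (H⊆G , λ a a∈G a∉H → ≤-reflexive (trans (cong suc (ind H H⊆G))
        (trans (sym (∣p∪⁅x⁆∣≡1+∣p∣ H a a∉H)) (sym (ind (H ∪ ⁅ a ⁆) (∪-⊆ H⊆G (⁅⁆⊆ a∈G)))))))
    low : ∀ j → 2 * j ≤ ∣ G ∣ → y G j ≡ signedBinomial ∣ G ∣ j
    low j 2j≤ = begin
      y G j                              ≡⟨ []-true (y G j) (self-flat G) ⟨
      [ fl G G ] y G j                   ≡⟨ Σˢ-cancel (λ H → [ fl G H ] y H j) (λ H → [ ⌊ H ⊆? G ⌋ ] signedBinomial ∣ H ∣ j) G off
                                              (trans (Σy-low ⊆⊤ (subst (0 <_) (sym rkG) (n≢0⇒n>0 nz)) j (subst (2 * j ≤_) (sym rkG) 2j≤)) (sym total)) ⟩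
      ([ ⌊ G ⊆? G ⌋ ] signedBinomial ∣ G ∣ j) ≡⟨ []-true _ (⌊⌋-true (G ⊆? G) ⊆-refl) ⟩
      signedBinomial ∣ G ∣ j ∎
      where
      off : ∀ H → H ≢ G → [ fl G H ] y H j ≡ [ ⌊ H ⊆? G ⌋ ] signedBinomial ∣ H ∣ j
      off H H≢G = trans ([]-cong (fl G H) (λ flH → y-independent m (<-≤-trans (flat-smaller flH H≢G) lt)
                    (λ I I⊆H → ind I (⊆-trans I⊆H (flat⊆ flH))) j))
                  (cong ([_] _) (fl-⊆ H))
      j<G : j < ∣ G ∣
      j<G with j ≟ 0
      ... | yes refl = n≢0⇒n>0 nz
      ... | no  j≢0  = <-≤-trans (m<m+n j (subst (0 <_) (sym (+-identityʳ j)) (n≢0⇒n>0 j≢0))) 2j≤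
      total : Σˢ (λ H → [ ⌊ H ⊆? G ⌋ ] signedBinomial ∣ H ∣ j) ≡ + 0
      total with m≤n⇒∃[o]m+o≡n j<G
      ... | a , eq = trans (Σˢ-⊆ G (λ r → signedBinomial r j))
        (trans (cong (λ N → binomialSum N (λ r → signedBinomial r j)) (trans (sym eq) (sym (+-suc j a)))) (binomialSum-signed j a))
    main : y G i ≡ signedBinomial ∣ G ∣ i
    main with i ≤? ∣ G ∣ | 2 * i ≤? ∣ G ∣
    ... | no i≰  | _        = trans (y-degree (suc ∣ G ∣) ≤-refl ⊆⊤ i (subst (_< i) (sym rkG) (≰⇒> i≰)))
                               (sym (trans (cong (λ c → sign ∣ G ∣ *ᶻ + c) (k>n⇒nCk≡0 (≰⇒> i≰))) (ℤₚ.*-zeroʳ (sign ∣ G ∣))))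
    ... | yes _  | yes 2i≤  = low i 2i≤
    ... | yes i≤ | no  2i≰  = begin
      y G i                           ≡⟨ y-palindromic (suc ∣ G ∣) ≤-refl ⊆⊤ i (subst (i ≤_) (sym rkG) i≤) ⟨
      y G (rk G ∸ i)                  ≡⟨ cong (λ r → y G (r ∸ i)) rkG ⟩
      (y G (∣ G ∣ ∸ i))               ≡⟨ low (∣ G ∣ ∸ i) (reflect-half ∣ G ∣ i 2i≰ i≤) ⟩
      (signedBinomial ∣ G ∣ (∣ G ∣ ∸ i)) ≡⟨ cong (λ c → sign ∣ G ∣ *ᶻ + c) (nCk≡nC[n∸k] i≤) ⟨
      signedBinomial ∣ G ∣ i ∎

  y-small : ∀ {H} → ∣ H ∣ < k → ∀ i → y H i ≡ signedBinomial ∣ H ∣ i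
  y-small {H} lt = y-independent (suc ∣ H ∣) ≤-refl (λ I I⊆H → small I (≤-<-trans (p⊆q⇒∣p∣≤∣q∣ I⊆H) lt))

  rk-add : ∀ {H} e → e ∉ H → ∣ H ∣ < k₁ → rk H < rk (H ∪ ⁅ e ⁆)
  rk-add {H} e e∉H lt = ≤-reflexive (trans (cong suc (small H (<-trans lt (n<1+n k₁))))
    (trans (sym ∣He∣) (sym (small (H ∪ ⁅ e ⁆) (subst (_< k) (sym ∣He∣) (s≤s lt))))))
    where
    ∣He∣ = ∣p∪⁅x⁆∣≡1+∣p∣ H e e∉H

  -- The only delicate size is `k`: removing one element leaves a `k₁`-set, which is independent.
  rk-lower : ∀ A → k₁ ≤ ∣ A ∣ → k₁ ≤ rk A
  rk-lower A le with ∣ A ∣ <? k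
  ... | yes lt = subst (k₁ ≤_) (sym (small A lt)) le
  ... | no ≮k with ∣p∣<∣q∣⇒∃∉ ⊥ A (subst (_< ∣ A ∣) (sym (∣⊥∣≡0 n)) (<-≤-trans z<s (≮⇒≥ ≮k)))
  ...   | e , e∈A , _ with ∣ A ∣ ≟ k
  ...     | no ≢k = subst (k₁ ≤_) (sym (large A (≤∧≢⇒< (≮⇒≥ ≮k) (≢k ∘ sym)))) (n≤1+n k₁)
  ...     | yes ≡k = subst (_≤ rk A) (trans (small (A - e) (subst (_< k) (sym ∣A-e∣) ≤-refl)) ∣A-e∣) (R2 (A - e) A (p─q⊆p A ⁅ e ⁆) ⊆⊤)
    where
    ∣A-e∣ : ∣ A - e ∣ ≡ k₁
    ∣A-e∣ = suc-injective (trans (sym (∣p∪⁅x⁆∣≡1+∣p∣ (A - e) e (λ e∈ → x∈p─q⇒x∉q A ⁅ e ⁆ e∈ (x∈⁅x⁆ e))))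
              (trans (cong ∣_∣ (∪─ (⁅⁆⊆ e∈A))) ≡k))

  -- Circuit-hyperplanes: by small and large, they are the only sets whose rank is not min(|C|, k).
  CH : Subset n → Bool
  CH C = (∣ C ∣ ≡ᵇ k) ∧ (rk C ≡ᵇ k₁)

  CH-size : ∀ {C} → CH C ≡ true → ∣ C ∣ ≡ k
  CH-size {C} e = ≡ᵇ-true⁻ ∣ C ∣ k (proj₁ (∧-true⁻ e))

  CH-rk : ∀ {C} → CH C ≡ true → rk C ≡ k₁
  CH-rk {C} e = ≡ᵇ-true⁻ (rk C) k₁ (proj₂ (∧-true⁻ {∣ C ∣ ≡ᵇ k} e))

  CH-intro : ∀ {C} → ∣ C ∣ ≡ k → rk C ≡ k₁ → CH C ≡ true
  CH-intro p q = ∧-true (≡ᵇ-true p) (≡ᵇ-true q)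

  -- A subset of `C` with at least `k₁` elements already has the full rank `k₁` of `C`, so the
  -- proper flats of `C` are exactly its subsets with fewer than `k₁` elements, all of them
  -- independent.
  ΣCH-flats : ∀ {C} → CH C ≡ true → ∀ i →
    Σˢ (λ H → [ fl C H ] y H i) ≡ Σˢ (λ H → [ ⌊ H ⊆? C ⌋ ] [ ∣ H ∣ <ᵇ k₁ ] signedBinomial ∣ H ∣ i) +ᶻ y C i
  ΣCH-flats {C} ch i = trans
    (Σˢ-extract (λ H → [ fl C H ] y H i) (λ H → [ ⌊ H ⊆? C ⌋ ] [ ∣ H ∣ <ᵇ k₁ ] signedBinomial ∣ H ∣ i) C off at-C)
    (cong (Σˢ (λ H → [ ⌊ H ⊆? C ⌋ ] [ ∣ H ∣ <ᵇ k₁ ] signedBinomial ∣ H ∣ i) +ᶻ_) ([]-true _ (self-flat C)))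
    where
    at-C : [ ⌊ C ⊆? C ⌋ ] [ ∣ C ∣ <ᵇ k₁ ] signedBinomial ∣ C ∣ i ≡ + 0
    at-C = trans (cong ([ ⌊ C ⊆? C ⌋ ]_) ([]-false _ (λ e → <⇒≱ (<ᵇ-true⁻ ∣ C ∣ k₁ e) (subst (k₁ ≤_) (sym (CH-size ch)) (n≤1+n k₁)))))
                 ([]-zero ⌊ C ⊆? C ⌋)
    off : ∀ H → H ≢ C → [ fl C H ] y H i ≡ [ ⌊ H ⊆? C ⌋ ] [ ∣ H ∣ <ᵇ k₁ ] signedBinomial ∣ H ∣ i
    off H H≢C = trans
      (trans (cong ([_] y H i) (bool-ext to from))
        ([]-cong (⌊ H ⊆? C ⌋ ∧ (∣ H ∣ <ᵇ k₁)) (λ e → y-small (<-trans (lt e) (n<1+n k₁)) i)))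
      (sym ([]-∧ ⌊ H ⊆? C ⌋ (∣ H ∣ <ᵇ k₁) _))
      where
      lt : ⌊ H ⊆? C ⌋ ∧ (∣ H ∣ <ᵇ k₁) ≡ true → ∣ H ∣ < k₁
      lt e = <ᵇ-true⁻ ∣ H ∣ k₁ (proj₂ (∧-true⁻ {⌊ H ⊆? C ⌋} e))
      from : ⌊ H ⊆? C ⌋ ∧ (∣ H ∣ <ᵇ k₁) ≡ true → fl C H ≡ true
      from e = isFlat⁺ (M C) H (⌊⌋-true⁻ (H ⊆? C) (proj₁ (∧-true⁻ e)) , λ a _ a∉H → rk-add a a∉H (lt e))
      to : fl C H ≡ true → ⌊ H ⊆? C ⌋ ∧ (∣ H ∣ <ᵇ k₁) ≡ true
      to e = ∧-true (⌊⌋-true (H ⊆? C) (flat⊆ e)) (<ᵇ-true (≰⇒> not-large))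
        where
        not-large : ¬ (k₁ ≤ ∣ H ∣)
        not-large le with ∣p∣<∣q∣⇒∃∉ H C (flat-smaller e H≢C)
        ... | a , a∈C , a∉H = <⇒≱ (≤-<-trans (rk-lower H le) (proj₂ (isFlat⁻ (M C) H e) a a∈C a∉H))
              (subst (rk (H ∪ ⁅ a ⁆) ≤_) (CH-rk ch) (R2 _ _ (∪-⊆ (flat⊆ e) (⁅⁆⊆ a∈C)) ⊆⊤))

  -- `Σy-low` solved for the term at `C`. The factor `suc b`, that is `k₁ - i`, is the binomial
  -- coefficient `C(b+1,b)` left by the truncated alternating sum.
  y-CH-low : ∀ {C} → CH C ≡ true → ∀ i b → i + suc b ≡ k₁ → 2 * i ≤ k₁ →
             y C i ≡ sign k₁ *ᶻ (+ (k choose i) *ᶻ + suc b)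
  y-CH-low {C} ch i b i+b≡ 2i≤ = begin
    y C i
      ≡⟨ ℤₚ.+-identityˡ (y C i) ⟨
    + 0 +ᶻ y C i
      ≡⟨ cong (_+ᶻ y C i) (ℤₚ.+-inverseˡ S) ⟨
    (- S +ᶻ S) +ᶻ y C i
      ≡⟨ ℤₚ.+-assoc (- S) S (y C i) ⟩
    - S +ᶻ (S +ᶻ y C i)
      ≡⟨ cong (- S +ᶻ_) (trans (sym (ΣCH-flats ch i)) (Σy-low ⊆⊤ (subst (0 <_) (sym (CH-rk ch)) 0<k₁) i (subst (2 * i ≤_) (sym (CH-rk ch)) 2i≤))) ⟩
    - S +ᶻ + 0
      ≡⟨ trans (ℤₚ.+-identityʳ (- S)) (cong -_ S-value) ⟩
    - (sign (i + b) *ᶻ (+ (k choose i) *ᶻ + suc b))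
      ≡⟨ ℤₚ.neg-distribˡ-* (sign (i + b)) _ ⟩
    sign (suc (i + b)) *ᶻ (+ (k choose i) *ᶻ + suc b)
      ≡⟨ cong (λ r → sign r *ᶻ (+ (k choose i) *ᶻ + suc b)) (trans (sym (+-suc i b)) i+b≡) ⟩
    sign k₁ *ᶻ (+ (k choose i) *ᶻ + suc b) ∎
    where
    open ≡-Reasoning
    S = Σˢ (λ H → [ ⌊ H ⊆? C ⌋ ] [ ∣ H ∣ <ᵇ k₁ ] signedBinomial ∣ H ∣ i)
    k≡ : k ≡ i + suc (suc b)
    k≡ = trans (cong suc (sym i+b≡)) (sym (+-suc i (suc b)))
    S-value : S ≡ sign (i + b) *ᶻ (+ (k choose i) *ᶻ + suc b)
    S-value = begin
      S ≡⟨ Σˢ-⊆ C (λ r → [ r <ᵇ k₁ ] signedBinomial r i) ⟩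
      (binomialSum ∣ C ∣ (λ r → [ r <ᵇ k₁ ] signedBinomial r i))
        ≡⟨ cong₂ (λ N m → binomialSum N (λ r → [ r <ᵇ m ] signedBinomial r i)) (trans (CH-size ch) k≡) (sym i+b≡) ⟩
      binomialSum (i + suc (suc b)) (λ r → [ r <ᵇ i + suc b ] signedBinomial r i)
        ≡⟨ binomialSum-signed-below i (suc b) b ⟩
      sign (i + b) *ᶻ (+ ((i + suc (suc b)) choose i) *ᶻ + (suc b choose b))
        ≡⟨ cong₂ (λ N c → sign (i + b) *ᶻ (+ (N choose i) *ᶻ + c)) (sym k≡) sb-choose-b ⟩
      sign (i + b) *ᶻ (+ (k choose i) *ᶻ + suc b) ∎
      where
      sb-choose-b : suc b choose b ≡ suc b
      sb-choose-b = trans (nCk≡nC[n∸k] (n≤1+n b)) (trans (cong (suc b choose_) (m+n∸n≡m 1 b)) (nC1≡n (suc b)))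

  k≤n : k ≤ n
  k≤n = subst₂ _≤_ rk⊤ (∣⊤∣≡n n) (R1 ⊤ ⊆-refl)

  -- On a `k₁`-set this count is 0 or 1 and records whether the set fails to be a flat; as a sum
  -- over `C` it can be double counted.
  ν : Subset n → ℤ
  ν H = Σˢ (λ C → [ CH C ∧ ⌊ H ⊆? C ⌋ ] (+ 1))

  -- If `C` and `D` differed, their union would have rank `k` and their intersection rank at least
  -- `k₁`, against submodularity, since `C` and `D` both have rank `k₁`.
  CH-unique : ∀ {H C D} → k₁ ≤ ∣ H ∣ → CH C ≡ true → CH D ≡ true → H ⊆ C → H ⊆ D → C ≡ D
  CH-unique {H} {C} {D} k₁≤H chC chD H⊆C H⊆D with ∣ C ∪ D ∣ ≤? k
  ... | yes le = trans (⊆-∣∣≥⇒≡ {q = C ∪ D} ⊆∪ˡ (subst (∣ C ∪ D ∣ ≤_) (sym (CH-size chC)) le))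
                   (sym (⊆-∣∣≥⇒≡ {q = C ∪ D} ⊆∪ʳ (subst (∣ C ∪ D ∣ ≤_) (sym (CH-size chD)) le)))
  ... | no ≰k = contradiction sub (<⇒≱ (n<1+n (k₁ + k₁)))
    where
    open ≤-Reasoning
    sub : suc (k₁ + k₁) ≤ k₁ + k₁
    sub = begin
      k + k₁                       ≤⟨ +-monoʳ-≤ k (rk-lower (C ∩ D) (≤-trans k₁≤H (p⊆q⇒∣p∣≤∣q∣ (λ x∈ → x∈p∩q⁺ (H⊆C x∈ , H⊆D x∈))))) ⟩
      k + rk (C ∩ D)               ≡⟨ cong (_+ rk (C ∩ D)) (large (C ∪ D) (≰⇒> ≰k)) ⟨
      rk (C ∪ D) + rk (C ∩ D)      ≤⟨ R3 C D ⊆⊤ ⊆⊤ ⟩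
      rk C + rk D                  ≡⟨ cong₂ _+_ (CH-rk chC) (CH-rk chD) ⟩
      k₁ + k₁ ∎

  above? : ∀ H → Dec (∃ λ C → CH C ∧ ⌊ H ⊆? C ⌋ ≡ true)
  above? H = anySubset? (λ C → CH C ∧ ⌊ H ⊆? C ⌋ ≟ᵇ true)

  ν-none : ∀ H → ¬ (∃ λ C → CH C ∧ ⌊ H ⊆? C ⌋ ≡ true) → ν H ≡ + 0
  ν-none H none = trans (Σˢ-cong (λ C → []-false (+ 1) (λ e → none (C , e)))) (Σˢ-zero n)

  ν-one : ∀ H → k₁ ≤ ∣ H ∣ → (∃ λ C → CH C ∧ ⌊ H ⊆? C ⌋ ≡ true) → ν H ≡ + 1
  ν-one H k₁≤H (C , e) = trans (Σˢ-single _ C (λ D ne → []-false (+ 1) (λ e′ → ne (sym (unique e′))))) ([]-true (+ 1) e)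
    where
    split : ∀ {D} → CH D ∧ ⌊ H ⊆? D ⌋ ≡ true → CH D ≡ true × H ⊆ D
    split {D} e = proj₁ (∧-true⁻ e) , (λ {x} → ⌊⌋-true⁻ (H ⊆? D) (proj₂ (∧-true⁻ {CH D} e)) {x})
    unique : ∀ {D} → CH D ∧ ⌊ H ⊆? D ⌋ ≡ true → C ≡ D
    unique {D} e′ = CH-unique {H} k₁≤H (proj₁ (split {C} e)) (proj₁ (split {D} e′)) (proj₂ (split {C} e)) (proj₂ (split {D} e′))

  λᶜ : ℤ
  λᶜ = Σˢ (λ C → [ CH C ] (+ 1))

  -- Double counting of pairs `H ⊆ C`: a circuit-hyperplane has `k` subsets of size `k₁`.
  Σν : Σˢ (λ H → [ ∣ H ∣ ≡ᵇ k₁ ] ν H) ≡ λᶜ *ᶻ + k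
  Σν = begin
    (Σˢ (λ H → [ ∣ H ∣ ≡ᵇ k₁ ] ν H))
      ≡⟨ Σˢ-cong (λ H → sym (Σˢ-[] (∣ H ∣ ≡ᵇ k₁) (λ C → [ CH C ∧ ⌊ H ⊆? C ⌋ ] (+ 1)))) ⟩
    Σˢ (λ H → Σˢ (λ C → [ ∣ H ∣ ≡ᵇ k₁ ] [ CH C ∧ ⌊ H ⊆? C ⌋ ] (+ 1)))
      ≡⟨ Σˢ-swap (λ H C → [ ∣ H ∣ ≡ᵇ k₁ ] [ CH C ∧ ⌊ H ⊆? C ⌋ ] (+ 1)) ⟩
    Σˢ (λ C → Σˢ (λ H → [ ∣ H ∣ ≡ᵇ k₁ ] [ CH C ∧ ⌊ H ⊆? C ⌋ ] (+ 1)))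
      ≡⟨ Σˢ-cong (λ C → trans
           (Σˢ-cong (λ H → trans ([]-swap (∣ H ∣ ≡ᵇ k₁) (CH C ∧ ⌊ H ⊆? C ⌋) (+ 1)) (sym ([]-∧ (CH C) ⌊ H ⊆? C ⌋ _))))
           (Σˢ-[] (CH C) (λ H → [ ⌊ H ⊆? C ⌋ ] [ ∣ H ∣ ≡ᵇ k₁ ] (+ 1)))) ⟩
    Σˢ (λ C → [ CH C ] Σˢ (λ H → [ ⌊ H ⊆? C ⌋ ] [ ∣ H ∣ ≡ᵇ k₁ ] (+ 1)))
      ≡⟨ Σˢ-cong (λ C → trans ([]-cong (CH C) (count C)) (sym ([]-*ʳ (CH C) (+ 1) (+ k)))) ⟩
    Σˢ (λ C → ([ CH C ] (+ 1)) *ᶻ + k)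
      ≡⟨ Σˢ-*ʳ (+ k) (λ C → [ CH C ] (+ 1)) ⟩
    λᶜ *ᶻ + k ∎
    where
    open ≡-Reasoning
    k-choose-k₁ : k choose k₁ ≡ k
    k-choose-k₁ = trans (nCk≡nC[n∸k] (n≤1+n k₁)) (trans (cong (k choose_) (m+n∸n≡m 1 k₁)) (nC1≡n k))
    count : ∀ C → CH C ≡ true → Σˢ (λ H → [ ⌊ H ⊆? C ⌋ ] [ ∣ H ∣ ≡ᵇ k₁ ] (+ 1)) ≡ + 1 *ᶻ + k
    count C ch = begin
      Σˢ (λ H → [ ⌊ H ⊆? C ⌋ ] [ ∣ H ∣ ≡ᵇ k₁ ] (+ 1))   ≡⟨ Σˢ-⊆ C (λ r → [ r ≡ᵇ k₁ ] (+ 1)) ⟩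
      (binomialSum ∣ C ∣ (λ r → [ r ≡ᵇ k₁ ] (+ 1)))     ≡⟨ binomialSum-single ∣ C ∣ k₁ (+ 1) ⟩
      (+ (∣ C ∣ choose k₁) *ᶻ + 1)                      ≡⟨ cong (λ N → + (N choose k₁) *ᶻ + 1) (CH-size ch) ⟩
      + (k choose k₁) *ᶻ + 1                            ≡⟨ cong (λ c → + c *ᶻ + 1) k-choose-k₁ ⟩
      + k *ᶻ + 1                                        ≡⟨ ℤₚ.*-comm (+ k) (+ 1) ⟩
      + 1 *ᶻ + k ∎

  Σˢ-size : ∀ f → Σˢ {n} (λ H → f ∣ H ∣) ≡ binomialSum n f
  Σˢ-size f = trans (Σˢ-cong (λ (H : Subset n) → sym ([]-true (f ∣ H ∣) (⌊⌋-true (H ⊆? ⊤) ⊆⊤))))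
    (trans (Σˢ-⊆ {n} ⊤ f) (cong (λ N → binomialSum N f) (∣⊤∣≡n n)))

  CH-bound : λᶜ *ᶻ + k ≤ᶻ + (n choose k₁)
  CH-bound = begin
    λᶜ *ᶻ + k                              ≡⟨ Σν ⟨
    Σˢ (λ H → [ ∣ H ∣ ≡ᵇ k₁ ] ν H)         ≤⟨ Σˢ-mono bound ⟩
    Σˢ {n} (λ H → [ ∣ H ∣ ≡ᵇ k₁ ] (+ 1))   ≡⟨ Σˢ-size (λ r → [ r ≡ᵇ k₁ ] (+ 1)) ⟩
    binomialSum n (λ r → [ r ≡ᵇ k₁ ] (+ 1)) ≡⟨ binomialSum-single n k₁ (+ 1) ⟩
    + (n choose k₁) *ᶻ + 1                 ≡⟨ ℤₚ.*-identityʳ (+ (n choose k₁)) ⟩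
    + (n choose k₁) ∎
    where
    open ℤₚ.≤-Reasoning
    bound : ∀ H → [ ∣ H ∣ ≡ᵇ k₁ ] ν H ≤ᶻ [ ∣ H ∣ ≡ᵇ k₁ ] (+ 1)
    bound H with ∣ H ∣ ≡ᵇ k₁ in eq | above? H
    ... | false | _        = ℤₚ.≤-refl
    ... | true  | yes some = ℤₚ.≤-reflexive (ν-one H (≤-reflexive (sym (≡ᵇ-true⁻ ∣ H ∣ k₁ eq))) some)
    ... | true  | no none  = ℤₚ.≤-trans (ℤₚ.≤-reflexive (ν-none H none)) (+≤+ z≤n)

  -- The only candidate of size `k` would be the ground set, whose rank is `k` and not `k₁`.
  λᶜ-zero : n ≡ k → λᶜ ≡ + 0
  λᶜ-zero n≡k = trans (Σˢ-cong (λ C → []-false (+ 1) (λ ch → 1+n≢n (trans (sym rk⊤)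
    (trans (cong rk (sym (∣p∣≡n⇒p≡⊤ (trans (CH-size {C} ch) (sym n≡k))))) (CH-rk {C} ch)))))) (Σˢ-zero n)

  module _ (i : ℕ) (c : ℤ) (y-CH : ∀ C → CH C ≡ true → y C i ≡ c) where

    private
      s : ℕ → ℤ
      s r = signedBinomial r i

      -- Inclusion and correction: `below` treats every set of fewer than `k` elements as a flat,
      -- `hyperplane` takes back the `k₁`-sets inside a circuit-hyperplane, and `circuit` adds the
      -- circuit-hyperplanes themselves.
      below hyperplane circuit g : Subset n → ℤ
      below      H = [ ∣ H ∣ <ᵇ k ] s ∣ H ∣
      hyperplane H = [ ∣ H ∣ ≡ᵇ k₁ ] (ν H *ᶻ - s k₁)
      circuit    H = [ CH H ] c
      g H = below H +ᶻ (hyperplane H +ᶻ circuit H)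

      below-zero : ∀ {H} → k ≤ ∣ H ∣ → below H ≡ + 0
      below-zero {H} le = []-false _ (λ e → ≤⇒≯ le (<ᵇ-true⁻ ∣ H ∣ k e))

      hyperplane-zero : ∀ {H} → ∣ H ∣ ≢ k₁ → hyperplane H ≡ + 0
      hyperplane-zero {H} ne = []-false _ (ne ∘ ≡ᵇ-true⁻ ∣ H ∣ k₁)

      circuit-zero : ∀ {H} → CH H ≢ true → circuit H ≡ + 0
      circuit-zero = []-false c

      g-zero : ∀ {H} → k ≤ ∣ H ∣ → CH H ≢ true → g H ≡ + 0
      g-zero {H} le nch = cong₂ _+ᶻ_ (below-zero {H} le)
        (cong₂ _+ᶻ_ (hyperplane-zero {H} (λ e → 1+n≰n (subst (k ≤_) e le))) (circuit-zero nch))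

      flat≡g : ∀ H → H ≢ ⊤ → [ fl ⊤ H ] y H i ≡ g H
      flat≡g H H≢⊤ = by-size (<-cmp ∣ H ∣ k₁)
        where
        missing : ∃ λ e → e ∈ ⊤ × e ∉ H
        missing = ∣p∣<∣q∣⇒∃∉ H ⊤ (≰⇒> (λ le → H≢⊤ (⊆-∣∣≥⇒≡ ⊆⊤ le)))
        e₀ = proj₁ missing
        jump : fl ⊤ H ≡ true → rk H < rk (H ∪ ⁅ e₀ ⁆)
        jump fH = proj₂ (isFlat⁻ (M ⊤) H fH) e₀ ∈⊤ (proj₂ (proj₂ missing))
        not-CH : ∣ H ∣ ≢ k → CH H ≢ true
        not-CH ne e = ne (CH-size e)
        by-size : Tri (∣ H ∣ < k₁) (∣ H ∣ ≡ k₁) (k₁ < ∣ H ∣) → [ fl ⊤ H ] y H i ≡ g H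
        by-size (tri< lt ne _) = begin
          [ fl ⊤ H ] y H i       ≡⟨ []-true _ (isFlat⁺ (M ⊤) H (⊆⊤ , λ a _ a∉H → rk-add a a∉H lt)) ⟩
          y H i                  ≡⟨ y-small lt′ i ⟩
          (s ∣ H ∣)              ≡⟨ ℤₚ.+-identityʳ (s ∣ H ∣) ⟨
          (s ∣ H ∣) +ᶻ + 0       ≡⟨ cong₂ _+ᶻ_ ([]-true _ (<ᵇ-true lt′))
                                      (cong₂ _+ᶻ_ (hyperplane-zero {H} ne) (circuit-zero (not-CH (<⇒≢ lt′)))) ⟨
          g H ∎
          where
          open ≡-Reasoning
          lt′ : ∣ H ∣ < k
          lt′ = <-trans lt (n<1+n k₁)
        by-size (tri≈ _ eq _) with above? H
        -- Not a flat: an element of `C` outside `H` keeps the rank at `k₁`, so the two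
        -- contributions to `g H` cancel.
        ... | yes (C , both) = begin
          [ fl ⊤ H ] y H i       ≡⟨ []-false _ not-flat ⟩
          + 0                    ≡⟨ ℤₚ.+-inverseʳ (s k₁) ⟨
          s k₁ +ᶻ - s k₁         ≡⟨ cong (s k₁ +ᶻ_) (trans (ℤₚ.+-identityʳ _) (ℤₚ.*-identityˡ (- s k₁))) ⟨
          s k₁ +ᶻ (+ 1 *ᶻ - s k₁ +ᶻ + 0)
            ≡⟨ cong₂ _+ᶻ_ (trans ([]-true _ (<ᵇ-true (s≤s (≤-reflexive eq)))) (cong s eq))
                 (cong₂ _+ᶻ_ (trans ([]-true _ (≡ᵇ-true eq)) (cong (_*ᶻ - s k₁) (ν-one H (≤-reflexive (sym eq)) (C , both))))
                             (circuit-zero (not-CH (λ e → 1+n≢n (trans (sym e) eq))))) ⟨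
          g H ∎
          where
          open ≡-Reasoning
          ch : CH C ≡ true
          ch = proj₁ (∧-true⁻ both)
          H⊆C : H ⊆ C
          H⊆C = ⌊⌋-true⁻ (H ⊆? C) (proj₂ (∧-true⁻ {CH C} both))
          not-flat : fl ⊤ H ≢ true
          not-flat fH with ∣p∣<∣q∣⇒∃∉ H C (≤-reflexive (trans (cong suc eq) (sym (CH-size ch))))
          ... | a , a∈C , a∉H = <⇒≱ (≤-<-trans (rk-lower H (≤-reflexive (sym eq))) (proj₂ (isFlat⁻ (M ⊤) H fH) a ∈⊤ a∉H))
                (subst (rk (H ∪ ⁅ a ⁆) ≤_) (CH-rk ch) (R2 _ _ (∪-⊆ H⊆C (⁅⁆⊆ a∈C)) ⊆⊤))
        -- A flat: an element that did not raise the rank would complete `H` to a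
        -- circuit-hyperplane.
        ... | no none = begin
          [ fl ⊤ H ] y H i       ≡⟨ []-true _ flat ⟩
          y H i                  ≡⟨ y-small (s≤s (≤-reflexive eq)) i ⟩
          (s ∣ H ∣)              ≡⟨ ℤₚ.+-identityʳ (s ∣ H ∣) ⟨
          (s ∣ H ∣) +ᶻ (+ 0 *ᶻ - s k₁ +ᶻ + 0)
            ≡⟨ cong₂ _+ᶻ_ ([]-true _ (<ᵇ-true (s≤s (≤-reflexive eq))))
                 (cong₂ _+ᶻ_ (trans ([]-true _ (≡ᵇ-true eq)) (cong (_*ᶻ - s k₁) (ν-none H none)))
                             (circuit-zero (not-CH (λ e → 1+n≢n (trans (sym e) eq))))) ⟨
          g H ∎
          where
          open ≡-Reasoning
          flat : fl ⊤ H ≡ true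
          flat = isFlat⁺ (M ⊤) H (⊆⊤ , λ a _ a∉H → ≰⇒> (λ le →
            let size = trans (∣p∪⁅x⁆∣≡1+∣p∣ H a a∉H) (cong suc eq)
                rkH = trans (small H (s≤s (≤-reflexive eq))) eq
            in none (H ∪ ⁅ a ⁆ , ∧-true (CH-intro size (≤-antisym (≤-trans le (≤-reflexive rkH))
                      (rk-lower (H ∪ ⁅ a ⁆) (≤-trans (n≤1+n k₁) (≤-reflexive (sym size))))))
                    (⌊⌋-true (H ⊆? H ∪ ⁅ a ⁆) ⊆∪ˡ))))
        by-size (tri> _ ne gt) with CH H in ch
        ... | true = begin
          [ fl ⊤ H ] y H i       ≡⟨ []-true _ (isFlat⁺ (M ⊤) H (⊆⊤ , λ a _ a∉H → subst₂ _<_ (sym (CH-rk ch))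
                                      (sym (large (H ∪ ⁅ a ⁆) (≤-reflexive (trans (cong suc (sym (CH-size ch))) (sym (∣p∪⁅x⁆∣≡1+∣p∣ H a a∉H)))))) ≤-refl)) ⟩
          y H i                  ≡⟨ y-CH H ch ⟩
          c                      ≡⟨ trans (ℤₚ.+-identityˡ _) (ℤₚ.+-identityˡ c) ⟨
          + 0 +ᶻ (+ 0 +ᶻ c)      ≡⟨ cong₂ _+ᶻ_ (below-zero {H} gt) (cong (_+ᶻ c) (hyperplane-zero {H} ne)) ⟨
          below H +ᶻ (hyperplane H +ᶻ c) ∎
          where open ≡-Reasoning
        -- Not a flat: `H` already has full rank, being either larger than `k` or a `k`-set other
        -- than a circuit-hyperplane.
        ... | false = trans ([]-false _ not-flat) (sym (cong₂ _+ᶻ_ (below-zero {H} gt) (cong (_+ᶻ + 0) (hyperplane-zero {H} ne))))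
          where
          not-flat : fl ⊤ H ≢ true
          not-flat fH with ∣ H ∣ ≟ k
          ... | no ≢k = <⇒≱ (jump fH) (≤-trans (R2 _ _ ⊆⊤ ⊆⊤) (≤-reflexive (trans rk⊤ (sym (large H (≤∧≢⇒< gt (≢k ∘ sym)))))))
          ... | yes ≡k = contradiction (CH-intro ≡k (≤-antisym
                  (≤-pred (subst (rk H <_) (large (H ∪ ⁅ e₀ ⁆) (≤-reflexive (trans (cong suc (sym ≡k))
                    (sym (∣p∪⁅x⁆∣≡1+∣p∣ H e₀ (proj₂ (proj₂ missing))))))) (jump fH)))
                  (rk-lower H (<⇒≤ gt))))
                (λ e → case-false (trans (sym ch) e))
            where
            case-false : false ≢ true
            case-false ()

    Σflats-⊤ : Σˢ (λ H → [ fl ⊤ H ] y H i) ≡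
      (binomialSum n (λ r → [ r <ᵇ k ] signedBinomial r i) +ᶻ (λᶜ *ᶻ + k *ᶻ - signedBinomial k₁ i +ᶻ λᶜ *ᶻ c)) +ᶻ y ⊤ i
    Σflats-⊤ = begin
      Σˢ (λ H → [ fl ⊤ H ] y H i)
        ≡⟨ Σˢ-extract (λ H → [ fl ⊤ H ] y H i) g ⊤ flat≡g (g-zero {⊤} (subst (k ≤_) (sym (∣⊤∣≡n n)) k≤n)
             (λ e → 1+n≢n (trans (sym rk⊤) (CH-rk e)))) ⟩
      Σˢ g +ᶻ [ fl ⊤ ⊤ ] y ⊤ i
        ≡⟨ cong₂ _+ᶻ_ sums ([]-true _ (self-flat ⊤)) ⟩
      (binomialSum n (λ r → [ r <ᵇ k ] s r) +ᶻ (λᶜ *ᶻ + k *ᶻ - s k₁ +ᶻ λᶜ *ᶻ c)) +ᶻ y ⊤ i ∎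
      where
      open ≡-Reasoning
      Σhyperplane : Σˢ hyperplane ≡ λᶜ *ᶻ + k *ᶻ - s k₁
      Σhyperplane = trans (Σˢ-cong (λ H → sym ([]-*ʳ (∣ H ∣ ≡ᵇ k₁) (ν H) (- s k₁))))
        (trans (Σˢ-*ʳ (- s k₁) (λ H → [ ∣ H ∣ ≡ᵇ k₁ ] ν H)) (cong (_*ᶻ - s k₁) Σν))
      Σcircuit : Σˢ circuit ≡ λᶜ *ᶻ c
      Σcircuit = trans (Σˢ-cong (λ H → trans (cong ([ CH H ]_) (sym (ℤₚ.*-identityˡ c))) (sym ([]-*ʳ (CH H) (+ 1) c))))
        (Σˢ-*ʳ c (λ H → [ CH H ] (+ 1)))
      sums : Σˢ g ≡ binomialSum n (λ r → [ r <ᵇ k ] s r) +ᶻ (λᶜ *ᶻ + k *ᶻ - s k₁ +ᶻ λᶜ *ᶻ c)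
      sums = trans (Σˢ-+ below (λ H → hyperplane H +ᶻ circuit H)) (cong₂ _+ᶻ_ (Σˢ-size (λ r → [ r <ᵇ k ] s r))
        (trans (Σˢ-+ hyperplane circuit) (cong₂ _+ᶻ_ Σhyperplane Σcircuit)))

  -- `Σy-low` for the whole matroid, solved for the top term. The number `d` is coefficient `i` of
  -- `Y` of a circuit-hyperplane; each circuit-hyperplane costs `k` Boolean hyperplanes and gives
  -- back `d`.
  Y-low : ∀ i a b d → i + suc b ≡ k → i + suc a ≡ n → 2 * i ≤ k → (∀ C → CH C ≡ true → y C i ≡ sign k₁ *ᶻ d) →
    sign k *ᶻ y ⊤ i ≡ + (n choose i) *ᶻ + (a choose b) -ᶻ λᶜ *ᶻ (+ k *ᶻ + (k₁ choose i) -ᶻ d)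
  Y-low i a b d i+b≡ i+a≡ 2i≤ y-CH = begin
    - σ *ᶻ y ⊤ i
      ≡⟨ cong (- σ *ᶻ_) y⊤ ⟩
    - σ *ᶻ - (σ *ᶻ (A *ᶻ B) +ᶻ (λᶜ *ᶻ + k *ᶻ - (σ *ᶻ + (k₁ choose i)) +ᶻ λᶜ *ᶻ (σ *ᶻ d)))
      ≡⟨ expand σ A B λᶜ (+ k) (+ (k₁ choose i)) d ⟩
    (σ *ᶻ σ) *ᶻ (A *ᶻ B -ᶻ λᶜ *ᶻ (+ k *ᶻ + (k₁ choose i) -ᶻ d))
      ≡⟨ trans (cong (_*ᶻ (A *ᶻ B -ᶻ λᶜ *ᶻ (+ k *ᶻ + (k₁ choose i) -ᶻ d))) (sign*sign k₁)) (ℤₚ.*-identityˡ _) ⟩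
    A *ᶻ B -ᶻ λᶜ *ᶻ (+ k *ᶻ + (k₁ choose i) -ᶻ d) ∎
    where
    open ≡-Reasoning
    σ = sign k₁
    A = + (n choose i)
    B = + (a choose b)
    expand : ∀ σ A B l k t d → - σ *ᶻ - (σ *ᶻ (A *ᶻ B) +ᶻ (l *ᶻ k *ᶻ - (σ *ᶻ t) +ᶻ l *ᶻ (σ *ᶻ d))) ≡
             (σ *ᶻ σ) *ᶻ (A *ᶻ B -ᶻ l *ᶻ (k *ᶻ t -ᶻ d))
    expand = ℤ-Solver.solve-∀
    Σᵇ = binomialSum n (λ r → [ r <ᵇ k ] signedBinomial r i)
    Σᵇ-value : Σᵇ ≡ σ *ᶻ (A *ᶻ B)
    Σᵇ-value = begin
      Σᵇ ≡⟨ cong₂ (λ N m → binomialSum N (λ r → [ r <ᵇ m ] signedBinomial r i)) (sym i+a≡) (sym i+b≡) ⟩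
      binomialSum (i + suc a) (λ r → [ r <ᵇ i + suc b ] signedBinomial r i)
        ≡⟨ binomialSum-signed-below i a b ⟩
      sign (i + b) *ᶻ (+ ((i + suc a) choose i) *ᶻ B)
        ≡⟨ cong₂ (λ r N → sign r *ᶻ (+ (N choose i) *ᶻ B)) (suc-injective (trans (sym (+-suc i b)) i+b≡)) i+a≡ ⟩
      σ *ᶻ (A *ᶻ B) ∎
    y⊤ : y ⊤ i ≡ - (σ *ᶻ (A *ᶻ B) +ᶻ (λᶜ *ᶻ + k *ᶻ - (σ *ᶻ + (k₁ choose i)) +ᶻ λᶜ *ᶻ (σ *ᶻ d)))
    y⊤ = trans (negate _ (y ⊤ i) (trans (sym (Σflats-⊤ i (σ *ᶻ d) y-CH))
           (Σy-low ⊆⊤ (subst (0 <_) (sym rk⊤) z<s) i (subst (2 * i ≤_) (sym rk⊤) 2i≤))))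
         (cong (λ t → - (t +ᶻ (λᶜ *ᶻ + k *ᶻ - (σ *ᶻ + (k₁ choose i)) +ᶻ λᶜ *ᶻ (σ *ᶻ d)))) Σᵇ-value)
      where
      negate : ∀ s t → s +ᶻ t ≡ + 0 → t ≡ - s
      negate s t e = trans (rearrange s t) (trans (cong (_+ᶻ - s) e) (ℤₚ.+-identityˡ (- s)))
        where
        rearrange : ∀ s t → t ≡ (s +ᶻ t) +ᶻ - s
        rearrange = ℤ-Solver.solve-∀

  -- Since `k C(k-1,i) = (k-i) C(k,i)` and a circuit-hyperplane gives back `(k-1-i) C(k,i)`, exactly
  -- one `C(k,i)` is lost for each.
  Y-below-middle : ∀ i a b → i + suc b ≡ k → i + suc a ≡ n → 2 * i < k →
    sign k *ᶻ y ⊤ i ≡ + (n choose i) *ᶻ + (a choose b) -ᶻ λᶜ *ᶻ + (k choose i)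
  -- `b = 0` means `i = k₁`, which `2 * i < k` excludes because `k₁` is positive.
  Y-below-middle i a zero i+b≡ i+a≡ 2i< =
    contradiction (≤-pred 2i<) (<⇒≱ (subst (_< 2 * i) i≡k₁ (m<m+n i (subst (0 <_) (sym (trans (+-identityʳ i) i≡k₁)) 0<k₁))))
    where
    i≡k₁ : i ≡ k₁
    i≡k₁ = suc-injective (trans (sym (+-comm i 1)) i+b≡)
  Y-below-middle i a (suc b) i+b≡ i+a≡ 2i< = trans
    (Y-low i a (suc b) (+ (k choose i) *ᶻ + suc b) i+b≡ i+a≡ (<⇒≤ 2i<)
      (λ C ch → y-CH-low ch i b k₁≡ (≤-pred 2i<)))
    (cong (λ z → + (n choose i) *ᶻ + (a choose suc b) -ᶻ λᶜ *ᶻ z) (begin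
      + k *ᶻ + (k₁ choose i) -ᶻ + (k choose i) *ᶻ + suc b
        ≡⟨ cong (_-ᶻ + (k choose i) *ᶻ + suc b) (sym (ℤₚ.pos-* k (k₁ choose i))) ⟩
      + (k * (k₁ choose i)) -ᶻ + (k choose i) *ᶻ + suc b
        ≡⟨ cong (λ z → + z -ᶻ + (k choose i) *ᶻ + suc b) deletion ⟩
      + (suc (suc b) * (k choose i)) -ᶻ + (k choose i) *ᶻ + suc b
        ≡⟨ cong (_-ᶻ + (k choose i) *ᶻ + suc b) (ℤₚ.pos-* (suc (suc b)) (k choose i)) ⟩
      + suc (suc b) *ᶻ + (k choose i) -ᶻ + (k choose i) *ᶻ + suc b
        ≡⟨ cong (λ z → z *ᶻ + (k choose i) -ᶻ + (k choose i) *ᶻ + suc b) (ℤₚ.pos-+ 1 (suc b)) ⟩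
      (+ 1 +ᶻ + suc b) *ᶻ + (k choose i) -ᶻ + (k choose i) *ᶻ + suc b
        ≡⟨ collect (+ suc b) (+ (k choose i)) ⟩
      + (k choose i) ∎))
    where
    open ≡-Reasoning
    k₁≡ : i + suc b ≡ k₁
    k₁≡ = suc-injective (trans (sym (+-suc i (suc b))) i+b≡)
    deletion : k * (k₁ choose i) ≡ suc (suc b) * (k choose i)
    deletion = subst (λ m → suc m * (m choose i) ≡ suc (suc b) * (suc m choose i)) k₁≡ (choose-delete i (suc b))
    collect : ∀ b c → (+ 1 +ᶻ b) *ᶻ c -ᶻ c *ᶻ b ≡ c
    collect = ℤ-Solver.solve-∀

  -- A circuit-hyperplane has rank `2m + 1`, so its coefficient at `m + 1` is the one at `m`, equal
  -- to `(m+1) C(k,m)` up to sign. The lost hyperplanes amount to `(m+2) C(k,m)`, again one binomial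
  -- more.
  Y-middle : ∀ m a → suc m + suc m ≡ k → suc m + suc a ≡ n →
    sign k *ᶻ y ⊤ (suc m) ≡ + (n choose suc m) *ᶻ + (a choose m) -ᶻ λᶜ *ᶻ + (k choose m)
  Y-middle m a m+m≡ m+a≡ = trans
    (Y-low (suc m) a m (+ (k choose m) *ᶻ + suc m) m+m≡ m+a≡ (≤-reflexive (trans (cong (λ j → suc m + j) (+-identityʳ (suc m))) m+m≡)) y-CH)
    (cong (λ z → + (n choose suc m) *ᶻ + (a choose m) -ᶻ λᶜ *ᶻ z) (begin
      + k *ᶻ + (k₁ choose suc m) -ᶻ + (k choose m) *ᶻ + suc m
        ≡⟨ cong (_-ᶻ + (k choose m) *ᶻ + suc m) (sym (ℤₚ.pos-* k (k₁ choose suc m))) ⟩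
      + (k * (k₁ choose suc m)) -ᶻ + (k choose m) *ᶻ + suc m
        ≡⟨ cong (λ z → + z -ᶻ + (k choose m) *ᶻ + suc m) deletion ⟩
      + (suc (suc m) * (k choose m)) -ᶻ + (k choose m) *ᶻ + suc m
        ≡⟨ cong (_-ᶻ + (k choose m) *ᶻ + suc m) (ℤₚ.pos-* (suc (suc m)) (k choose m)) ⟩
      + suc (suc m) *ᶻ + (k choose m) -ᶻ + (k choose m) *ᶻ + suc m
        ≡⟨ cong (λ z → z *ᶻ + (k choose m) -ᶻ + (k choose m) *ᶻ + suc m) (ℤₚ.pos-+ 1 (suc m)) ⟩
      (+ 1 +ᶻ + suc m) *ᶻ + (k choose m) -ᶻ + (k choose m) *ᶻ + suc m
        ≡⟨ collect (+ suc m) (+ (k choose m)) ⟩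
      + (k choose m) ∎))
    where
    open ≡-Reasoning
    collect : ∀ b c → (+ 1 +ᶻ b) *ᶻ c -ᶻ c *ᶻ b ≡ c
    collect = ℤ-Solver.solve-∀
    k₁≡ : m + suc m ≡ k₁
    k₁≡ = suc-injective m+m≡
    deletion : k * (k₁ choose suc m) ≡ suc (suc m) * (k choose m)
    deletion = begin
      k * (k₁ choose suc m)
        ≡⟨ subst (λ r → suc r * (r choose suc m) ≡ suc m * (suc r choose suc m)) (trans (sym (+-suc m m)) k₁≡) (choose-delete (suc m) m) ⟩
      suc m * (k choose suc m)
        ≡⟨ subst (λ r → suc m * (r choose suc m) ≡ suc (suc m) * (r choose m)) (trans (+-suc m (suc m)) m+m≡) (choose-step m (suc m)) ⟩
      suc (suc m) * (k choose m) ∎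
    y-CH : ∀ C → CH C ≡ true → y C (suc m) ≡ sign k₁ *ᶻ (+ (k choose m) *ᶻ + suc m)
    y-CH C ch = begin
      y C (suc m)          ≡⟨ cong (y C) (trans (sym (m+n∸m≡n m (suc m))) (cong (_∸ m) (trans k₁≡ (sym (CH-rk ch))))) ⟩
      y C (rk C ∸ m)       ≡⟨ y-palindromic (suc ∣ C ∣) ≤-refl ⊆⊤ m (subst (m ≤_) (trans k₁≡ (sym (CH-rk ch))) (m≤m+n m (suc m))) ⟩
      y C m                ≡⟨ y-CH-low ch m m k₁≡ (subst (2 * m ≤_) k₁≡ (+-monoʳ-≤ m (≤-trans (≤-reflexive (+-identityʳ m)) (n≤1+n m)))) ⟩
      sign k₁ *ᶻ (+ (k choose m) *ᶻ + suc m) ∎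

-- Symmetric sequences that are rising and log-concave on the first half

module Symmetric (k : ℕ) (α : ℕ → ℕ) (α-sym : ∀ i j → i + j ≡ k → α i ≡ α j)
  (rise : ∀ i → suc i + suc i ≤ k → α i ≤ α (suc i))
  (lc : ∀ i → (2 + i) + (2 + i) ≤ k → α i * α (2 + i) ≤ α (1 + i) * α (1 + i)) where

  fall : ∀ i d → suc i + d ≡ k → d ≤ i → α (suc i) ≤ α i
  fall i d eq d≤i with d ≟ i
  ... | yes refl = ≤-reflexive (α-sym (suc i) i eq)
  ... | no d≢i = begin
    α (suc i)  ≡⟨ α-sym (suc i) d eq ⟩
    α d        ≤⟨ rise d (subst (suc d + suc d ≤_) eq′ (+-monoˡ-≤ (suc d) (≤∧≢⇒< d≤i d≢i))) ⟩
    α (suc d)  ≡⟨ α-sym i (suc d) eq′ ⟨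
    α i ∎
    where
    open ≤-Reasoning
    eq′ : i + suc d ≡ k
    eq′ = trans (+-suc i d) eq

  log-concave : ∀ i d → 2 + i + d ≡ k → α i * α (2 + i) ≤ α (1 + i) * α (1 + i)
  log-concave i d eq with 2 + i ≤? d | 2 + d ≤? i
  ... | yes le | _ = lc i (subst ((2 + i) + (2 + i) ≤_) eq (+-monoʳ-≤ (2 + i) le))
  ... | no _ | yes le = begin
    α i * α (2 + i)          ≡⟨ cong₂ _*_ (α-sym i (2 + d) e₀) (α-sym (2 + i) d eq) ⟩
    α (2 + d) * α d          ≡⟨ *-comm (α (2 + d)) (α d) ⟩
    α d * α (2 + d)          ≤⟨ lc d (subst ((2 + d) + (2 + d) ≤_) e₀ (+-monoˡ-≤ (2 + d) le)) ⟩
    α (1 + d) * α (1 + d)    ≡⟨ cong (λ z → z * z) (α-sym (1 + i) (1 + d) e₁) ⟨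
    α (1 + i) * α (1 + i) ∎
    where
    open ≤-Reasoning
    e₀ : i + (2 + d) ≡ k
    e₀ = trans (+-suc i (suc d)) (trans (cong suc (+-suc i d)) eq)
    e₁ : 1 + i + (1 + d) ≡ k
    e₁ = trans (cong suc (+-suc i d)) eq
  -- Here `i` and `d` differ by at most one, so `1 + i` is a central index: neither neighbour
  -- exceeds it, and the two inequalities multiply.
  ... | no i≰ | no d≰ = *-mono-≤ (up i d eq (≤-pred (≰⇒> d≰))) (down (≤-pred (≰⇒> i≰)))
    where
    up : ∀ i d → 2 + i + d ≡ k → i ≤ suc d → α i ≤ α (1 + i)
    up i d eq i≤1+d with i ≤? d
    ... | yes i≤d = rise i (subst (suc i + suc i ≤_) (trans (cong suc (+-suc i d)) eq) (+-monoʳ-≤ (suc i) (s≤s i≤d)))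
    ... | no i≰d with ≤-antisym i≤1+d (≰⇒> i≰d)
    ...   | refl = ≤-reflexive (α-sym i (1 + i) (trans (+-suc i i) (trans (cong suc (+-suc i d)) eq)))
    down : d ≤ suc i → α (2 + i) ≤ α (1 + i)
    down d≤1+i = fall (suc i) d eq d≤1+i

half : ∀ k → ∃ λ j → j + j ≤ k × k ≤ suc (j + j)
half zero = 0 , z≤n , z≤n
half (suc zero) = 0 , z≤n , ≤-refl
half (suc (suc k)) with half k
... | j , lo , hi = suc j , subst (_≤ 2 + k) (cong suc (sym (+-suc j j))) (s≤s (s≤s lo))
                  , subst (2 + k ≤_) (cong (λ z → 2 + z) (sym (+-suc j j))) (s≤s (s≤s hi))

-- Inequalities between the coefficients

-- The coefficients are known only as quotients `A / p` and `B / q`, so they are compared by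
-- cross-multiplication.
cancel-≤ : ∀ p q {a b A B} .{{_ : NonZero p}} .{{_ : NonZero q}} → p * a ≡ A → q * b ≡ B → A * q ≤ B * p → a ≤ b
cancel-≤ p q {a} {b} {A} {B} pa qb le = *-cancelˡ-≤ (p * q) {{m*n≢0 p q}} (begin
  p * q * a    ≡⟨ regroup₁ p q a ⟩
  p * a * q    ≡⟨ cong (_* q) pa ⟩
  A * q        ≤⟨ le ⟩
  B * p        ≡⟨ cong (_* p) qb ⟨
  q * b * p    ≡⟨ regroup₂ p q b ⟩
  p * q * b ∎)
  where
  open ≤-Reasoning
  regroup₁ : ∀ p q a → p * q * a ≡ p * a * q
  regroup₁ = ℕ-Solver.solve-∀
  regroup₂ : ∀ p q b → q * b * p ≡ p * q * b
  regroup₂ = ℕ-Solver.solve-∀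

cancel-square-≤ : ∀ p₀ p₁ p₂ {a₀ a₁ a₂ A₀ A₁ A₂} .{{_ : NonZero p₀}} .{{_ : NonZero p₁}} .{{_ : NonZero p₂}} →
  p₀ * a₀ ≡ A₀ → p₁ * a₁ ≡ A₁ → p₂ * a₂ ≡ A₂ → A₀ * A₂ * (p₁ * p₁) ≤ A₁ * A₁ * (p₀ * p₂) → a₀ * a₂ ≤ a₁ * a₁
cancel-square-≤ p₀ p₁ p₂ {a₀} {a₁} {a₂} e₀ e₁ e₂ =
  cancel-≤ (p₀ * p₂) (p₁ * p₁) {{m*n≢0 p₀ p₂}} {{m*n≢0 p₁ p₁}}
    (trans (regroup p₀ p₂ a₀ a₂) (cong₂ _*_ e₀ e₂)) (trans (regroup p₁ p₁ a₁ a₁) (cong₂ _*_ e₁ e₁))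
  where
  regroup : ∀ p q a b → p * q * (a * b) ≡ p * a * (q * b)
  regroup = ℕ-Solver.solve-∀

-- With X = (n-k) λ, σ = C(n,k) - (n-k+1) λ and b = k-i-1, the i-th coefficient (i < k/2) is C(k,i) / (n-i) times this.
weight : ℕ → ℕ → ℕ → ℕ
weight X σ b = b * X + suc b * σ

-- After multiplication by `suc i` the binomials drop out and `suc i ≤ b` reduces the claim to
-- `b * w₁ ≤ (2 + b) * w₀`, where the two sides differ by `b * X + (2 + b) * σ`.
rise-bound : ∀ i b x X σ c₀ c₁ → suc i ≤ b → suc i * c₁ ≡ (2 + b) * c₀ →
  c₀ * weight X σ (suc b) * (suc b + x) ≤ c₁ * weight X σ b * (2 + b + x)
rise-bound i b x X σ c₀ c₁ i<b c≡ = *-cancelˡ-≤ (suc i) (begin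
  suc i * (c₀ * w₁ * (suc b + x))                 ≡⟨ regroup₁ (suc i) c₀ w₁ (suc b + x) ⟩
  c₀ * (suc i * w₁) * (suc b + x)                 ≤⟨ *-mono-≤ (*-monoʳ-≤ c₀ (*-monoˡ-≤ w₁ i<b)) (n≤1+n (suc b + x)) ⟩
  c₀ * (b * w₁) * (2 + b + x)                     ≤⟨ m≤m+n _ _ ⟩
  c₀ * (b * w₁) * (2 + b + x) + c₀ * (b * X + (2 + b) * σ) * (2 + b + x)
                                                  ≡⟨ slack b c₀ X σ (2 + b + x) ⟩
  (2 + b) * c₀ * w₀ * (2 + b + x)                 ≡⟨ cong (λ z → z * w₀ * (2 + b + x)) c≡ ⟨
  suc i * c₁ * w₀ * (2 + b + x)                   ≡⟨ regroup₂ (suc i) c₁ w₀ (2 + b + x) ⟩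
  suc i * (c₁ * w₀ * (2 + b + x)) ∎)
  where
  open ≤-Reasoning
  w₀ = weight X σ b
  w₁ = weight X σ (suc b)
  regroup₁ : ∀ s c w p → s * (c * w * p) ≡ c * (s * w) * p
  regroup₁ = ℕ-Solver.solve-∀
  regroup₂ : ∀ s c w p → s * c * w * p ≡ s * (c * w * p)
  regroup₂ = ℕ-Solver.solve-∀
  slack : ∀ b c X σ p → c * (b * (suc b * X + suc (suc b) * σ)) * p + c * (b * X + (2 + b) * σ) * p ≡
                        (2 + b) * c * (b * X + suc b * σ) * p
  slack = ℕ-Solver.solve-∀

-- Binomials and weights are log-concave, but the factor `1 / (n - i)` is log-convex. The gain from
-- `2 + b` to `3 + b` in the binomial ratio pays for it: with `y = 2 + b + x`, `(2 + b) y²` is at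
-- most `(3 + b) (y² - 1)`.
log-concave-bound : ∀ i b x X σ c₀ c₁ c₂ → (3 + b) * c₀ ≡ suc i * c₁ → (2 + i) * c₂ ≡ (2 + b) * c₁ →
  c₀ * weight X σ (2 + b) * (c₂ * weight X σ b) * ((2 + b + x) * (2 + b + x)) ≤
  c₁ * weight X σ (1 + b) * (c₁ * weight X σ (1 + b)) * ((3 + b + x) * (1 + b + x))
log-concave-bound i b x X σ c₀ c₁ c₂ c₀≡ c₂≡ = *-cancelˡ-≤ ((3 + b) * (2 + i)) (begin
  (3 + b) * (2 + i) * (c₀ * w₂ * (c₂ * w₀) * (y * y))
    ≡⟨ regroup₁ (3 + b) (2 + i) c₀ c₂ w₂ w₀ (y * y) ⟩
  (3 + b) * c₀ * ((2 + i) * c₂) * (w₂ * w₀ * (y * y))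
    ≡⟨ cong₂ (λ u v → u * v * (w₂ * w₀ * (y * y))) c₀≡ c₂≡ ⟩
  suc i * c₁ * ((2 + b) * c₁) * (w₂ * w₀ * (y * y))
    ≡⟨ regroup₂ (suc i) (2 + b) c₁ (w₂ * w₀) (y * y) ⟩
  c₁ * c₁ * (w₂ * w₀ * (suc i * ((2 + b) * (y * y))))
    ≤⟨ *-monoʳ-≤ (c₁ * c₁) (*-mono-≤ weights (*-mono-≤ (n≤1+n (suc i)) factors)) ⟩
  c₁ * c₁ * (w₁ * w₁ * ((2 + i) * ((3 + b) * ((3 + b + x) * (1 + b + x)))))
    ≡⟨ regroup₃ (3 + b) (2 + i) c₁ w₁ ((3 + b + x) * (1 + b + x)) ⟩
  (3 + b) * (2 + i) * (c₁ * w₁ * (c₁ * w₁) * ((3 + b + x) * (1 + b + x))) ∎)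
  where
  open ≤-Reasoning
  y = 2 + b + x
  w₀ = weight X σ b
  w₁ = weight X σ (1 + b)
  w₂ = weight X σ (2 + b)
  regroup₁ : ∀ s t c d w v p → s * t * (c * w * (d * v) * p) ≡ s * c * (t * d) * (w * v * p)
  regroup₁ = ℕ-Solver.solve-∀
  regroup₂ : ∀ s t c w p → s * c * (t * c) * (w * p) ≡ c * c * (w * (s * (t * p)))
  regroup₂ = ℕ-Solver.solve-∀
  regroup₃ : ∀ s t c w p → c * c * (w * w * (t * (s * p))) ≡ s * t * (c * w * (c * w) * p)
  regroup₃ = ℕ-Solver.solve-∀
  -- The weights form an arithmetic progression with difference X + σ.
  progression : ∀ b X σ → (suc (suc b) * X + suc (suc (suc b)) * σ) * (b * X + suc b * σ) + (X + σ) * (X + σ) ≡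
                          (suc b * X + suc (suc b) * σ) * (suc b * X + suc (suc b) * σ)
  progression = ℕ-Solver.solve-∀
  weights : w₂ * w₀ ≤ w₁ * w₁
  weights = ≤-trans (m≤m+n _ _) (≤-reflexive (progression b X σ))
  slack : ∀ b x → (2 + b) * ((2 + b + x) * (2 + b + x)) + (b * b + 3 * b + 1 + (2 * ((2 + b) * x) + x * x)) ≡
                  (3 + b) * ((3 + b + x) * (1 + b + x))
  slack = ℕ-Solver.solve-∀
  factors : (2 + b) * (y * y) ≤ (3 + b) * ((3 + b + x) * (1 + b + x))
  factors = ≤-trans (m≤m+n _ _) (≤-reflexive (slack b x))

-- For k = 2m, the m-th coefficient is C(k,m-1) / (n-m) times this.
middleWeight : ℕ → ℕ → ℕ → ℕ → ℕ
middleWeight x ℓ σ m = suc (m * x) * ℓ + suc m * σ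

-- The middle coefficient carries the binomial of its left neighbour, and its weight is larger by
-- exactly `ℓ`.
rise-middle-bound : ∀ m x ℓ σ c → c * weight (x * ℓ) σ m * (m + x) ≤ c * middleWeight x ℓ σ m * (suc m + x)
rise-middle-bound m x ℓ σ c = *-mono-≤ (*-monoʳ-≤ c (+-monoˡ-≤ (suc m * σ)
  (≤-trans (≤-reflexive (sym (*-assoc m x ℓ))) (*-monoˡ-≤ ℓ (n≤1+n (m * x)))))) (n≤1+n (m + x))

-- The coefficients of λ², λσ and σ² are compared separately; when n = k the first two are absent, as λ = 0.
middle-weights-bound : ∀ m x ℓ σ → (x ≡ 0 → ℓ ≡ 0) → let M = 2 + m in
  suc m * (weight (x * ℓ) σ (suc M) * middleWeight x ℓ σ M) * ((suc M + x) * (suc M + x)) ≤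
  (2 + M) * (weight (x * ℓ) σ M * weight (x * ℓ) σ M) * ((2 + M + x) * (M + x))
middle-weights-bound m zero ℓ σ ℓ≡0 rewrite ℓ≡0 refl = ≤-trans (m≤m+n _ _) (≤-reflexive (slack m σ))
  where
  slack : ∀ m σ → let M = suc (suc m) in
    suc m * ((suc M * 0 + suc (suc M) * σ) * (suc (M * 0) * 0 + suc M * σ)) * ((suc M + 0) * (suc M + 0))
      + (2 + M) * (suc M * suc M) * σ * σ * (2 * m + 5) ≡
    (2 + M) * ((M * 0 + suc M * σ) * (M * 0 + suc M * σ)) * ((2 + M + 0) * (M + 0))
  slack = ℕ-Solver.solve-∀
middle-weights-bound m (suc x) ℓ σ _ = begin
  suc m * (weight (X * ℓ) σ (suc M) * middleWeight X ℓ σ M) * P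
    ≡⟨ expandˡ (suc m) M X ℓ σ P ⟩
  ℓ * ℓ * (X * (suc m * suc M * suc (M * X) * P)) + ℓ * σ * (suc m * (suc M * suc M * X + suc (suc M) * suc (M * X)) * P)
    + σ * σ * ((2 + M) * suc M * (suc m * P))
    ≤⟨ +-mono-≤ (+-mono-≤ (*-monoʳ-≤ (ℓ * ℓ) (*-monoʳ-≤ X (≤-trans (m≤m+n _ _) (≤-reflexive (slack₁ m x)))))
                          (*-monoʳ-≤ (ℓ * σ) (≤-trans (m≤m+n _ _) (≤-reflexive (slack₂ m x)))))
                (*-monoʳ-≤ (σ * σ) (*-monoʳ-≤ ((2 + M) * suc M) {suc m * P} {suc M * R} (≤-trans (m≤m+n (suc m * P) _) (≤-reflexive (slack₃ m x))))) ⟩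
  ℓ * ℓ * (X * ((2 + M) * (M * M) * X * R)) + ℓ * σ * (2 * ((2 + M) * M * suc M * X) * R)
    + σ * σ * ((2 + M) * suc M * (suc M * R))
    ≡⟨ expandʳ M X ℓ σ R ⟨
  (2 + M) * (weight (X * ℓ) σ M * weight (X * ℓ) σ M) * R ∎
  where
  open ≤-Reasoning
  M = 2 + m
  X = suc x
  P = (suc M + X) * (suc M + X)
  R = (2 + M + X) * (M + X)
  expandˡ : ∀ N M X ℓ σ P →
    N * ((suc M * (X * ℓ) + suc (suc M) * σ) * (suc (M * X) * ℓ + suc M * σ)) * P ≡
    ℓ * ℓ * (X * (N * suc M * suc (M * X) * P)) + ℓ * σ * (N * (suc M * suc M * X + suc (suc M) * suc (M * X)) * P)
      + σ * σ * ((2 + M) * suc M * (N * P))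
  expandˡ = ℕ-Solver.solve-∀
  expandʳ : ∀ M X ℓ σ R →
    (2 + M) * ((M * (X * ℓ) + suc M * σ) * (M * (X * ℓ) + suc M * σ)) * R ≡
    ℓ * ℓ * (X * ((2 + M) * (M * M) * X * R)) + ℓ * σ * (2 * ((2 + M) * M * suc M * X) * R)
      + σ * σ * ((2 + M) * suc M * (suc M * R))
  expandʳ = ℕ-Solver.solve-∀
  -- The substitutions `M = 2 + m` and `X = 1 + x` build in the ranges of the parameters; the
  -- bracketed polynomial is the difference of the two sides, now with nonnegative coefficients
  -- only. `slack₂` and `slack₃` are formed in the same way.
  slack₁ : ∀ m x → let M = suc (suc m); X = suc x in
    suc m * suc M * suc (M * X) * ((suc M + X) * (suc M + X)) +
    (2 * m * m * m * m * x + 1 * m * m * m * m + 4 * m * m * m * x * x + 26 * m * m * m * x + 12 * m * m * m + 2 * m * m * x * x * x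
      + 35 * m * m * x * x + 124 * m * m * x + 55 * m * m + 9 * m * x * x * x + 97 * m * x * x + 258 * m * x + 116 * m
      + 10 * x * x * x + 87 * x * x + 200 * x + 96) ≡
    (2 + M) * (M * M) * X * ((2 + M + X) * (M + X))
  slack₁ = ℕ-Solver.solve-∀
  slack₂ : ∀ m x → let M = suc (suc m); X = suc x in
    suc m * (suc M * suc M * X + suc (suc M) * suc (M * X)) * ((suc M + X) * (suc M + X)) +
    (4 * m * m * m * m * x + 3 * m * m * m * m + 8 * m * m * m * x * x + 59 * m * m * m * x + 40 * m * m * m + 4 * m * m * x * x * x
      + 81 * m * m * x * x + 321 * m * m * x + 201 * m * m + 23 * m * x * x * x + 264 * m * x * x + 762 * m * x + 452 * m
      + 31 * x * x * x + 275 * x * x + 664 * x + 384) ≡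
    2 * ((2 + M) * M * suc M * X) * ((2 + M + X) * (M + X))
  slack₂ = ℕ-Solver.solve-∀
  slack₃ : ∀ m x → let M = suc (suc m); X = suc x in
    suc m * ((suc M + X) * (suc M + X)) + (2 * m * m + 4 * m * x + 15 * m + 2 * x * x + 16 * x + 29) ≡
    suc M * ((2 + M + X) * (M + X))
  slack₃ = ℕ-Solver.solve-∀

-- The coefficient formula determines the shape

choose-nonzero : ∀ {i k} → i ≤ k → k choose i ≢ 0
choose-nonzero {i} {k} i≤k z with m≤n⇒∃[o]m+o≡n i≤k
... | d , refl = contradiction (trans (sym (choose-factorial i d)) (cong (_* (i ! * d !)) z)) (≢-nonZero⁻¹ ((i + d) !) {{(i + d) !≢0}})

-- Nonnegativity of an integer coefficient is read off from a positive multiple of it that is a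
-- natural number.
natural-quotient : ∀ p z w → + suc p *ᶻ z ≡ + w → z ≡ + absᶻ z × suc p * absᶻ z ≡ w
natural-quotient p (+ a)    w eq = refl , ℤₚ.+-injective (trans (ℤₚ.pos-* (suc p) a) eq)
natural-quotient p -[1+ a ] w ()

lift-difference : ∀ p u v l c {w} → p * (u * v) ≡ w + p * (l * c) → + p *ᶻ (+ u *ᶻ + v -ᶻ + l *ᶻ + c) ≡ + w
lift-difference p u v l c {w} eq = begin
  + p *ᶻ (+ u *ᶻ + v -ᶻ + l *ᶻ + c)             ≡⟨ cong₂ (λ s t → + p *ᶻ (s -ᶻ t)) (sym (ℤₚ.pos-* u v)) (sym (ℤₚ.pos-* l c)) ⟩
  + p *ᶻ (+ (u * v) -ᶻ + (l * c))               ≡⟨ distrib (+ p) (+ (u * v)) (+ (l * c)) ⟩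
  + p *ᶻ + (u * v) -ᶻ + p *ᶻ + (l * c)          ≡⟨ cong₂ _-ᶻ_ (sym (ℤₚ.pos-* p (u * v))) (sym (ℤₚ.pos-* p (l * c))) ⟩
  + (p * (u * v)) -ᶻ + (p * (l * c))            ≡⟨ cong (λ s → + s -ᶻ + (p * (l * c))) eq ⟩
  + (w + p * (l * c)) -ᶻ + (p * (l * c))        ≡⟨ cong (_-ᶻ + (p * (l * c))) (ℤₚ.pos-+ w (p * (l * c))) ⟩
  (+ w +ᶻ + (p * (l * c))) -ᶻ + (p * (l * c))   ≡⟨ cancel (+ w) (+ (p * (l * c))) ⟩
  + w ∎
  where
  open ≡-Reasoning
  distrib : ∀ p s t → p *ᶻ (s -ᶻ t) ≡ p *ᶻ s -ᶻ p *ᶻ t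
  distrib = ℤ-Solver.solve-∀
  cancel : ∀ s t → (s +ᶻ t) -ᶻ t ≡ s
  cancel = ℤ-Solver.solve-∀

module Shape (n k x ℓ σ : ℕ) (k+x≡n : k + x ≡ n) (2≤k : 2 ≤ k)
  (split : suc x * ℓ + σ ≡ n choose k) (boolean : x ≡ 0 → ℓ ≡ 0) (a : ℕ → ℤ)
  (a-below : ∀ i c b → i + suc b ≡ k → i + suc c ≡ n → 2 * i < k →
    a i ≡ + (n choose i) *ᶻ + (c choose b) -ᶻ + ℓ *ᶻ + (k choose i))
  (a-middle : ∀ m c → suc m + suc m ≡ k → suc m + suc c ≡ n →
    a (suc m) ≡ + (n choose suc m) *ᶻ + (c choose m) -ᶻ + ℓ *ᶻ + (k choose m))
  (a-sym : ∀ i j → i + j ≡ k → a i ≡ a j) where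

  α : ℕ → ℕ
  α i = absᶻ (a i)

  n-size : ∀ i b → i + suc b ≡ k → i + suc (b + x) ≡ n
  n-size i b eq = trans (sym (+-assoc i (suc b) x)) (trans (cong (_+ x) eq) k+x≡n)

  -- Multiplying by `n - i` collects the product of two binomials into `C(k,i) C(n,k)`, and `split`
  -- then expresses `C(n,k)` through `ℓ` and `σ`.
  leading : ∀ i b → i + suc b ≡ k → (suc b + x) * ((n choose i) * ((b + x) choose b)) ≡ suc b * (k choose i) * (suc x * ℓ + σ)
  leading i b refl = begin
    (suc b + x) * (A * ((b + x) choose b))      ≡⟨ regroup₁ (suc b + x) A ((b + x) choose b) ⟩
    A * ((suc b + x) * ((b + x) choose b))      ≡⟨ cong (A *_) (absorption b x) ⟩
    A * (suc b * (suc (b + x) choose suc b))    ≡⟨ regroup₁ A (suc b) (suc (b + x) choose suc b) ⟩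
    suc b * (A * (suc (b + x) choose suc b))    ≡⟨ cong (λ N → suc b * ((N choose i) * (suc (b + x) choose suc b))) (n-size i b refl) ⟨
    suc b * (((i + (suc b + x)) choose i) * ((suc b + x) choose suc b))
                                                ≡⟨ cong (suc b *_) (choose-choose i (suc b) x) ⟩
    suc b * (((i + suc b + x) choose (i + suc b)) * (k choose i))
                                                ≡⟨ cong (λ N → suc b * ((N choose k) * (k choose i))) k+x≡n ⟩
    suc b * ((n choose k) * (k choose i))       ≡⟨ cong (suc b *_) (*-comm (n choose k) (k choose i)) ⟩
    suc b * ((k choose i) * (n choose k))       ≡⟨ *-assoc (suc b) (k choose i) (n choose k) ⟨
    suc b * (k choose i) * (n choose k)         ≡⟨ cong (suc b * (k choose i) *_) split ⟨
    suc b * (k choose i) * (suc x * ℓ + σ) ∎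
    where
    open ≡-Reasoning
    A = n choose i
    regroup₁ : ∀ p q r → p * (q * r) ≡ q * (p * r)
    regroup₁ = ℕ-Solver.solve-∀

  2*-≡ : ∀ i → 2 * i ≡ i + i
  2*-≡ i = cong (λ j → i + j) (+-identityʳ i)

  below : ∀ i b → i + suc b ≡ k → i + i < k → a i ≡ + α i × (suc b + x) * α i ≡ (k choose i) * weight (x * ℓ) σ b
  below i b eq i+i<k = natural-quotient (b + x) (a i) _
    (trans (cong (+ (suc b + x) *ᶻ_) (a-below i (b + x) b eq (n-size i b eq) (subst (_< k) (sym (2*-≡ i)) i+i<k)))
      (lift-difference (suc b + x) (n choose i) ((b + x) choose b) ℓ (k choose i) (trans (leading i b eq) (regroup b (k choose i) x ℓ σ))))
    where
    -- The origin of `weight`: subtracting `(n - i) λ C(k,i)` leaves `(b+1)(x+1) - (b+1+x) = b x` as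
    -- the coefficient of `ℓ`.
    regroup : ∀ b c x ℓ σ → suc b * c * (suc x * ℓ + σ) ≡ c * (b * (x * ℓ) + suc b * σ) + (suc b + x) * (ℓ * c)
    regroup = ℕ-Solver.solve-∀

  middle : ∀ m → suc m + suc m ≡ k →
    a (suc m) ≡ + α (suc m) × (suc m + x) * α (suc m) ≡ (k choose m) * middleWeight x ℓ σ (suc m)
  middle m eq = natural-quotient (m + x) (a (suc m)) _
    (trans (cong (+ (suc m + x) *ᶻ_) (a-middle m (m + x) eq (n-size (suc m) m eq)))
      (lift-difference (suc m + x) (n choose suc m) ((m + x) choose m) ℓ (k choose m) (trans (leading (suc m) m eq)
        (trans (cong (_* (suc x * ℓ + σ)) step) (regroup m (k choose m) x ℓ σ)))))
    where
    step : suc m * (k choose suc m) ≡ suc (suc m) * (k choose m)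
    step = subst (λ r → suc m * (r choose suc m) ≡ suc (suc m) * (r choose m)) (trans (+-suc m (suc m)) eq) (choose-step m (suc m))
    -- The origin of `middleWeight`: `step` brings the leading term to the binomial `C(k,m)` of the
    -- `λ` term, and `(m+2)(x+1) - (m+1+x) = (m+1) x + 1`.
    regroup : ∀ m c x ℓ σ → suc (suc m) * c * (suc x * ℓ + σ) ≡ c * (suc (suc m * x) * ℓ + suc (suc m) * σ) + (suc m + x) * (ℓ * c)
    regroup = ℕ-Solver.solve-∀

  α-sym : ∀ i j → i + j ≡ k → α i ≡ α j
  α-sym i j eq = cong absᶻ (a-sym i j eq)

  choose-step-k : ∀ i b → i + suc b ≡ k → suc i * (k choose suc i) ≡ suc b * (k choose i)
  choose-step-k i b refl = choose-step i b

  rise : ∀ i → suc i + suc i ≤ k → α i ≤ α (suc i)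
  rise i le with m≤n⇒m<n∨m≡n le
  ... | inj₂ eq = cancel-≤ (suc (suc i) + x) (suc i + x) {α i} {α (suc i)}
          (proj₂ (below i (suc i) (trans (+-suc i (suc i)) eq) (≤-trans (s≤s (+-monoʳ-≤ i (n≤1+n i))) (≤-reflexive eq))))
          (proj₂ (middle i eq)) (rise-middle-bound (suc i) x ℓ σ (k choose i))
  ... | inj₁ lt with m≤n⇒∃[o]m+o≡n lt
  ...   | d , eq = cancel-≤ (suc (suc b) + x) (suc b + x) {α i} {α (suc i)}
          (proj₂ (below i (suc b) i+b≡ (≤-<-trans (+-mono-≤ (n≤1+n i) (n≤1+n i)) lt)))
          (proj₂ (below (suc i) b (trans (sym (+-suc i (suc b))) i+b≡) lt))
          (rise-bound i b x (x * ℓ) σ (k choose i) (k choose suc i) (m≤m+n (suc i) d) (choose-step-k i (suc b) i+b≡))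
    where
    b = suc i + d
    regroup : ∀ i d → i + suc (suc (suc i + d)) ≡ suc (suc i + suc i) + d
    regroup = ℕ-Solver.solve-∀
    i+b≡ : i + suc (suc b) ≡ k
    i+b≡ = trans (regroup i d) eq

  lc : ∀ i → (2 + i) + (2 + i) ≤ k → α i * α (2 + i) ≤ α (1 + i) * α (1 + i)
  lc i le with m≤n⇒m<n∨m≡n le
  ... | inj₂ eq = cancel-square-≤ (2 + M + x) (suc M + x) (M + x) {α i} {α (1 + i)} {α (2 + i)}
          (proj₂ (below i (suc M) e₀ (<-≤-trans (s≤s (+-monoʳ-≤ i (≤-trans (n≤1+n i) (n≤1+n (suc i))))) (≤-trans (n≤1+n _) (≤-reflexive eq)))))
          (proj₂ (below (1 + i) M e₁ (<-≤-trans (s≤s (s≤s (+-monoʳ-≤ i (n≤1+n (suc i))))) (≤-reflexive eq))))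
          (proj₂ (middle (1 + i) eq)) bound
    where
    M = 2 + i
    e₀ : i + suc (suc M) ≡ k
    e₀ = trans (+-suc i (suc M)) (trans (cong suc (+-suc i M)) eq)
    e₁ : 1 + i + suc M ≡ k
    e₁ = trans (cong suc (+-suc i M)) eq
    c₀ = k choose i
    c₁ = k choose (1 + i)
    w₁ = weight (x * ℓ) σ M
    w₂ = weight (x * ℓ) σ (suc M)
    v = middleWeight x ℓ σ M
    P = (suc M + x) * (suc M + x)
    R = (2 + M + x) * (M + x)
    bound : c₀ * w₂ * (c₁ * v) * P ≤ c₁ * w₁ * (c₁ * w₁) * R
    bound = *-cancelˡ-≤ (2 + M) (begin
      (2 + M) * (c₀ * w₂ * (c₁ * v) * P)       ≡⟨ regroup₁ (2 + M) c₀ w₂ c₁ v P ⟩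
      (2 + M) * c₀ * c₁ * (w₂ * v) * P         ≡⟨ cong (λ z → z * c₁ * (w₂ * v) * P) (choose-step-k i (suc M) e₀) ⟨
      suc i * c₁ * c₁ * (w₂ * v) * P           ≡⟨ regroup₂ (suc i) c₁ (w₂ * v) P ⟩
      c₁ * c₁ * (suc i * (w₂ * v) * P)         ≤⟨ *-monoʳ-≤ (c₁ * c₁) (middle-weights-bound i x ℓ σ boolean) ⟩
      c₁ * c₁ * ((2 + M) * (w₁ * w₁) * R)      ≡⟨ regroup₃ (2 + M) c₁ w₁ R ⟩
      (2 + M) * (c₁ * w₁ * (c₁ * w₁) * R) ∎)
      where
      open ≤-Reasoning
      regroup₁ : ∀ s c w d v p → s * (c * w * (d * v) * p) ≡ s * c * d * (w * v) * p
      regroup₁ = ℕ-Solver.solve-∀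
      regroup₂ : ∀ s c w p → s * c * c * w * p ≡ c * c * (s * w * p)
      regroup₂ = ℕ-Solver.solve-∀
      regroup₃ : ∀ s c w p → c * c * (s * (w * w) * p) ≡ s * (c * w * (c * w) * p)
      regroup₃ = ℕ-Solver.solve-∀
  ... | inj₁ lt with m≤n⇒∃[o]m+o≡n lt
  ...   | d , eq = cancel-square-≤ (3 + b + x) (2 + b + x) (1 + b + x) {α i} {α (1 + i)} {α (2 + i)}
          (proj₂ (below i (2 + b) e₀ (≤-<-trans (+-mono-≤ (≤-trans (n≤1+n i) (n≤1+n (suc i))) (≤-trans (n≤1+n i) (n≤1+n (suc i)))) lt)))
          (proj₂ (below (1 + i) (1 + b) e₁ (≤-<-trans (+-mono-≤ (n≤1+n (suc i)) (n≤1+n (suc i))) lt)))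
          (proj₂ (below (2 + i) b (trans (cong suc (sym (+-suc i (suc b)))) e₁) lt))
          (log-concave-bound i b x (x * ℓ) σ (k choose i) (k choose (1 + i)) (k choose (2 + i))
            (sym (choose-step-k i (2 + b) e₀)) (choose-step-k (1 + i) (1 + b) e₁))
    where
    b = 2 + i + d
    regroup : ∀ i d → i + suc (suc (suc (2 + i + d))) ≡ suc ((2 + i) + (2 + i)) + d
    regroup = ℕ-Solver.solve-∀
    e₀ : i + suc (2 + b) ≡ k
    e₀ = trans (regroup i d) eq
    e₁ : 1 + i + suc (1 + b) ≡ k
    e₁ = trans (sym (+-suc i (2 + b))) e₀

  by-symmetry : (P : ℕ → Set) → (∀ i j → i + j ≡ k → P i → P j) → (∀ i b → i + suc b ≡ k → i + i < k → P i) →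
                (∀ m → suc m + suc m ≡ k → P (suc m)) → ∀ i → i ≤ k → P i
  by-symmetry P sym′ lo mid i i≤k with m≤n⇒∃[o]m+o≡n i≤k
  ... | j , eq = by-order i j eq (<-cmp i j)
    where
    lower : ∀ i j → i + j ≡ k → i < j → P i
    lower i (suc b) eq i<j = lo i b eq (<-≤-trans (+-monoʳ-< i i<j) (≤-reflexive eq))
    by-order : ∀ i j → i + j ≡ k → Tri (i < j) (i ≡ j) (j < i) → P i
    by-order i       j eq (tri< i<j _ _)  = lower i j eq i<j
    by-order i       j eq (tri> _ _ j<i)  = sym′ j i (trans (+-comm j i) eq) (lower j i (trans (+-comm j i) eq) j<i)
    -- A middle index 0 would force `k = 0`.
    by-order zero    _ eq (tri≈ _ refl _) = contradiction (subst (2 ≤_) (sym eq) 2≤k) λ ()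
    by-order (suc m) _ eq (tri≈ _ refl _) = mid m eq

  a-natural : ∀ i → i ≤ k → a i ≡ + α i
  a-natural = by-symmetry (λ i → a i ≡ + α i)
    (λ i j eq h → trans (sym (a-sym i j eq)) (trans h (cong +_ (α-sym i j eq))))
    (λ i b eq lt → proj₁ (below i b eq lt)) (λ m eq → proj₁ (middle m eq))

  -- If `x * ℓ` vanishes then so does `ℓ`, by `boolean` when `x = 0`; then `split` makes `σ` equal
  -- to `C(n,k)`, which is nonzero.
  not-both-zero : x * ℓ ≡ 0 → σ ≢ 0
  not-both-zero xℓ≡0 refl = choose-nonzero (subst (k ≤_) k+x≡n (m≤m+n k x)) (trans (sym split)
    (trans (+-identityʳ (ℓ + x * ℓ)) (cong₂ _+_ ℓ≡0 xℓ≡0)))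
    where
    ℓ≡0 : ℓ ≡ 0
    ℓ≡0 = [ boolean , id ]′ (m*n≡0⇒m≡0∨n≡0 x xℓ≡0)

  product-nonzero : ∀ p {z c w} → p * z ≡ c * w → c ≢ 0 → w ≢ 0 → z ≢ 0
  product-nonzero p {c = c} eq c≢0 w≢0 refl = [ c≢0 , w≢0 ]′ (m*n≡0⇒m≡0∨n≡0 c (trans (sym eq) (*-zeroʳ p)))

  α-nonzero : ∀ i → i ≤ k → α i ≢ 0
  α-nonzero = by-symmetry (λ i → α i ≢ 0) (λ i j eq h z → h (trans (α-sym i j eq) z))
    (λ i b eq lt → product-nonzero (suc b + x) (proj₂ (below i b eq lt)) (choose-nonzero (subst (i ≤_) eq (m≤m+n i (suc b)))) (weight-nonzero i b eq lt))
    (λ m eq → product-nonzero (suc m + x) (proj₂ (middle m eq)) (choose-nonzero (≤-trans (n≤1+n m) (subst (suc m ≤_) eq (m≤m+n (suc m) (suc m)))))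
      (λ z → not-both-zero
        (trans (cong (x *_) ([ (λ ()) , id ]′ (m*n≡0⇒m≡0∨n≡0 (suc (suc m * x)) (m+n≡0⇒m≡0 _ z)))) (*-zeroʳ x))
        ([ (λ ()) , id ]′ (m*n≡0⇒m≡0∨n≡0 (suc (suc m)) (m+n≡0⇒n≡0 (suc (suc m * x) * ℓ) z)))))
    where
    weight-nonzero : ∀ i b → i + suc b ≡ k → i + i < k → weight (x * ℓ) σ b ≢ 0
    -- With `b = 0` the condition `i + i < k` gives `i = 0` and `k = 1`.
    weight-nonzero i zero    eq lt _ = contradiction 2≤k (<⇒≱ (subst (_< 2) eq (subst (_< 2) (sym (+-comm i 1)) (s≤s i<1))))
      where
      i<1 : i < 1
      i<1 = +-cancelˡ-< i i 1 (subst (i + i <_) (sym eq) lt)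
    weight-nonzero i (suc b) eq lt z = not-both-zero
      ([ (λ ()) , id ]′ (m*n≡0⇒m≡0∨n≡0 (suc b) (m+n≡0⇒m≡0 _ z)))
      ([ (λ ()) , id ]′ (m*n≡0⇒m≡0∨n≡0 (suc (suc b)) (m+n≡0⇒n≡0 (suc b * (x * ℓ)) z)))

  open Symmetric k α α-sym rise lc

  lift-≤ : ∀ i j → i ≤ k → j ≤ k → α i ≤ α j → a i ≤ᶻ a j
  lift-≤ i j i≤k j≤k le = subst₂ _≤ᶻ_ (sym (a-natural i i≤k)) (sym (a-natural j j≤k)) (+≤+ le)

  unimodal : Unimodal k a
  unimodal with half k
  ... | j , lo , hi = j , ≤-trans (m≤m+n j j) lo , up , down
    where
    up : ∀ i → i < j → a i ≤ᶻ a (suc i)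
    up i i<j = lift-≤ i (suc i) (≤-trans (n≤1+n i) i+1≤k) i+1≤k (rise i i+1+i+1≤k)
      where
      i+1+i+1≤k = ≤-trans (+-mono-≤ i<j i<j) lo
      i+1≤k = ≤-trans (m≤m+n (suc i) (suc i)) i+1+i+1≤k
    down : ∀ i → j ≤ i → i < k → a (suc i) ≤ᶻ a i
    down i j≤i i<k with m≤n⇒∃[o]m+o≡n i<k
    ... | d , eq = lift-≤ (suc i) i i<k (<⇒≤ i<k) (fall i d eq
      (+-cancelˡ-≤ (suc i) d i (≤-trans (≤-reflexive eq) (≤-trans hi (s≤s (+-mono-≤ j≤i j≤i))))))

  logConcave : LogConcave k a
  logConcave i lt with m≤n⇒∃[o]m+o≡n lt
  ... | d , eq = subst₂ _≤ᶻ_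
    (trans (ℤₚ.pos-* (α i) (α (2 + i))) (sym (cong₂ _*ᶻ_ (a-natural i (≤-trans (n≤1+n i) (<⇒≤ lt))) (a-natural (2 + i) lt))))
    (trans (ℤₚ.pos-* (α (1 + i)) (α (1 + i))) (sym (cong₂ _*ᶻ_ (a-natural (1 + i) (<⇒≤ lt)) (a-natural (1 + i) (<⇒≤ lt)))))
    (+≤+ (log-concave i d eq))

  noInternalZeros : NoInternalZeros k a
  noInternalZeros i j l _ j<l l≤k _ _ z = α-nonzero j (≤-trans (<⇒≤ j<l) l≤k) (cong absᶻ z)

-- Rank functions of sparse paving matroids, and the theorem

-- By induction all smaller subsets of `A` are independent, so a dependent `A` would be a circuit
-- smaller than the rank. Asking only for the bound by size lets this apply to the dual without its
-- matroid axioms.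
paving-small : ∀ {n} (N : RawMatroid n) → (∀ A → A ⊆ E N → rk N A ≤ ∣ A ∣) → Paving N →
               ∀ m A → ∣ A ∣ < m → A ⊆ E N → ∣ A ∣ < rank N → rk N A ≡ ∣ A ∣
paving-small N bound paving (suc m) A (s≤s A≤m) A⊆E small with rk N A ≟ ∣ A ∣
... | yes eq = eq
... | no  ne = contradiction (paving A (A⊆E , ≤∧≢⇒< (bound A A⊆E) ne , λ D D⊆A D<A →
      ⊆-trans D⊆A A⊆E , paving-small N bound paving m D (<-≤-trans D<A A≤m) (⊆-trans D⊆A A⊆E) (<-trans D<A small)))
    (<⇒≱ small)

module _ {n} (rk : Subset n → ℕ) (isM : IsMatroid (mkRaw ⊤ rk)) (sparse : SparsePaving (mkRaw ⊤ rk)) where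

  open IsMatroid isM

  private
    N = mkRaw ⊤ rk

  rank-small : ∀ A → ∣ A ∣ < rk ⊤ → rk A ≡ ∣ A ∣
  rank-small A = paving-small N R1 (proj₁ sparse) (suc ∣ A ∣) A ≤-refl ⊆⊤

  -- The complement of `A` is smaller than the rank of the dual, hence independent there, and the
  -- dual rank formula then says that `A` spans. The empty complement is treated apart because a
  -- dual rank 0 could come from truncation.
  rank-large : ∀ A → rk ⊤ < ∣ A ∣ → rk A ≡ rk ⊤
  rank-large A k<A with ∣ ∁ A ∣ ≟ 0
  ... | yes z = cong rk (∣p∣≡n⇒p≡⊤ (≤-antisym (∣p∣≤n A) (m∸n≡0⇒m≤n (trans (sym (∣∁p∣≡n∸∣p∣ A)) z))))
  ... | no nz = +-cancelˡ-≡ ∣ ∁ A ∣ (rk A) (rk ⊤) (begin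
    (∣ ∁ A ∣ + rk A)                       ≡⟨ m∸n+n≡m k≤ ⟨
    ((∣ ∁ A ∣ + rk A) ∸ rk ⊤) + rk ⊤       ≡⟨ cong (_+ rk ⊤) dual-value ⟩
    (∣ ∁ A ∣ + rk ⊤) ∎)
    where
    open ≡-Reasoning
    ⊤─∁A : ⊤ ─ ∁ A ≡ A
    ⊤─∁A = ⊆-antisym (λ x∈ → x∉∁p⇒x∈p (x∈p─q⇒x∉q ⊤ (∁ A) x∈)) (λ x∈ → x∈p∧x∉q⇒x∈p─q ∈⊤ (x∈p⇒x∉∁p x∈))
    rk⊥ : rk (⊤ ─ ⊤) ≡ 0
    rk⊥ = n≤0⇒n≡0 (≤-trans (R1 (⊤ ─ ⊤) ⊆⊤) (≤-reflexive (trans (cong ∣_∣ (p─⊤≡⊥ (⊤ {n}))) (∣⊥∣≡0 n))))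
    dual-rank : rank (dual N) ≡ n ∸ rk ⊤
    dual-rank = cong (_∸ rk ⊤) (trans (cong₂ _+_ (∣⊤∣≡n n) rk⊥) (+-identityʳ n))
    dual-bound : ∀ B → B ⊆ ⊤ → RawMatroid.rk (dual N) B ≤ ∣ B ∣
    dual-bound B _ = ≤-trans (∸-monoˡ-≤ (rk ⊤) (+-monoʳ-≤ ∣ B ∣ (R2 (⊤ ─ B) ⊤ ⊆⊤ ⊆⊤))) (≤-reflexive (m+n∸n≡m ∣ B ∣ (rk ⊤)))
    ∁A-small : ∣ ∁ A ∣ < rank (dual N)
    ∁A-small = subst₂ _<_ (sym (∣∁p∣≡n∸∣p∣ A)) (sym dual-rank) (∸-monoʳ-< k<A (∣p∣≤n A))
    dual-value : (∣ ∁ A ∣ + rk A) ∸ rk ⊤ ≡ ∣ ∁ A ∣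
    dual-value = trans (cong (λ X → (∣ ∁ A ∣ + rk X) ∸ rk ⊤) (sym ⊤─∁A))
      (paving-small (dual N) dual-bound (proj₂ sparse) (suc ∣ ∁ A ∣) (∁ A) ≤-refl ⊆⊤ ∁A-small)
    k≤ : rk ⊤ ≤ ∣ ∁ A ∣ + rk A
    -- The dual rank of `∁ A` is nonzero, so the subtraction was not truncated.
    k≤ = ≮⇒≥ (λ lt → nz (trans (sym dual-value) (m≤n⇒m∸n≡0 (<⇒≤ lt))))

deleteLoops-loopless : ∀ {n} (rk : Subset n → ℕ) → Loopless (mkRaw ⊤ rk) → deleteLoops (mkRaw ⊤ rk) ≡ mkRaw ⊤ rk
deleteLoops-loopless rk loopless = cong (λ X → mkRaw X rk) (⊆-antisym ⊆⊤ (λ {e} _ → x∈p∩q⁺ (∈⊤ ,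
  lookup⇒[]= e _ (trans (lookup∘tabulate (λ e → not (rk ⁅ e ⁆ ≡ᵇ 0)) e) (cong (λ r → not (r ≡ᵇ 0)) (loopless e ∈⊤))))))

module _ {n} (rk : Subset n → ℕ) (isM : IsMatroid (mkRaw ⊤ rk)) (sparse : SparsePaving (mkRaw ⊤ rk))
  (Q : RawMatroid n → Poly) (isQ : IsInverseKL Q) (k₁ : ℕ) (0<k₁ : 0 < k₁) (rk⊤ : rk ⊤ ≡ suc k₁) where

  private
    small : ∀ A → ∣ A ∣ < suc k₁ → rk A ≡ ∣ A ∣
    small A lt = rank-small rk isM sparse A (subst (∣ A ∣ <_) (sym rk⊤) lt)

    large : ∀ A → suc k₁ < ∣ A ∣ → rk A ≡ suc k₁
    large A lt = trans (rank-large rk isM sparse A (subst (_< ∣ A ∣) (sym rk⊤) lt)) rk⊤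

    -- In rank at least 2 a singleton is smaller than the rank, hence independent; so `deleteLoops`
    -- changes nothing.
    loopless : Loopless (mkRaw ⊤ rk)
    loopless e _ = trans (small ⁅ e ⁆ (subst (_< suc k₁) (sym (∣⁅x⁆∣≡1 e)) (s≤s 0<k₁))) (∣⁅x⁆∣≡1 e)

  open SparsePavingY rk isM loopless Q isQ k₁ 0<k₁ rk⊤ small large

  private
    a : Poly
    a = Y Q (mkRaw ⊤ rk)

    a≡ : ∀ i → a i ≡ sign k *ᶻ y ⊤ i
    a≡ i = trans (cong (λ N → Yloopless Q N i) (deleteLoops-loopless rk loopless))
             (trans (Yloopless-y ⊤ i) (cong (λ r → sign r *ᶻ y ⊤ i) rk⊤))

    ℓ : ℕ
    ℓ = absᶻ λᶜ

    λᶜ≡ : λᶜ ≡ + ℓ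
    λᶜ≡ = sym (ℤₚ.0≤i⇒+∣i∣≡i (ℤₚ.≤-trans (ℤₚ.≤-reflexive (sym (Σˢ-zero n))) (Σˢ-mono (λ C → nonneg (CH C)))))
      where
      nonneg : ∀ b → + 0 ≤ᶻ [ b ] (+ 1)
      nonneg true  = +≤+ z≤n
      nonneg false = ℤₚ.≤-refl

    x : ℕ
    x = n ∸ k

    k+x≡n : k + x ≡ n
    k+x≡n = m+[n∸m]≡n k≤n

    -- The incidence bound `λ k ≤ C(n,k-1)` is transported by `k C(n,k) = (n-k+1) C(n,k-1)`; its
    -- slack becomes `σ`.
    ℓ-bound : suc x * ℓ ≤ n choose k
    ℓ-bound = *-cancelˡ-≤ k (begin
      k * (suc x * ℓ)             ≡⟨ regroup k (suc x) ℓ ⟩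
      suc x * (ℓ * k)             ≤⟨ *-monoʳ-≤ (suc x) (ℤₚ.drop‿+≤+ (subst (_≤ᶻ + (n choose k₁))
                                       (trans (cong (_*ᶻ + k) λᶜ≡) (sym (ℤₚ.pos-* ℓ k))) CH-bound)) ⟩
      suc x * (n choose k₁)       ≡⟨ subst (λ N → k * (N choose k) ≡ suc x * (N choose k₁)) (trans (+-suc k₁ x) k+x≡n) (choose-step k₁ x) ⟨
      k * (n choose k) ∎)
      where
      open ≤-Reasoning
      regroup : ∀ k s l → k * (s * l) ≡ s * (l * k)
      regroup = ℕ-Solver.solve-∀

    a-sym : ∀ i j → i + j ≡ k → a i ≡ a j
    a-sym i j eq = begin
      a i                         ≡⟨ a≡ i ⟩
      sign k *ᶻ y ⊤ i             ≡⟨ cong (sign k *ᶻ_) (y-palindromic (suc ∣ ⊤ {n} ∣) ≤-refl ⊆⊤ i (subst (i ≤_) (trans eq (sym rk⊤)) (m≤m+n i j))) ⟨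
      sign k *ᶻ y ⊤ (rk ⊤ ∸ i)    ≡⟨ cong (λ r → sign k *ᶻ y ⊤ r) (trans (cong (_∸ i) (trans rk⊤ (sym eq))) (m+n∸m≡n i j)) ⟩
      sign k *ᶻ y ⊤ j             ≡⟨ a≡ j ⟨
      a j ∎
      where open ≡-Reasoning

    ℓ-zero : x ≡ 0 → ℓ ≡ 0
    ℓ-zero z = cong absᶻ (λᶜ-zero (trans (sym k+x≡n) (trans (cong (λ d → k + d) z) (+-identityʳ k))))

    open Shape n k x ℓ (n choose k ∸ suc x * ℓ) k+x≡n (s≤s 0<k₁) (m+[n∸m]≡n ℓ-bound) ℓ-zero a
      (λ i c b e₁ e₂ lt → trans (a≡ i) (trans (Y-below-middle i c b e₁ e₂ lt) (cong (λ l → + (n choose i) *ᶻ + (c choose b) -ᶻ l *ᶻ + (k choose i)) λᶜ≡)))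
      (λ m c e₁ e₂ → trans (a≡ (suc m)) (trans (Y-middle m c e₁ e₂) (cong (λ l → + (n choose suc m) *ᶻ + (c choose m) -ᶻ l *ᶻ + (k choose m)) λᶜ≡)))
      a-sym

  sparse-paving-shape : Unimodal (suc k₁) a × (LogConcave (suc k₁) a × NoInternalZeros (suc k₁) a)
  sparse-paving-shape = unimodal , logConcave , noInternalZeros

-- At most two coefficients: log-concavity and internal zeros are vacuous, and the peak is the
-- larger of the two. This covers the ranks in which a sparse paving matroid may have loops.
short-shape : ∀ k (a : Poly) → k ≤ 1 → Unimodal k a × (LogConcave k a × NoInternalZeros k a)
short-shape k a k≤1 = short-unimodal k k≤1 ,
  (λ i lt → contradiction (≤-trans lt k≤1) λ { (s≤s ()) }) ,
  (λ i j l i<j j<l l≤k _ _ _ → <⇒≱ (≤-<-trans (≤-trans (s≤s z≤n) i<j) j<l) (≤-trans l≤k k≤1))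
  where
  short-unimodal : ∀ k → k ≤ 1 → Unimodal k a
  short-unimodal zero _ = 0 , z≤n , (λ _ ()) , (λ _ _ ())
  short-unimodal (suc zero) _ with ℤₚ.≤-total (a 0) (a 1)
  ... | inj₁ up   = 1 , ≤-refl , (λ { zero _ → up ; (suc _) (s≤s ()) }) , (λ { zero () _ ; (suc _) _ (s≤s ()) })
  ... | inj₂ down = 0 , z≤n , (λ _ ()) , (λ { zero _ _ → down ; (suc _) _ (s≤s ()) })
  short-unimodal (suc (suc _)) (s≤s ())

theorem1p6 : (n k : ℕ) (M : RawMatroid n) → IsMatroid M → E M ≡ ⊤ → rank M ≡ k →
    SparsePaving M → (Q : RawMatroid n → Poly) → IsInverseKL Q →
    Unimodal k (Y Q M) × (LogConcave k (Y Q M) × NoInternalZeros k (Y Q M))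
theorem1p6 n zero          M isM E≡⊤ rank≡k sparse Q isQ = short-shape 0 (Y Q M) z≤n
theorem1p6 n (suc zero)    M isM E≡⊤ rank≡k sparse Q isQ = short-shape 1 (Y Q M) ≤-refl
theorem1p6 n (suc (suc k)) (mkRaw _ rk) isM refl rank≡k sparse Q isQ =
  sparse-paving-shape rk isM sparse Q isQ (suc k) z<s rank≡k
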